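{- Let $\diamondsuit\in\{\varnothing,\square,\mathrm{h},\mathrm{v}\}$, let $n\ge 1$ and let $\nu=(\nu_1,\dots,\nu_n)\in\mathbb{Z}^n$. Then $$B^{\diamondsuit}_{\nu_1}B^{\diamondsuit}_{\nu_2}\cdots B^{\diamondsuit}_{\nu_n}\,1 \;=\; B^{\diamondsuit}_{\nu}\,1\;=\;s^{\diamondsuit}_\nu[X].$$
   Context: $\Lambda$ is the ring of symmetric functions in $X=x_1+x_2+\cdots$ (rational coefficients, extended by auxiliary indeterminates as needed), with the scalar product $\langle\cdot,\cdot\rangle$ for which Schur functions are orthonormal. Plethystic notation: $P[A]$ is obtained from $P\in\Lambda$ by expressing $P$ in power sums and replacing $p_k$ by $p_k[A]$, where $p_k[A]$ raises every indeterminate in $A$ to the $k$-th power and $p_k[A-B]=p_k[A]-p_k[B]$; $\Omega[A]=\exp(\sum_{k\ge1}p_k[A]/k)$, so that $\Omega[A-B]=\prod_{b\in B}(1-b)/\prod_{a\in A}(1-a)$ when $A,B$ are sums of monomials. $P^\perp$ is the operator on $\Lambda$ adjoint to multiplication by $P$ (skewing is always in the $X$ variables and extends to infinite sums of homogeneous pieces); in particular $\Omega[XA]^\perp P[X]=P[X+A]$. The four symbols: $\varnothing$; $\square$ (single cell); $\mathrm{h}$ (horizontal domino); $\mathrm{v}$ (vertical domino). Put $f_\varnothing=0$, $f_\square=s_1+s_{(1^2)}$, $f_{\mathrm{h}}=s_2$, $f_{\mathrm{v}}=s_{(1^2)}$, so that $\Omega[-f_{\mathrm v}[X]]=\prod_{i<j}(1-x_ix_j)$,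 $\Omega[-f_{\mathrm h}[X]]=\prod_{i\le j}(1-x_ix_j)$, $\Omega[-f_\square[X]]=\prod_i(1-x_i)\prod_{i<j}(1-x_ix_j)$. For $\nu\in\mathbb{Z}^n$ let $s_\nu=\det(s_{\nu_i-i+j})_{1\le i,j\le n}$, where $s_r$ is the complete homogeneous symmetric function for $r\ge0$ and $s_r=0$ for $r<0$. Put $s^\diamondsuit_\nu=\Omega[-f_\diamondsuit]^\perp s_\nu$. Bernstein's operators $B_r\in\mathrm{End}(\Lambda)$ ($r\in\mathbb{Z}$) are defined by $\sum_{r\in\mathbb{Z}}B_rz^r=\Omega[zX]\,\Omega[-z^{ -1}X]^\perp$ (skew, then multiply). For $\nu\in\mathbb{Z}^n$, $B_\nu=B_{\nu_1}\circ\cdots\circ B_{\nu_n}$ and $$B^\diamondsuit_\nu=\Omega[-f_\diamondsuit]^\perp\circ B_\nu\circ\Omega[f_\diamondsuit]^\perp .$$ -}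

module Defs where

open import Algebra.Bundles.Raw using (RawRing)
import Algebra.Definitions.RawSemiring as RawSemiringDefs
open import Algebra.Properties.CommutativeSemigroup using (interchange)
open import Data.Bool.Base using (T; true; false; if_then_else_)
open import Data.Fin.Base using (Fin; zero; suc; toℕ; punchIn)
open import Data.Fin.Properties using (toℕ<n)
open import Data.Integer.Base as ℤ using (ℤ; +_; -[1+_])
open import Data.List.Base using (List; []; _∷_; map)
open import Data.List.Relation.Binary.Permutation.Propositional
  using (_↭_; refl; prep; swap; trans; ↭-sym)
open import Data.List.Relation.Binary.Permutation.Propositional.Properties
  using (All-resp-↭; map⁺)
open import Data.List.Relation.Unary.All using (All; _∷_; all?)
open import Data.List.Relation.Unary.Linked using (Linked)
open import Data.Nat.Base as ℕ using (ℕ; zero; suc; _∸_; _≡ᵇ_; _!)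
open import Data.Nat.Divisibility using (_∣?_; _∣0)
open import Data.Nat.ListAction renaming (sum to degree)
open import Data.Nat.ListAction.Properties using (sum-↭)
import Data.Nat.Properties as ℕₚ
open import Data.Rational.Base as ℚ using (ℚ; 0ℚ; 1ℚ)
import Data.Rational.Properties as ℚₚ
open import Algebra.Properties.CommutativeMonoid.Sum ℚₚ.+-0-commutativeMonoid
  using (sum; ∑-comm; sum-cong-≗; sum-replicate-zero)
open import Data.Vec.Base as Vec using (Vec; []; _∷_; lookup; fromList)
open import Function.Base using (_∘_; _∘′_; id)
open import Level using (0ℓ)
open import Relation.Binary.PropositionalEquality as ≡
  using (_≡_; _≢_; cong; cong₂; module ≡-Reasoning)
open import Relation.Nullary.Decidable.Core using (does; yes; no)
open import Relation.Nullary.Negation.Core using (contradiction)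

∑≤ : ℕ → (ℕ → ℚ) → ℚ
∑≤ n f = sum {suc n} (f ∘ toℕ)

-- Power series in x₁, x₂, …: the exponent list a₁ ∷ … ∷ aₘ ∷ [] stands for
-- x₁^a₁ ⋯ xₘ^aₘ, and a series sends it to its coefficient.

Series : Set
Series = List ℕ → ℚ

-- Cauchy product: F ∘ (a ∷_) is the coefficient of x₁^a in F, a series in
-- the remaining variables.

mul : Series → Series → Series
mul F G []      = F [] ℚ.* G []
mul F G (a ∷ α) = ∑≤ a λ i → mul (F ∘ (i ∷_)) (G ∘ ((a ∸ i) ∷_)) α

-- An exponent list does not change its monomial when zeros are appended.
-- Given invariance under permutations this amounts to `pad`, which puts
-- the zero in front.

record IsSymmetric (F : Series) : Set where
  field
    perm : ∀ {α β} → α ↭ β → F α ≡ F β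
    pad  : ∀ α → F (0 ∷ α) ≡ F α

open IsSymmetric

HasDegree≤ : ℕ → Series → Set
HasDegree≤ d F = ∀ α → d ℕ.< degree α → F α ≡ 0ℚ

∑≤-cong : ∀ n {f g : ℕ → ℚ} → (∀ i → f i ≡ g i) → ∑≤ n f ≡ ∑≤ n g
∑≤-cong n f≗g = sum-cong-≗ {suc n} (f≗g ∘ toℕ)

∑≤-zero : ∀ n {f : ℕ → ℚ} → (∀ (i : Fin (suc n)) → f (toℕ i) ≡ 0ℚ) → ∑≤ n f ≡ 0ℚ
∑≤-zero n f≗0 =
  ≡.trans (sum-cong-≗ {suc n} f≗0) (sum-replicate-zero (suc n))

mul-cong : ∀ {F F′ G G′ : Series} → (∀ α → F α ≡ F′ α) → (∀ α → G α ≡ G′ α) →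
           ∀ α → mul F G α ≡ mul F′ G′ α
mul-cong p q []      = cong₂ ℚ._*_ (p []) (q [])
mul-cong p q (a ∷ α) = ∑≤-cong a λ i → mul-cong (λ β → p (i ∷ β)) (λ β → q (a ∸ i ∷ β)) α

mul-perm : ∀ {F G : Series} →
           (∀ {α β} → α ↭ β → F α ≡ F β) → (∀ {α β} → α ↭ β → G α ≡ G β) →
           ∀ {α β} → α ↭ β → mul F G α ≡ mul F G β
mul-perm p q refl       = ≡.refl
mul-perm p q (prep a r) =
  ∑≤-cong a λ i → mul-perm (λ s → p (prep i s)) (λ s → q (prep (a ∸ i) s)) r
mul-perm {F} {G} p q {a ∷ b ∷ α} {b ∷ a ∷ β} (swap a b r) = begin
  ∑≤ a (λ i → ∑≤ b λ j → mul (λ γ → F (i ∷ j ∷ γ)) (λ γ → G (a ∸ i ∷ b ∸ j ∷ γ)) α)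
    ≡⟨ ∑-comm {suc a} {suc b} (λ i j →
         mul (λ γ → F (toℕ i ∷ toℕ j ∷ γ)) (λ γ → G (a ∸ toℕ i ∷ b ∸ toℕ j ∷ γ)) α) ⟩
  ∑≤ b (λ j → ∑≤ a λ i → mul (λ γ → F (i ∷ j ∷ γ)) (λ γ → G (a ∸ i ∷ b ∸ j ∷ γ)) α)
    ≡⟨ ∑≤-cong b (λ j → ∑≤-cong a λ i → ≡.trans
         (mul-cong (λ γ → p (swap i j refl)) (λ γ → q (swap (a ∸ i) (b ∸ j) refl)) α)
         (mul-perm (λ s → p (prep j (prep i s))) (λ s → q (prep (b ∸ j) (prep (a ∸ i) s))) r)) ⟩
  ∑≤ b (λ j → ∑≤ a λ i → mul (λ γ → F (j ∷ i ∷ γ)) (λ γ → G (b ∸ j ∷ a ∸ i ∷ γ)) β)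
    ∎ where open ≡-Reasoning
mul-perm p q (trans r s) = ≡.trans (mul-perm p q r) (mul-perm p q s)

mul-symmetric : ∀ {F G} → IsSymmetric F → IsSymmetric G → IsSymmetric (mul F G)
mul-symmetric F-sym G-sym .perm = mul-perm (F-sym .perm) (G-sym .perm)
mul-symmetric F-sym G-sym .pad α =
  ≡.trans (ℚₚ.+-identityʳ _) (mul-cong (F-sym .pad) (G-sym .pad) α)

mul-degree : ∀ d e {F G} → HasDegree≤ d F → HasDegree≤ e G → HasDegree≤ (d ℕ.+ e) (mul F G)
mul-degree d e {F} {G} F≤ G≤ α d+e<α =
  go 0 0 α F≤ G≤ d+e<α
  where
  -- F and G are slices, with i and j the exponents already used up.
  go : ∀ {F G} i j α →
       (∀ β → d ℕ.< i ℕ.+ degree β → F β ≡ 0ℚ) →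
       (∀ β → e ℕ.< j ℕ.+ degree β → G β ≡ 0ℚ) →
       d ℕ.+ e ℕ.< (i ℕ.+ j) ℕ.+ degree α → mul F G α ≡ 0ℚ
  go {F} {G} i j [] f g lt with d ℕₚ.<? i | e ℕₚ.<? j
  ... | yes d<i | _       = ≡.trans (cong (ℚ._* G []) (f [] (≡.subst (d ℕ.<_) (≡.sym (ℕₚ.+-identityʳ i)) d<i))) (ℚₚ.*-zeroˡ (G []))
  ... | no _    | yes e<j = ≡.trans (cong (F [] ℚ.*_) (g [] (≡.subst (e ℕ.<_) (≡.sym (ℕₚ.+-identityʳ j)) e<j))) (ℚₚ.*-zeroʳ (F []))
  ... | no d≮i  | no e≮j  = contradiction
          (≡.subst (d ℕ.+ e ℕ.<_) (ℕₚ.+-identityʳ (i ℕ.+ j)) lt)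
          (ℕₚ.≤⇒≯ (ℕₚ.+-mono-≤ (ℕₚ.≮⇒≥ d≮i) (ℕₚ.≮⇒≥ e≮j)))
  go {F} {G} i j (a ∷ α) f g lt =
    ∑≤-zero a {λ k → mul (F ∘ (k ∷_)) (G ∘ ((a ∸ k) ∷_)) α} λ k′ →
    let k = toℕ k′
        k≤a : k ℕ.≤ a
        k≤a = ℕ.s≤s⁻¹ (toℕ<n k′)
        eq : (i ℕ.+ k ℕ.+ (j ℕ.+ (a ∸ k))) ≡ i ℕ.+ j ℕ.+ a
        eq = ≡.trans (interchange ℕₚ.+-commutativeSemigroup i k j (a ∸ k)) (cong (i ℕ.+ j ℕ.+_) (ℕₚ.m+[n∸m]≡n k≤a))
    in go (i ℕ.+ k) (j ℕ.+ (a ∸ k)) α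
         (λ β h → f (k ∷ β) (≡.subst (d ℕ.<_) (ℕₚ.+-assoc i k (degree β)) h))
         (λ β h → g (a ∸ k ∷ β) (≡.subst (e ℕ.<_) (ℕₚ.+-assoc j (a ∸ k) (degree β)) h))
         (≡.subst (d ℕ.+ e ℕ.<_)
            (≡.trans (≡.sym (ℕₚ.+-assoc (i ℕ.+ j) a (degree α))) (cong (ℕ._+ degree α) (≡.sym eq))) lt)

-- Λ̂: symmetric series of unbounded degree, i.e. infinite sums of
-- homogeneous symmetric functions of increasing degrees

record Λ̂ : Set where
  constructor mkΛ̂
  field
    coeff     : Series
    symmetric : IsSymmetric coeff

open Λ̂ public

-- byDegree c = Σ_r c r · h_r

byDegree : (ℕ → ℚ) → Λ̂
byDegree c .coeff α            = c (degree α)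
byDegree c .symmetric .perm r  = cong c (sum-↭ r)
byDegree c .symmetric .pad α   = ≡.refl

pointwise₂ : (ℚ → ℚ → ℚ) → Λ̂ → Λ̂ → Λ̂
pointwise₂ _∙_ F G .coeff α           = F .coeff α ∙ G .coeff α
pointwise₂ _∙_ F G .symmetric .perm r = cong₂ _∙_ (F .symmetric .perm r) (G .symmetric .perm r)
pointwise₂ _∙_ F G .symmetric .pad α  = cong₂ _∙_ (F .symmetric .pad α) (G .symmetric .pad α)

pointwise : (ℚ → ℚ) → Λ̂ → Λ̂
pointwise f F = pointwise₂ (λ x _ → f x) F F

_*̂_ : Λ̂ → Λ̂ → Λ̂
(F *̂ G) .coeff     = mul (F .coeff) (G .coeff)
(F *̂ G) .symmetric = mul-symmetric (F .symmetric) (G .symmetric)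

δ : ℕ → ℕ → ℚ
δ m n = if m ≡ᵇ n then 1ℚ else 0ℚ

Λ̂-rawRing : RawRing 0ℓ 0ℓ
Λ̂-rawRing = record
  { Carrier = Λ̂
  ; _≈_     = λ F G → ∀ α → F .coeff α ≡ G .coeff α
  ; _+_     = pointwise₂ ℚ._+_
  ; _*_     = _*̂_
  ; -_      = pointwise (λ x → ℚ.- x)
  ; 0#      = byDegree λ _ → 0ℚ
  ; 1#      = byDegree (δ 0)
  }

module Λ̂ʳ where
  open RawRing Λ̂-rawRing public using (_≈_; _+_; _*_; -_; 0#; 1#; rawSemiring)
  open RawSemiringDefs rawSemiring public using (_^_)

-- Σ_{m ≥ 0} F m, for families in which F m has no term of degree < m.

∑∞ : (ℕ → Λ̂) → Λ̂
∑∞ F .coeff α           = ∑≤ (degree α) λ m → F m .coeff α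
∑∞ F .symmetric .perm {α} {β} r = ≡.trans
  (cong (λ d → ∑≤ d λ m → F m .coeff α) (sum-↭ r))
  (∑≤-cong (degree β) λ m → F m .symmetric .perm r)
∑∞ F .symmetric .pad α  = ∑≤-cong (degree α) λ m → F m .symmetric .pad α

-- p_k[A] for k = suc j: every variable of A is raised to the k-th power.

p[1+_]_ : ℕ → Λ̂ → Λ̂
(p[1+ j ] A) .coeff α =
  if does (all? (suc j ∣?_) α) then A .coeff (map (ℕ._/ suc j) α) else 0ℚ
(p[1+ j ] A) .symmetric .perm {α} {β} r with all? (suc j ∣?_) α | all? (suc j ∣?_) β
... | yes _ | yes _ = A .symmetric .perm (map⁺ _ r)
... | yes u | no ¬v = contradiction (All-resp-↭ r u) ¬v
... | no ¬u | yes v = contradiction (All-resp-↭ (↭-sym r) v) ¬u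
... | no _  | no _  = ≡.refl
(p[1+ j ] A) .symmetric .pad α with all? (suc j ∣?_) α | all? (suc j ∣?_) (0 ∷ α)
... | yes _ | yes _       = A .symmetric .pad (map (ℕ._/ suc j) α)
... | yes u | no ¬v       = contradiction ((suc j ∣0) ∷ u) ¬v
... | no ¬u | yes (_ ∷ v) = contradiction v ¬u
... | no _  | no _        = ≡.refl

scale : ℚ → Λ̂ → Λ̂
scale c = pointwise (c ℚ.*_)

-- exp G = Σ_m G^m / m!, for G without constant term.

exp : Λ̂ → Λ̂
exp G = ∑∞ λ m → scale (ℚ._/_ (+ 1) (m !) {{ℕₚ._!≢0 m}}) (G Λ̂ʳ.^ m)

-- Ω[A] = exp (Σ_{k ≥ 1} p_k[A] / k), for A without constant term.

Ω[_] : Λ̂ → Λ̂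
Ω[ A ] = exp (∑∞ λ where
  zero    → Λ̂ʳ.0#
  (suc j) → scale (+ 1 ℚ./ suc j) (p[1+ j ] A))

-- Symmetric functions are the symmetric series of bounded degree; `bound`
-- need not be the exact degree.

record Λ : Set where
  constructor mkΛ
  field
    series  : Λ̂
    bound   : ℕ
    bounded : HasDegree≤ bound (series .coeff)

open Λ public

component : ℕ → Λ̂ → Λ
component d F .series  = pointwise₂ ℚ._*_ (byDegree (δ d)) F
component d F .bound   = d
component d F .bounded α d<α = ≡.trans
  (cong (ℚ._* F .coeff α) (δ-≢ (ℕₚ.<⇒≢ d<α)))
  (ℚₚ.*-zeroˡ (F .coeff α))
  where
  δ-≢ : ∀ {m n} → m ≢ n → δ m n ≡ 0ℚ
  δ-≢ {m} {n} m≢n with m ≡ᵇ n in eq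
  ... | false = ≡.refl
  ... | true  = contradiction (ℕₚ.≡ᵇ⇒≡ m n (≡.subst T (≡.sym eq) _)) m≢n

infix  4 _≈_
infixl 6 _+_
infixl 7 _*_ _·_
infix  8 -_

_≈_ : Λ → Λ → Set
F ≈ G = F .series Λ̂ʳ.≈ G .series

_+_ : Λ → Λ → Λ
(F + G) .series  = F .series Λ̂ʳ.+ G .series
(F + G) .bound   = F .bound ℕ.⊔ G .bound
(F + G) .bounded α lt = cong₂ ℚ._+_
  (F .bounded α (ℕₚ.≤-<-trans (ℕₚ.m≤m⊔n _ _) lt))
  (G .bounded α (ℕₚ.≤-<-trans (ℕₚ.m≤n⊔m _ _) lt))

_*_ : Λ → Λ → Λ
(F * G) .series  = F .series Λ̂ʳ.* G .series
(F * G) .bound   = F .bound ℕ.+ G .bound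
(F * G) .bounded = mul-degree (F .bound) (G .bound) (F .bounded) (G .bounded)

_·_ : ℚ → Λ → Λ
(c · F) .series  = scale c (F .series)
(c · F) .bound   = F .bound
(c · F) .bounded α lt = ≡.trans (cong (c ℚ.*_) (F .bounded α lt)) (ℚₚ.*-zeroʳ c)

-_ : Λ → Λ
(- F) .series  = Λ̂ʳ.- F .series
(- F) .bound   = F .bound
(- F) .bounded α lt = cong (λ x → ℚ.- x) (F .bounded α lt)

0Λ 1Λ : Λ
0Λ = mkΛ Λ̂ʳ.0# 0 (λ _ _ → ≡.refl)
1Λ = mkΛ Λ̂ʳ.1# 0 λ α 0<α → helper (degree α) 0<α
  where
  helper : ∀ m → 0 ℕ.< m → δ 0 m ≡ 0ℚ
  helper (suc m) _ = ≡.refl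

Λ-rawRing : RawRing 0ℓ 0ℓ
Λ-rawRing = record
  { Carrier = Λ ; _≈_ = _≈_ ; _+_ = _+_ ; _*_ = _*_ ; -_ = -_ ; 0# = 0Λ ; 1# = 1Λ }

module Λʳ = RawSemiringDefs (RawRing.rawSemiring Λ-rawRing)

-- Laplace expansion along the first row.

det : ∀ {n} → (Fin n → Fin n → Λ) → Λ
det {zero}  M = 1Λ
det {suc n} M = Λʳ.sum λ j →
  (- 1Λ) Λʳ.^ toℕ j * M zero j * det λ i k → M (suc i) (punchIn j k)

-- In degree r ≥ 0, the sum of all monomials of degree r.

h : ℤ → Λ
h (+ r)    = component r (byDegree λ _ → 1ℚ)
h -[1+ _ ] = 0Λ

s : ∀ {n} → Vec ℤ n → Λ
s ν = det λ i j → h (lookup ν i ℤ.- + toℕ i ℤ.+ + toℕ j)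

record Partition : Set where
  field
    parts    : List ℕ
    weakly-↓ : Linked ℕ._≥_ parts
    positive : All (0 ℕ.<_) parts

open Partition public

schur : Partition → Λ
schur κ = s (Vec.map +_ (fromList (parts κ)))

-- Since the Schur functions (Jacobi–Trudi determinants of partitions) form a
-- basis of Λ, these fields determine ⟨_,_⟩, and `adjoint` then determines _⊥_
-- up to _≈_; P ⊥ Q is the operator P^⊥ applied to Q.

record ScalarProduct : Set where
  field
    ⟨_,_⟩       : Λ → Λ → ℚ
    ⟨⟩-cong     : ∀ {P P′ Q Q′} → P ≈ P′ → Q ≈ Q′ → ⟨ P , Q ⟩ ≡ ⟨ P′ , Q′ ⟩
    ⟨⟩-sym      : ∀ P Q → ⟨ P , Q ⟩ ≡ ⟨ Q , P ⟩
    ⟨⟩-+        : ∀ P Q R → ⟨ P + Q , R ⟩ ≡ ⟨ P , R ⟩ ℚ.+ ⟨ Q , R ⟩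
    ⟨⟩-·        : ∀ c P R → ⟨ c · P , R ⟩ ≡ c ℚ.* ⟨ P , R ⟩
    normal      : ∀ κ → ⟨ schur κ , schur κ ⟩ ≡ 1ℚ
    orthogonal  : ∀ κ μ → parts κ ≢ parts μ → ⟨ schur κ , schur μ ⟩ ≡ 0ℚ

record Skewing (S : ScalarProduct) : Set where
  open ScalarProduct S
  infix 9 _⊥_
  field
    _⊥_     : Λ → Λ → Λ
    adjoint : ∀ P Q R → ⟨ P ⊥ Q , R ⟩ ≡ ⟨ Q , P * R ⟩

data Symbol : Set where
  ∅ □ 𝗁 𝗏 : Symbol

f : Symbol → Λ
f ∅ = 0Λ
f □ = s (+ 1 ∷ []) + s (+ 1 ∷ + 1 ∷ [])
f 𝗁 = s (+ 2 ∷ [])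
f 𝗏 = s (+ 1 ∷ + 1 ∷ [])

X : Λ̂
X = h (+ 1) .series

module Operators {S : ScalarProduct} (K : Skewing S) where
  open Skewing K

  -- Skewing by an infinite sum: components of Φ of degree above that of P
  -- skew P to 0, so the sum over all components is cut off at P .bound.

  _⊥̂_ : Λ̂ → Λ → Λ
  Φ ⊥̂ P = Λʳ.sum {suc (P .bound)} λ d → component (toℕ d) Φ ⊥ P

  -- Coefficient of zʳ in Ω[zX]: since p_k[zX] = zᵏ p_k[X], the degree in z
  -- is the degree in X. Likewise the coefficient of z⁻ⁱ in Ω[-z⁻¹X] is the
  -- component of degree i of Ω[-X].

  [z^_]Ω[zX] : ℤ → Λ
  [z^ + r      ]Ω[zX] = component r Ω[ X ]
  [z^ -[1+ _ ] ]Ω[zX] = 0Λ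

  [z^-_]Ω[-z⁻¹X] : ℕ → Λ
  [z^- i ]Ω[-z⁻¹X] = component i Ω[ Λ̂ʳ.- X ]

  B : ℤ → Λ → Λ
  B r P = Λʳ.sum {suc (P .bound)} λ i →
    [z^ r ℤ.+ + toℕ i ]Ω[zX] * ([z^- toℕ i ]Ω[-z⁻¹X] ⊥ P)

  composite : ∀ {n} → Vec (Λ → Λ) n → Λ → Λ
  composite = Vec.foldr′ _∘′_ id

  Bᵥ : ∀ {n} → Vec ℤ n → Λ → Λ
  Bᵥ ν = composite (Vec.map B ν)

  B^ : Symbol → ∀ {n} → Vec ℤ n → Λ → Λ
  B^ ◇ ν P = Ω[ Λ̂ʳ.- f ◇ .series ] ⊥̂ Bᵥ ν (Ω[ f ◇ .series ] ⊥̂ P)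

  s^ : Symbol → ∀ {n} → Vec ℤ n → Λ
  s^ ◇ ν = Ω[ Λ̂ʳ.- f ◇ .series ] ⊥̂ s ν

module Submission where

-- Skewing is determined by ⟨ h_α , F ⟩ = [x^α] F, where h_α = h_α₁ h_α₂ ⋯.
-- To derive this from the orthonormality of the Schur functions, read a series
-- in x₁, x₂, … as a power series in x₁ whose coefficients are its slices
-- F (m ∷_). Column operations give h_k[x₁ + X] - x₁ h_{k-1}[x₁ + X] = h_k[X] and
-- show that slicing s_μ at m = μ₁ yields s_(μ₂, μ₃, …), and at m > μ₁ yields 0.
-- Hence the Schur functions span Λ, and pairing the h-expansion of s_κ with s_μ
-- by coefficient extraction gives δ_{κ μ}.
--
-- The same column operations, with the row 1, x₁, x₁², … on top, show that
-- e_k^⊥ turns the maximal minor omitting column 0 of a matrix with rows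
-- h_a, h_{a+1}, … into the minor omitting column k. So B_r s_ν is the Laplace
-- expansion of s_(r, ν) along its first row, and B_ν 1 = s_ν. Finally
-- Ω[-f]^⊥ and Ω[f]^⊥ are mutually inverse, so conjugation by them telescopes.
-- The power series identities for Ω are solved by the Euler derivation.

open import Algebra.Bundles using (CommutativeMonoid; CommutativeRing)
open import Data.Fin.Base as Fin using (Fin; zero; suc; toℕ; fromℕ; inject₁; punchIn; punchOut)
import Data.Fin.Properties as Finₚ
open import Data.Nat.Base as ℕ using (ℕ; zero; suc; _≤_; _∸_; _!; NonZero)
open import Function.Base using (_∘_; const; flip)
open import Relation.Binary.PropositionalEquality as ≡ using (_≡_; _≢_)
open import Relation.Nullary.Decidable.Core using (yes; no; does)
open import Relation.Nullary.Negation.Core using (¬_; contradiction)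

-- Determinants over a commutative ring

-- The scalar product and the skewing are given by axioms only, so nothing can be computed with them
-- before they are expressed through coefficients. Linear functionals on Λ come from expansions in
-- products of h, and these expansions are kept as syntax (`Formal`), so that identities linear in
-- them follow by induction. A second obstacle is the finite cut-offs in `_⊥̂_` and `B`: they use
-- `bound`, which `≈` does not respect, and the bound of `P ⊥ Q` is whatever the given skewing
-- supplies. Both operators are therefore first shown to be insensitive to raising the cut-off; that
-- they respect `≈`, and that skewings compose, follows by moving to a common cut-off.

module Determinant {c ℓ} (R : CommutativeRing c ℓ) where
  open CommutativeRing R hiding (zero)
  open import Relation.Binary.Reasoning.Setoid setoid

  open import Algebra.Solver.Ring.NaturalCoefficients.Default commutativeSemiring
    using (solve; _:+_; _:*_; _:=_; con)

  Row : ℕ → Set c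
  Row n = Fin n → Carrier

  -1# : Carrier
  -1# = - 1#

  -- Inserting (1# + -1#) * y turns identities with signs into semiring identities.
  cancel : ∀ x y → x + (1# + -1#) * y ≈ x
  cancel x y = trans (+-congˡ (trans (*-congʳ (-‿inverseʳ 1#)) (zeroˡ y))) (+-identityʳ x)

  -1#*0# : ∀ x {y} → y ≈ 0# → x + -1# * y ≈ x
  -1#*0# x y≈0 = trans (+-congˡ (trans (*-congˡ y≈0) (zeroʳ _))) (+-identityʳ x)

  -- The nesting a₀ - (a₁ - (a₂ - ⋯)) produces the Laplace signs without powers of -1, so that sums
  -- along a row yield to structural induction.
  alt : ∀ {n} → Row n → Carrier
  alt {zero}  a = 0#
  alt {suc n} a = a zero + -1# * alt (a ∘ suc)

  Matrix : ℕ → Set c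
  Matrix n = Fin n → Row n

  minor : ∀ {n} → Matrix (suc n) → Fin (suc n) → Matrix n
  minor M j i k = M (suc i) (punchIn j k)

  determinant : ∀ {n} → Matrix n → Carrier
  determinant {zero}  M = 1#
  determinant {suc n} M = alt λ j → M zero j * determinant (minor M j)

  alt-cong : ∀ {n} {a b : Row n} → (∀ j → a j ≈ b j) → alt a ≈ alt b
  alt-cong {zero}  p = refl
  alt-cong {suc n} p = +-cong (p zero) (*-congˡ (alt-cong (p ∘ suc)))

  alt-linear : ∀ {n} t (a b : Row n) → alt (λ j → a j + t * b j) ≈ alt a + t * alt b
  alt-linear {zero}  t a b = sym (trans (+-identityˡ _) (zeroʳ t))
  alt-linear {suc n} t a b = begin
    (a zero + t * b zero) + -1# * alt (λ j → a (suc j) + t * b (suc j))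
      ≈⟨ +-congˡ (*-congˡ (alt-linear t (a ∘ suc) (b ∘ suc))) ⟩
    (a zero + t * b zero) + -1# * (alt (a ∘ suc) + t * alt (b ∘ suc))
      ≈⟨ lemma -1# t (a zero) (b zero) (alt (a ∘ suc)) (alt (b ∘ suc)) ⟩
    alt a + t * alt b ∎
    where
    lemma : ∀ e t x y u v → (x + t * y) + e * (u + t * v) ≈ (x + e * u) + t * (y + e * v)
    lemma = solve 6 (λ e t x y u v → (x :+ t :* y) :+ e :* (u :+ t :* v) := (x :+ e :* u) :+ t :* (y :+ e :* v)) refl

  alt-zero : ∀ {n} {a : Row n} → (∀ j → a j ≈ 0#) → alt a ≈ 0#
  alt-zero {zero}  p = refl
  alt-zero {suc n} p = trans (-1#*0# _ (alt-zero (p ∘ suc))) (p zero)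

  alt-head : ∀ {n} (a : Row (suc n)) → (∀ j → a (suc j) ≈ 0#) → alt a ≈ a zero
  alt-head a p = -1#*0# _ (alt-zero p)

  determinant-cong : ∀ {n} {M N : Matrix n} → (∀ i j → M i j ≈ N i j) → determinant M ≈ determinant N
  determinant-cong {zero}  p = refl
  determinant-cong {suc n} p = alt-cong λ j →
    *-cong (p zero j) (determinant-cong λ i k → p (suc i) (punchIn j k))

  -- Induction along the first row. In the term at j = k the entry splits and the minors agree, as
  -- they omit column k; in the other terms the entry is common and the minor still contains column
  -- k, at position `punchOut j≢k`.
  determinant-linear : ∀ {n} k t {M U V : Matrix n} →
    (∀ i → M i k ≈ U i k + t * V i k) →
    (∀ i j → j ≢ k → M i j ≈ U i j) → (∀ i j → j ≢ k → M i j ≈ V i j) →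
    determinant M ≈ determinant U + t * determinant V
  determinant-linear {suc n} k t {M} {U} {V} col U-rest V-rest = trans
    (alt-cong term)
    (alt-linear t (λ j → U zero j * determinant (minor U j)) (λ j → V zero j * determinant (minor V j)))
    where
    split : ∀ t x y d → (x + t * y) * d ≈ x * d + t * (y * d)
    split = solve 4 (λ t x y d → (x :+ t :* y) :* d := x :* d :+ t :* (y :* d)) refl
    split′ : ∀ t m x y → m * (x + t * y) ≈ m * x + t * (m * y)
    split′ = solve 4 (λ t m x y → m :* (x :+ t :* y) := m :* x :+ t :* (m :* y)) refl
    term : ∀ j → M zero j * determinant (minor M j)
               ≈ U zero j * determinant (minor U j) + t * (V zero j * determinant (minor V j))
    term j with j Finₚ.≟ k
    ... | yes ≡.refl = begin
      M zero j * determinant (minor M j)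
        ≈⟨ *-congʳ (col zero) ⟩
      (U zero j + t * V zero j) * determinant (minor M j)
        ≈⟨ split t _ _ _ ⟩
      U zero j * determinant (minor M j) + t * (V zero j * determinant (minor M j))
        ≈⟨ +-cong
             (*-congˡ (determinant-cong λ i l → U-rest (suc i) _ (Finₚ.punchInᵢ≢i j l)))
             (*-congˡ (*-congˡ (determinant-cong λ i l → V-rest (suc i) _ (Finₚ.punchInᵢ≢i j l)))) ⟩
      U zero j * determinant (minor U j) + t * (V zero j * determinant (minor V j)) ∎
    ... | no j≢k = begin
      M zero j * determinant (minor M j)
        ≈⟨ *-congˡ (determinant-linear k′ t col′
             (λ i l l≢k′ → U-rest (suc i) _ (off l≢k′)) (λ i l l≢k′ → V-rest (suc i) _ (off l≢k′))) ⟩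
      M zero j * (determinant (minor U j) + t * determinant (minor V j))
        ≈⟨ split′ t _ _ _ ⟩
      M zero j * determinant (minor U j) + t * (M zero j * determinant (minor V j))
        ≈⟨ +-cong (*-congʳ (U-rest zero j j≢k)) (*-congˡ (*-congʳ (V-rest zero j j≢k))) ⟩
      U zero j * determinant (minor U j) + t * (V zero j * determinant (minor V j)) ∎
      where
      k′ : Fin n
      k′ = punchOut j≢k
      to-k : punchIn j k′ ≡ k
      to-k = Finₚ.punchIn-punchOut j≢k
      col′ : ∀ i → minor M j i k′ ≈ minor U j i k′ + t * minor V j i k′
      col′ i rewrite to-k = col (suc i)
      off : ∀ {l} → l ≢ k′ → punchIn j l ≢ k
      off {l} l≢k′ eq = l≢k′ (Finₚ.punchIn-injective j l k′ (≡.trans eq (≡.sym to-k)))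

  -- Subtract τ b times entry b from entry b + 1, and x from entry 0.

  shear : ∀ {n} → Carrier → Row n → Row (suc n) → Row (suc n)
  shear         x τ v zero    = v zero + -1# * x
  shear {suc n} x τ v (suc b) = shear (τ zero * v zero) (τ ∘ suc) (v ∘ suc) b

  shear-cong : ∀ {n x y} {τ : Row n} (v : Row (suc n)) → x ≈ y → ∀ b → shear x τ v b ≈ shear y τ v b
  shear-cong         v x≈y zero    = +-congˡ (*-congˡ x≈y)
  shear-cong {suc n} v x≈y (suc b) = refl

  -- The multipliers for which shearing a row without its entry j gives the
  -- sheared row without entry j, up to a multiple of the latter in position j.

  merge : ∀ {n} → Fin (suc (suc n)) → Row (suc n) → Row n
  merge         zero          τ k       = τ (suc k)
  merge {suc n} (suc zero)    τ zero    = τ (suc zero) * τ zero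
  merge {suc n} (suc zero)    τ (suc k) = τ (suc (suc k))
  merge {suc n} (suc (suc j)) τ zero    = τ zero
  merge {suc n} (suc (suc j)) τ (suc k) = merge (suc j) (τ ∘ suc) k

  -- The counterpart of `merge` for the front subtrahend: once entry 0 is deleted, entry 1 stands in
  -- front, and v₁ - τ₀ x = (v₁ - τ₀ v₀) + τ₀ (v₀ - x).
  lead : ∀ {n} → Fin (suc (suc n)) → Row (suc n) → Carrier → Carrier
  lead zero    τ x = τ zero * x
  lead (suc j) τ x = x

  shear-merge-off : ∀ {n} x j (τ : Row (suc n)) v l → inject₁ l ≢ j →
    shear (lead j τ x) (merge j τ) (v ∘ punchIn j) l ≈ shear x τ v (punchIn j l)
  shear-merge-off         x zero          τ v zero    l≢j = contradiction ≡.refl l≢j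
  shear-merge-off {suc n} x zero          τ v (suc l) l≢j = refl
  shear-merge-off         x (suc j)       τ v zero    l≢j = refl
  shear-merge-off {suc n} x (suc zero)    τ v (suc l) l≢j = trans
    (shear-cong (λ b → v (suc (punchIn zero b))) (*-assoc _ _ _) l)
    (shear-merge-off (τ zero * v zero) zero (τ ∘ suc) (v ∘ suc) l (l≢j ∘ ≡.cong suc))
  shear-merge-off {suc n} x (suc (suc j)) τ v (suc l) l≢j =
    shear-merge-off (τ zero * v zero) (suc j) (τ ∘ suc) (v ∘ suc) l (l≢j ∘ ≡.cong suc)

  -- In (v_(k+1) - τ_k v_k) + τ_k (v_k - τ_(k-1) v_(k-1)) the deleted entry v_k cancels, and v_(k-1)
  -- is left with the merged multiplier τ_k τ_(k-1).
  shear-merge-on : ∀ {n} x (τ : Row (suc n)) v k →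
    shear (lead (inject₁ k) τ x) (merge (inject₁ k) τ) (v ∘ punchIn (inject₁ k)) k
    ≈ shear x τ v (suc k) + τ k * shear x τ v (inject₁ k)
  shear-merge-on         x τ v zero          = sym (trans
    (lemma -1# x (τ zero) (v zero) (v (suc zero))) (cancel _ _))
    where
    lemma : ∀ e x t y z → (z + e * (t * y)) + t * (y + e * x) ≈ (z + e * (t * x)) + (1# + e) * (t * y)
    lemma = solve 5 (λ e x t y z → (z :+ e :* (t :* y)) :+ t :* (y :+ e :* x) := (z :+ e :* (t :* x)) :+ (con 1 :+ e) :* (t :* y)) refl
  shear-merge-on {suc n} x τ v (suc zero)    = trans
    (shear-cong {τ = λ b → τ (suc (suc b))} (λ b → v (suc (punchIn zero b))) (*-assoc _ _ _) zero)
    (shear-merge-on (τ zero * v zero) (τ ∘ suc) (v ∘ suc) zero)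
  shear-merge-on {suc n} x τ v (suc (suc k)) =
    shear-merge-on (τ zero * v zero) (τ ∘ suc) (v ∘ suc) (suc k)

  -- Summation by parts: the contribution of `τ k * N′ (suc k)` moves to the next index, where the
  -- alternating sign turns it into the subtraction made by `shear`. The boundary term `x * N′ zero`
  -- returns what `shear` takes from the front entry; x is arbitrary because the tail is sheared
  -- with `τ zero * v zero` in front.
  alt-shear : ∀ {n} x (τ : Row n) v (N N′ : Row (suc n)) →
    (∀ k → N (inject₁ k) ≈ N′ (inject₁ k) + τ k * N′ (suc k)) → N (fromℕ n) ≈ N′ (fromℕ n) →
    alt (λ j → v j * N j) ≈ alt (λ j → shear x τ v j * N′ j) + x * N′ zero
  alt-shear {zero} x τ v N N′ _ last = trans (+-congʳ (*-congˡ last)) (sym (trans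
    (lemma -1# x (v zero) (N′ zero) 0#) (cancel _ _)))
    where
    lemma : ∀ e x v n z → ((v + e * x) * n + e * z) + x * n ≈ (v * n + e * z) + (1# + e) * (x * n)
    lemma = solve 5 (λ e x v n z → ((v :+ e :* x) :* n :+ e :* z) :+ x :* n := (v :* n :+ e :* z) :+ (con 1 :+ e) :* (x :* n)) refl
  alt-shear {suc n} x τ v N N′ step last = begin
    v zero * N zero + -1# * alt (λ j → v (suc j) * N (suc j))
      ≈⟨ +-cong (*-congˡ (step zero))
           (*-congˡ (alt-shear (τ zero * v zero) (τ ∘ suc) (v ∘ suc) (N ∘ suc) (N′ ∘ suc) (step ∘ suc) last)) ⟩
    v zero * (N′ zero + τ zero * N′ (suc zero)) + -1# * (A + τ zero * v zero * N′ (suc zero))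
      ≈⟨ lemma -1# (v zero) (τ zero) (N′ zero) (N′ (suc zero)) A ⟩
    (v zero * N′ zero + -1# * A) + (1# + -1#) * (v zero * (τ zero * N′ (suc zero)))
      ≈⟨ cancel _ _ ⟩
    v zero * N′ zero + -1# * A
      ≈⟨ cancel _ _ ⟨
    (v zero * N′ zero + -1# * A) + (1# + -1#) * (x * N′ zero)
      ≈⟨ lemma′ -1# x (v zero) (N′ zero) A ⟨
    ((v zero + -1# * x) * N′ zero + -1# * A) + x * N′ zero ∎
    where
    A = alt λ j → shear (τ zero * v zero) (τ ∘ suc) (v ∘ suc) j * N′ (suc j)
    lemma : ∀ e v t m n a → v * (m + t * n) + e * (a + t * v * n) ≈ (v * m + e * a) + (1# + e) * (v * (t * n))
    lemma = solve 6 (λ e v t m n a → v :* (m :+ t :* n) :+ e :* (a :+ t :* v :* n) := (v :* m :+ e :* a) :+ (con 1 :+ e) :* (v :* (t :* n))) refl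
    lemma′ : ∀ e x v n z → ((v + e * x) * n + e * z) + x * n ≈ (v * n + e * z) + (1# + e) * (x * n)
    lemma′ = solve 5 (λ e x v n z → ((v :+ e :* x) :* n :+ e :* z) :+ x :* n := (v :* n :+ e :* z) :+ (con 1 :+ e) :* (x :* n)) refl

  punchIn-inject₁ : ∀ {n} (k : Fin n) → punchIn (inject₁ k) k ≡ suc k
  punchIn-inject₁ zero    = ≡.refl
  punchIn-inject₁ (suc k) = ≡.cong suc (punchIn-inject₁ k)

  punchIn-suc : ∀ {n} (k : Fin n) → punchIn (suc k) k ≡ inject₁ k
  punchIn-suc zero    = ≡.refl
  punchIn-suc (suc k) = ≡.cong suc (punchIn-suc k)

  punchIn-suc-off : ∀ {n} (k l : Fin n) → l ≢ k → punchIn (inject₁ k) l ≡ punchIn (suc k) l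
  punchIn-suc-off zero    zero    l≢k = contradiction ≡.refl l≢k
  punchIn-suc-off zero    (suc l) l≢k = ≡.refl
  punchIn-suc-off (suc k) zero    l≢k = ≡.refl
  punchIn-suc-off (suc k) (suc l) l≢k = ≡.cong suc (punchIn-suc-off k l (l≢k ∘ ≡.cong suc))

  lead-0# : ∀ {n} j (τ : Row (suc n)) → 0# ≈ lead j τ 0#
  lead-0# zero    τ = sym (zeroʳ _)
  lead-0# (suc j) τ = refl

  -- All column operations are made at once: by induction on the size, each minor of M may be
  -- sheared with the merged multipliers, and this yields the relation between minors that
  -- `alt-shear` asks for.
  determinant-shear : ∀ {n} (τ : Row n) (M : Matrix (suc n)) →
                      determinant M ≈ determinant (λ i → shear 0# τ (M i))
  determinant-shear {zero} τ M = +-congʳ (*-congʳ (sym (-1#*0# (M zero zero) refl)))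
  determinant-shear {suc n} τ M = trans
    (alt-shear 0# τ (M zero) (determinant ∘ minor M) (determinant ∘ minor M′) step last)
    (trans (+-congˡ (zeroˡ _)) (+-identityʳ _))
    where
    M′ : Matrix (suc (suc n))
    M′ i = shear 0# τ (M i)
    sheared-minor : Fin (suc (suc n)) → Matrix (suc n)
    sheared-minor j i = shear 0# (merge j τ) (minor M j i)
    off : ∀ j i l → inject₁ l ≢ j → sheared-minor j i l ≈ minor M′ j i l
    off j i l l≢j = trans (shear-cong (minor M j i) (lead-0# j τ) l) (shear-merge-off 0# j τ (M (suc i)) l l≢j)
    step : ∀ k → determinant (minor M (inject₁ k))
               ≈ determinant (minor M′ (inject₁ k)) + τ k * determinant (minor M′ (suc k))
    -- The minors of `M′` omitting columns k and k + 1 differ only in position k, where they show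
    -- column k + 1 and column k. The sheared minor of M has the combination of the two in that
    -- position.
    step k = trans (determinant-shear (merge (inject₁ k) τ) (minor M (inject₁ k)))
      (determinant-linear k (τ k) on
        (λ i l l≢k → off (inject₁ k) i l (l≢k ∘ Finₚ.inject₁-injective))
        (λ i l l≢k → trans (off (inject₁ k) i l (l≢k ∘ Finₚ.inject₁-injective))
          (reflexive (≡.cong (M′ (suc i)) (punchIn-suc-off k l l≢k)))))
      where
      on : ∀ i → sheared-minor (inject₁ k) i k
               ≈ minor M′ (inject₁ k) i k + τ k * minor M′ (suc k) i k
      on i rewrite punchIn-inject₁ k | punchIn-suc k =
        trans (shear-cong (minor M (inject₁ k) i) (lead-0# (inject₁ k) τ) k) (shear-merge-on 0# τ (M (suc i)) k)
    last : determinant (minor M (fromℕ (suc n))) ≈ determinant (minor M′ (fromℕ (suc n)))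
    -- With the final column omitted no two sheared columns are merged, so all entries agree with
    -- those of `M′`.
    last = trans (determinant-shear (merge (fromℕ (suc n)) τ) (minor M (fromℕ (suc n))))
      (determinant-cong λ i l → off (fromℕ (suc n)) i l (Finₚ.fromℕ≢inject₁ ∘ ≡.sym))

  determinant-zeroColumn : ∀ {n} (M : Matrix (suc n)) → (∀ i → M i zero ≈ 0#) → determinant M ≈ 0#
  determinant-zeroColumn M p = alt-zero (term M p)
    where
    term : ∀ {n} (M : Matrix (suc n)) → (∀ i → M i zero ≈ 0#) →
           ∀ j → M zero j * determinant (minor M j) ≈ 0#
    term         M p zero    = trans (*-congʳ (p zero)) (zeroˡ _)
    term {suc n} M p (suc j) = trans
      (*-congˡ (alt-zero (term (minor M (suc j)) (p ∘ suc)))) (zeroʳ _)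

  determinant-unitColumn : ∀ {n} (M : Matrix (suc n)) → M zero zero ≈ 1# → (∀ i → M (suc i) zero ≈ 0#) →
                           determinant M ≈ determinant (minor M zero)
  determinant-unitColumn M one null = trans
    (alt-head (λ j → M zero j * determinant (minor M j)) (term M null))
    (trans (*-congʳ one) (*-identityˡ _))
    where
    term : ∀ {n} (M : Matrix (suc n)) → (∀ i → M (suc i) zero ≈ 0#) →
           ∀ j → M zero (suc j) * determinant (minor M (suc j)) ≈ 0#
    term {suc n} M null j = trans
      (*-congˡ (determinant-zeroColumn (minor M (suc j)) null)) (zeroʳ _)

  determinant-unitRow : ∀ {n} (M : Matrix (suc n)) → M zero zero ≈ 1# → (∀ j → M zero (suc j) ≈ 0#) →
                        determinant M ≈ determinant (minor M zero)
  determinant-unitRow M one null = trans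
    (alt-head (λ j → M zero j * determinant (minor M j)) λ j → trans (*-congʳ (null j)) (zeroˡ _))
    (trans (*-congʳ one) (*-identityˡ _))

import Data.Rational.Properties as ℚₚ
open import Defs
open import Algebra.Properties.Semiring.Mult (CommutativeRing.semiring ℚₚ.+-*-commutativeRing)
  using (×-homo-+; ×1-homo-*) renaming (_×_ to _×ℚ_)
open import Data.Bool.Base using (true; false)
open import Data.Integer.Base as ℤ using (ℤ; +_; -[1+_]; _⊖_)
import Data.Integer.Properties as ℤₚ
import Data.Integer.Tactic.RingSolver as ℤSolver
open import Data.List.Base using (List; []; _∷_; length; map)
import Data.List.Properties as Listₚ
import Data.List.Relation.Binary.Permutation.Propositional as ↭
open import Data.List.Relation.Unary.All as All using (All; []; _∷_; all?)
open import Data.List.Relation.Unary.Linked as Linked using (Linked; []; [-]; _∷_)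
open import Data.List.Relation.Unary.Linked.Properties using (Linked⇒All)
open import Data.Nat.DivMod using (m*[n/m]≡n)
open import Data.Nat.Divisibility using (_∣_; _∣?_; _∣0; ∣⇒≤; ∣-refl)
open import Data.Nat.ListAction renaming (sum to degree)
import Data.Nat.Properties as ℕₚ
open import Data.Product.Base using (∃; _×_; _,_; proj₁; proj₂)
open import Data.Rational.Base as ℚ using (ℚ; 0ℚ; 1ℚ; toℚᵘ)
open import Data.Rational.Unnormalised.Base as ℚᵘ using (mkℚᵘ; *≡*)
import Data.Rational.Unnormalised.Properties as ℚᵘₚ
open import Data.Vec.Base as Vec using (Vec; []; _∷_; fromList; lookup)
open import Level using (0ℓ)
open import Relation.Binary.Definitions using (tri<; tri≈; tri>)
open import Relation.Binary.PropositionalEquality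
  using (refl; sym; trans; cong; cong₂; module ≡-Reasoning)
import Algebra.Properties.CommutativeMonoid.Sum ℚₚ.+-0-commutativeMonoid as ℚΣ
import Algebra.Properties.Semiring.Sum (CommutativeRing.semiring ℚₚ.+-*-commutativeRing) as ℚΣ*
open ≡-Reasoning

-- The ring of series

∑≤-+ : ∀ n (a b : ℕ → ℚ) → ∑≤ n (λ i → a i ℚ.+ b i) ≡ ∑≤ n a ℚ.+ ∑≤ n b
∑≤-+ n a b = ℚΣ.∑-distrib-+ {suc n} (a ∘ toℕ) (b ∘ toℕ)

∑≤-*ˡ : ∀ n c (a : ℕ → ℚ) → c ℚ.* ∑≤ n a ≡ ∑≤ n (λ i → c ℚ.* a i)
∑≤-*ˡ n c a = ℚΣ*.*-distribˡ-sum {suc n} c (a ∘ toℕ)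

∑≤-*ʳ : ∀ n c (a : ℕ → ℚ) → ∑≤ n a ℚ.* c ≡ ∑≤ n (λ i → a i ℚ.* c)
∑≤-*ʳ n c a = ℚΣ*.*-distribʳ-sum {suc n} c (a ∘ toℕ)

∑≤-comm : ∀ m n (a : ℕ → ℕ → ℚ) →
          ∑≤ m (λ i → ∑≤ n λ j → a i j) ≡ ∑≤ n (λ j → ∑≤ m λ i → a i j)
∑≤-comm m n a = ℚΣ.∑-comm {suc m} {suc n} λ i j → a (toℕ i) (toℕ j)

∑≤-last : ∀ n (a : ℕ → ℚ) → ∑≤ (suc n) a ≡ ∑≤ n a ℚ.+ a (suc n)
∑≤-last zero    a = trans (sym (ℚₚ.+-assoc (a 0) (a 1) 0ℚ))
  (trans (ℚₚ.+-identityʳ (a 0 ℚ.+ a 1)) (cong (ℚ._+ a 1) (sym (ℚₚ.+-identityʳ (a 0)))))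
∑≤-last (suc n) a = trans (cong (a 0 ℚ.+_) (∑≤-last n (a ∘ suc)))
  (sym (ℚₚ.+-assoc (a 0) _ _))

∑≤-null : ∀ n (a : ℕ → ℚ) → (∀ i → a i ≡ 0ℚ) → ∑≤ n a ≡ 0ℚ
∑≤-null n a a≡0 = ∑≤-zero n {a} (a≡0 ∘ toℕ)

∑≤-head : ∀ n (a : ℕ → ℚ) → (∀ i → a (suc i) ≡ 0ℚ) → ∑≤ n a ≡ a 0
∑≤-head zero    a a≡0 = ℚₚ.+-identityʳ (a 0)
∑≤-head (suc n) a a≡0 = trans (cong (a 0 ℚ.+_) (∑≤-null n (a ∘ suc) a≡0)) (ℚₚ.+-identityʳ (a 0))

-- With the complement n ∸ i as a second argument, `mul` at `a ∷ α` is literally a `conv a`, and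
-- exchanging the factors is a flip of φ.
conv : ℕ → (ℕ → ℕ → ℚ) → ℚ
conv n φ = ∑≤ n λ i → φ i (n ∸ i)

conv-cong : ∀ n {φ ψ : ℕ → ℕ → ℚ} → (∀ i j → φ i j ≡ ψ i j) → conv n φ ≡ conv n ψ
conv-cong n p = ∑≤-cong n λ i → p i (n ∸ i)

conv-+ : ∀ n (φ ψ : ℕ → ℕ → ℚ) → conv n (λ i j → φ i j ℚ.+ ψ i j) ≡ conv n φ ℚ.+ conv n ψ
conv-+ n φ ψ = ∑≤-+ n (λ i → φ i (n ∸ i)) (λ i → ψ i (n ∸ i))

-- Unlike ∑≤-cong, the summands may use i + j ≡ n.
conv-cong′ : ∀ n {φ ψ : ℕ → ℕ → ℚ} →
             (∀ i j → i ℕ.+ j ≡ n → φ i j ≡ ψ i j) → conv n φ ≡ conv n ψ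
conv-cong′ zero    p = cong (ℚ._+ 0ℚ) (p 0 0 refl)
conv-cong′ (suc n) p = cong₂ ℚ._+_ (p 0 (suc n) refl)
  (conv-cong′ n λ i j eq → p (suc i) j (cong suc eq))

conv-last : ∀ n (φ : ℕ → ℕ → ℚ) →
            conv (suc n) φ ≡ conv n (λ i j → φ i (suc j)) ℚ.+ φ (suc n) 0
conv-last zero    φ = ∑≤-last 0 (λ i → φ i (1 ∸ i))
conv-last (suc n) φ = trans (cong (φ 0 (suc (suc n)) ℚ.+_) (conv-last n (φ ∘ suc)))
  (sym (ℚₚ.+-assoc (φ 0 (suc (suc n))) _ _))

conv-comm : ∀ n (φ : ℕ → ℕ → ℚ) → conv n φ ≡ conv n (flip φ)
conv-comm zero    φ = refl
conv-comm (suc n) φ = begin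
  φ 0 (suc n) ℚ.+ conv n (φ ∘ suc)        ≡⟨ ℚₚ.+-comm (φ 0 (suc n)) _ ⟩
  conv n (φ ∘ suc) ℚ.+ φ 0 (suc n)        ≡⟨ cong (ℚ._+ φ 0 (suc n)) (conv-comm n (φ ∘ suc)) ⟩
  conv n (flip (φ ∘ suc)) ℚ.+ φ 0 (suc n) ≡⟨ conv-last n (flip φ) ⟨
  conv (suc n) (flip φ)                   ∎

-- Both sides run over all j + l + k = n; the induction splits off the terms with j = 0.
conv-assoc : ∀ n (φ : ℕ → ℕ → ℕ → ℚ) →
             conv n (λ i k → conv i λ j l → φ j l k) ≡ conv n (λ j m → conv m λ l k → φ j l k)
conv-assoc zero    φ = refl
conv-assoc (suc n) φ = begin
  (φ 0 0 (suc n) ℚ.+ 0ℚ) ℚ.+ conv n (λ i k → φ 0 (suc i) k ℚ.+ conv i λ j l → φ (suc j) l k)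
    ≡⟨ cong₂ ℚ._+_ (ℚₚ.+-identityʳ (φ 0 0 (suc n))) (conv-+ n (φ 0 ∘ suc) λ i k → conv i λ j l → φ (suc j) l k) ⟩
  φ 0 0 (suc n) ℚ.+ (conv n (φ 0 ∘ suc) ℚ.+ conv n (λ i k → conv i λ j l → φ (suc j) l k))
    ≡⟨ ℚₚ.+-assoc (φ 0 0 (suc n)) _ _ ⟨
  conv (suc n) (φ 0) ℚ.+ conv n (λ i k → conv i λ j l → φ (suc j) l k)
    ≡⟨ cong (conv (suc n) (φ 0) ℚ.+_) (conv-assoc n (φ ∘ suc)) ⟩
  conv (suc n) (φ 0) ℚ.+ conv n (λ j m → conv m λ l k → φ (suc j) l k) ∎

mul-∑≤ : ∀ n (F : ℕ → Series) G α → mul (λ β → ∑≤ n λ i → F i β) G α ≡ ∑≤ n (λ i → mul (F i) G α)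
mul-∑≤ n F G []      = ∑≤-*ʳ n (G []) (λ i → F i [])
mul-∑≤ n F G (a ∷ α) = trans
  (∑≤-cong a λ j → mul-∑≤ n (λ i → F i ∘ (j ∷_)) (G ∘ ((a ∸ j) ∷_)) α)
  (∑≤-comm a n λ j i → mul (F i ∘ (j ∷_)) (G ∘ ((a ∸ j) ∷_)) α)

mul-comm : ∀ F G α → mul F G α ≡ mul G F α
mul-comm F G []      = ℚₚ.*-comm (F []) (G [])
mul-comm F G (a ∷ α) = trans
  (conv-comm a λ i j → mul (F ∘ (i ∷_)) (G ∘ (j ∷_)) α)
  (conv-cong a λ i j → mul-comm (F ∘ (j ∷_)) (G ∘ (i ∷_)) α)

mul-∑≤ʳ : ∀ n F (G : ℕ → Series) α → mul F (λ β → ∑≤ n λ i → G i β) α ≡ ∑≤ n (λ i → mul F (G i) α)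
mul-∑≤ʳ n F G α = trans (mul-comm F _ α) (trans (mul-∑≤ n G F α) (∑≤-cong n λ i → mul-comm (G i) F α))

mul-assoc : ∀ F G H α → mul (mul F G) H α ≡ mul F (mul G H) α
mul-assoc F G H []      = ℚₚ.*-assoc (F []) (G []) (H [])
mul-assoc F G H (a ∷ α) = begin
  conv a (λ i k → mul (λ β → conv i λ j l → mul (F ∘ (j ∷_)) (G ∘ (l ∷_)) β) (H ∘ (k ∷_)) α)
    ≡⟨ conv-cong a (λ i k → mul-∑≤ i (λ j → mul (F ∘ (j ∷_)) (G ∘ ((i ∸ j) ∷_))) (H ∘ (k ∷_)) α) ⟩
  conv a (λ i k → conv i λ j l → mul (mul (F ∘ (j ∷_)) (G ∘ (l ∷_))) (H ∘ (k ∷_)) α)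
    ≡⟨ conv-cong a (λ i k → conv-cong i λ j l → mul-assoc (F ∘ (j ∷_)) (G ∘ (l ∷_)) (H ∘ (k ∷_)) α) ⟩
  conv a (λ i k → conv i λ j l → mul (F ∘ (j ∷_)) (mul (G ∘ (l ∷_)) (H ∘ (k ∷_))) α)
    ≡⟨ conv-assoc a (λ j l k → mul (F ∘ (j ∷_)) (mul (G ∘ (l ∷_)) (H ∘ (k ∷_))) α) ⟩
  conv a (λ j m → conv m λ l k → mul (F ∘ (j ∷_)) (mul (G ∘ (l ∷_)) (H ∘ (k ∷_))) α)
    ≡⟨ conv-cong a (λ j m → mul-∑≤ʳ m (F ∘ (j ∷_)) (λ l → mul (G ∘ (l ∷_)) (H ∘ ((m ∸ l) ∷_))) α) ⟨
  conv a (λ j m → mul (F ∘ (j ∷_)) (λ β → conv m λ l k → mul (G ∘ (l ∷_)) (H ∘ (k ∷_)) β) α) ∎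

mul-zeroˡ : ∀ G α → mul (λ _ → 0ℚ) G α ≡ 0ℚ
mul-zeroˡ G []      = ℚₚ.*-zeroˡ (G [])
mul-zeroˡ G (a ∷ α) = ∑≤-null a (λ i → mul (λ _ → 0ℚ) (G ∘ ((a ∸ i) ∷_)) α)
  λ i → mul-zeroˡ (G ∘ ((a ∸ i) ∷_)) α

mul-zeroʳ : ∀ F α → mul F (λ _ → 0ℚ) α ≡ 0ℚ
mul-zeroʳ F α = trans (mul-comm F _ α) (mul-zeroˡ F α)

mul-identityˡ : ∀ F α → mul (δ 0 ∘ degree) F α ≡ F α
mul-identityˡ F []      = ℚₚ.*-identityˡ (F [])
mul-identityˡ F (a ∷ α) = trans
  (∑≤-head a (λ i → mul (δ 0 ∘ degree ∘ (i ∷_)) (F ∘ ((a ∸ i) ∷_)) α) λ i → mul-zeroˡ (F ∘ ((a ∸ suc i) ∷_)) α)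
  (mul-identityˡ (F ∘ (a ∷_)) α)

mul-identityʳ : ∀ F α → mul F (δ 0 ∘ degree) α ≡ F α
mul-identityʳ F α = trans (mul-comm F _ α) (mul-identityˡ F α)

mul-distribʳ : ∀ F G H α → mul (λ β → G β ℚ.+ H β) F α ≡ mul G F α ℚ.+ mul H F α
mul-distribʳ F G H []      = ℚₚ.*-distribʳ-+ (F []) (G []) (H [])
mul-distribʳ F G H (a ∷ α) = trans
  (conv-cong a λ i j → mul-distribʳ (F ∘ (j ∷_)) (G ∘ (i ∷_)) (H ∘ (i ∷_)) α)
  (conv-+ a (λ i j → mul (G ∘ (i ∷_)) (F ∘ (j ∷_)) α) (λ i j → mul (H ∘ (i ∷_)) (F ∘ (j ∷_)) α))

mul-distribˡ : ∀ F G H α → mul F (λ β → G β ℚ.+ H β) α ≡ mul F G α ℚ.+ mul F H α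
mul-distribˡ F G H α = trans (mul-comm F _ α) (trans (mul-distribʳ F G H α)
  (cong₂ ℚ._+_ (mul-comm G F α) (mul-comm H F α)))

mul-scaleˡ : ∀ c F G α → mul (λ β → c ℚ.* F β) G α ≡ c ℚ.* mul F G α
mul-scaleˡ c F G []      = ℚₚ.*-assoc c (F []) (G [])
mul-scaleˡ c F G (a ∷ α) = trans
  (conv-cong a λ i j → mul-scaleˡ c (F ∘ (i ∷_)) (G ∘ (j ∷_)) α)
  (sym (∑≤-*ˡ a c λ i → mul (F ∘ (i ∷_)) (G ∘ ((a ∸ i) ∷_)) α))

mul-scaleʳ : ∀ c F G α → mul F (λ β → c ℚ.* G β) α ≡ c ℚ.* mul F G α
mul-scaleʳ c F G α = trans (mul-comm F _ α) (trans (mul-scaleˡ c G F α) (cong (c ℚ.*_) (mul-comm G F α)))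

-- Symmetry is dropped on purpose: x₁ itself and the series free of x₁ are not symmetric, and the
-- column operations multiply by x₁.
seriesRing : CommutativeRing 0ℓ 0ℓ
seriesRing = record
  { Carrier = Series
  ; _≈_ = λ F G → ∀ α → F α ≡ G α
  ; _+_ = λ F G α → F α ℚ.+ G α
  ; _*_ = mul
  ; -_  = λ F α → ℚ.- F α
  ; 0#  = λ _ → 0ℚ
  ; 1#  = δ 0 ∘ degree
  ; isCommutativeRing = record
    { isRing = record
      { +-isAbelianGroup = record
        { isGroup = record
          { isMonoid = record
            { isSemigroup = record
              { isMagma = record
                { isEquivalence = record
                  { refl  = λ _ → refl
                  ; sym   = λ p α → sym (p α)
                  ; trans = λ p q α → trans (p α) (q α)
                  }
                ; ∙-cong = λ p q α → cong₂ ℚ._+_ (p α) (q α)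
                }
              ; assoc = λ F G H α → ℚₚ.+-assoc (F α) (G α) (H α)
              }
            ; identity = (λ F α → ℚₚ.+-identityˡ (F α)) , (λ F α → ℚₚ.+-identityʳ (F α))
            }
          ; inverse = (λ F α → ℚₚ.+-inverseˡ (F α)) , (λ F α → ℚₚ.+-inverseʳ (F α))
          ; ⁻¹-cong = λ p α → cong ℚ.-_ (p α)
          }
        ; comm = λ F G α → ℚₚ.+-comm (F α) (G α)
        }
      ; *-cong = mul-cong
      ; *-assoc = mul-assoc
      ; *-identity = mul-identityˡ , mul-identityʳ
      ; distrib = mul-distribˡ , mul-distribʳ
      }
    ; *-comm = mul-comm
    }
  }

-- Jacobi–Trudi determinants as power series in x₁

module R = CommutativeRing seriesRing
module D = Determinant seriesRing

⟦_⟧ : Λ → Series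
⟦ F ⟧ = F .series .coeff

H : ℤ → Series
H z = ⟦ h z ⟧

altℚ : ∀ {n} → (Fin n → ℚ) → ℚ
altℚ {zero}  q = 0ℚ
altℚ {suc n} q = q zero ℚ.+ ℚ.- altℚ (q ∘ suc)

altℚ-cong : ∀ {n} {p q : Fin n → ℚ} → (∀ j → p j ≡ q j) → altℚ p ≡ altℚ q
altℚ-cong {zero}  e = refl
altℚ-cong {suc n} e = cong₂ (λ x y → x ℚ.+ ℚ.- y) (e zero) (altℚ-cong (e ∘ suc))

neg-mul : ∀ F α → mul D.-1# F α ≡ ℚ.- F α
neg-mul F = -1*x≈-x F
  where open import Algebra.Properties.Ring R.ring using (-1*x≈-x)

alt-at : ∀ {n} (a : Fin n → Series) α → D.alt a α ≡ altℚ (λ j → a j α)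
alt-at {zero}  a α = refl
alt-at {suc n} a α = cong (a zero α ℚ.+_)
  (trans (neg-mul (D.alt (a ∘ suc)) α) (cong ℚ.-_ (alt-at (a ∘ suc) α)))

minus : ∀ {F G K : Series} → F R.≈ (G R.+ K) → (F R.+ (D.-1# R.* K)) R.≈ G
minus {F} {G} {K} eq α = begin
  F α ℚ.+ mul D.-1# K α         ≡⟨ cong₂ ℚ._+_ (eq α) (neg-mul K α) ⟩
  (G α ℚ.+ K α) ℚ.+ ℚ.- K α     ≡⟨ ℚₚ.+-assoc (G α) (K α) (ℚ.- K α) ⟩
  G α ℚ.+ (K α ℚ.+ ℚ.- K α)     ≡⟨ cong (G α ℚ.+_) (ℚₚ.+-inverseʳ (K α)) ⟩
  G α ℚ.+ 0ℚ                    ≡⟨ ℚₚ.+-identityʳ (G α) ⟩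
  G α                           ∎

-- `det` gives each term an explicit power of -1, whereas `D.alt` nests the signs. The prefix c
-- collects the signs already passed, so that the induction can move to the tail.
signed-sum : ∀ {n} (c : Series) (g A B : Fin n → Λ) →
  (∀ j → ⟦ g j ⟧ R.≈ (c R.* ⟦ (- 1Λ) Λʳ.^ toℕ j ⟧)) →
  ⟦ Λʳ.sum (λ j → g j * A j * B j) ⟧ R.≈ (c R.* D.alt λ j → ⟦ A j ⟧ R.* ⟦ B j ⟧)
signed-sum {zero}  c g A B eq = R.sym (R.zeroʳ c)
signed-sum {suc n} c g A B eq = R.trans
  (R.+-cong
    (R.trans (R.*-congʳ (R.*-congʳ (R.trans (eq zero) (R.*-identityʳ c)))) (R.*-assoc c ⟦ A zero ⟧ ⟦ B zero ⟧))
    (R.trans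
      (signed-sum (c R.* D.-1#) (g ∘ suc) (A ∘ suc) (B ∘ suc)
        λ j → R.trans (eq (suc j)) (R.sym (R.*-assoc c D.-1# ⟦ (- 1Λ) Λʳ.^ toℕ j ⟧)))
      (R.*-assoc c D.-1# tail)))
  (R.sym (R.distribˡ c (⟦ A zero ⟧ R.* ⟦ B zero ⟧) (D.-1# R.* tail)))
  where
  tail : Series
  tail = D.alt λ j → ⟦ A (suc j) ⟧ R.* ⟦ B (suc j) ⟧

det-⟦⟧ : ∀ {n} (M : Fin n → Fin n → Λ) → ⟦ det M ⟧ R.≈ D.determinant (λ i j → ⟦ M i j ⟧)
det-⟦⟧ {zero}  M = R.refl
det-⟦⟧ {suc n} M = R.trans
  (signed-sum R.1# (λ j → (- 1Λ) Λʳ.^ toℕ j) (M zero) (λ j → det λ i k → M (suc i) (punchIn j k))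
    λ j → R.sym (R.*-identityˡ ⟦ (- 1Λ) Λʳ.^ toℕ j ⟧))
  (R.trans (R.*-identityˡ (D.alt λ j → ⟦ M zero j ⟧ R.* ⟦ det (λ i k → M (suc i) (punchIn j k)) ⟧))
    (D.alt-cong λ j → R.*-congˡ {⟦ M zero j ⟧} (det-⟦⟧ (λ i k → M (suc i) (punchIn j k)))))

-- The variable x₁, and series that do not involve it.

t : Series
t []                = 0ℚ
t (0 ∷ α)           = 0ℚ
t (1 ∷ α)           = δ 0 (degree α)
t (suc (suc _) ∷ α) = 0ℚ

ι : Series → Series
ι F []          = F []
ι F (0 ∷ α)     = F α
ι F (suc _ ∷ α) = 0ℚ

t-mul-zero : ∀ F α → mul t F (0 ∷ α) ≡ 0ℚ
t-mul-zero F α = trans (ℚₚ.+-identityʳ _) (mul-zeroˡ (F ∘ (0 ∷_)) α)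

t-mul-suc : ∀ F a α → mul t F (suc a ∷ α) ≡ F (a ∷ α)
t-mul-suc F a α = begin
  mul (λ _ → 0ℚ) (F ∘ (suc a ∷_)) α ℚ.+ ∑≤ a summand
    ≡⟨ cong₂ ℚ._+_ (mul-zeroˡ (F ∘ (suc a ∷_)) α)
         (∑≤-head a summand λ i → mul-zeroˡ (F ∘ ((a ∸ suc i) ∷_)) α) ⟩
  0ℚ ℚ.+ mul (δ 0 ∘ degree) (F ∘ (a ∷_)) α
    ≡⟨ ℚₚ.+-identityˡ (mul (δ 0 ∘ degree) (F ∘ (a ∷_)) α) ⟩
  mul (δ 0 ∘ degree) (F ∘ (a ∷_)) α
    ≡⟨ mul-identityˡ (F ∘ (a ∷_)) α ⟩
  F (a ∷ α) ∎
  where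
  summand : ℕ → ℚ
  summand i = mul (t ∘ (suc i ∷_)) (F ∘ ((a ∸ i) ∷_)) α

-- An integer index lets `m ⊖ j` express the shift by x₁^j, with value 0 for j > m, in step with `h`
-- at negative indices.
slice : ℤ → Series → Series
slice (+ m)    F α = F (m ∷ α)
slice -[1+ _ ] F α = 0ℚ

pow : ℕ → Series
pow zero    = R.1#
pow (suc j) = mul t (pow j)

pow-mul : ∀ j F m α → mul (pow j) F (m ∷ α) ≡ slice (m ⊖ j) F α
pow-mul zero    F m       α = mul-identityˡ F (m ∷ α)
pow-mul (suc j) F zero    α = trans (mul-assoc t (pow j) F (0 ∷ α)) (t-mul-zero (mul (pow j) F) α)
pow-mul (suc j) F (suc m) α = begin
  mul (mul t (pow j)) F (suc m ∷ α) ≡⟨ mul-assoc t (pow j) F (suc m ∷ α) ⟩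
  mul t (mul (pow j) F) (suc m ∷ α) ≡⟨ t-mul-suc (mul (pow j) F) m α ⟩
  mul (pow j) F (m ∷ α)             ≡⟨ pow-mul j F m α ⟩
  slice (m ⊖ j) F α                 ≡⟨ cong (λ z → slice z F α) (ℤₚ.[1+m]⊖[1+n]≡m⊖n m j) ⟨
  slice (suc m ⊖ suc j) F α         ∎

-- A factor free of x₁ acts as a scalar on the coefficients of the powers of x₁.
slice-ι : ∀ m F G α → mul F (ι G) (m ∷ α) ≡ mul (F ∘ (m ∷_)) G α
slice-ι m F G α = trans
  (conv-comm m (λ i j → mul (F ∘ (i ∷_)) (ι G ∘ (j ∷_)) α))
  (∑≤-head m (λ i → mul (F ∘ ((m ∸ i) ∷_)) (ι G ∘ (i ∷_)) α)
    λ i → mul-zeroʳ (F ∘ ((m ∸ suc i) ∷_)) α)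

ι-mul : ∀ F G α → mul (ι F) (ι G) α ≡ ι (mul F G) α
ι-mul F G []          = refl
ι-mul F G (zero ∷ α)  = slice-ι 0 (ι F) G α
ι-mul F G (suc a ∷ α) = trans (slice-ι (suc a) (ι F) G α) (mul-zeroˡ G α)

ι-1 : R.1# R.≈ ι R.1#
ι-1 []          = refl
ι-1 (zero ∷ α)  = refl
ι-1 (suc a ∷ α) = refl

ι-alt : ∀ {n} (a : Fin n → Series) → D.alt (ι ∘ a) R.≈ ι (D.alt a)
ι-alt a []          = trans (alt-at (ι ∘ a) []) (sym (alt-at a []))
ι-alt a (zero ∷ α)  = trans (alt-at (ι ∘ a) (0 ∷ α)) (sym (alt-at a α))
ι-alt a (suc b ∷ α) = trans (alt-at (ι ∘ a) (suc b ∷ α)) (zeros a)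
  where
  zeros : ∀ {n} (a : Fin n → Series) → altℚ (λ j → ι (a j) (suc b ∷ α)) ≡ 0ℚ
  zeros {zero}  a = refl
  zeros {suc n} a = cong (λ x → 0ℚ ℚ.+ ℚ.- x) (zeros (a ∘ suc))

ι-determinant : ∀ {n} (M : Fin n → Fin n → Series) →
                D.determinant (λ i j → ι (M i j)) R.≈ ι (D.determinant M)
ι-determinant {zero}  M = ι-1
ι-determinant {suc n} M = R.trans
  (D.alt-cong λ j → R.trans (R.*-congˡ {ι (M zero j)} (ι-determinant (D.minor M j)))
    (ι-mul (M zero j) (D.determinant (D.minor M j))))
  (ι-alt λ j → M zero j R.* D.determinant (D.minor M j))

infixr 5 _∷ᶜ_

_∷ᶜ_ : ∀ {n m} → (Fin n → Series) → (Fin n → Fin m → Series) → Fin n → Fin (suc m) → Series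
(c ∷ᶜ C) i zero    = c i
(c ∷ᶜ C) i (suc b) = C i b

minor-∷ᶜ : ∀ {n} (c : Fin (suc (suc n)) → Series) C j i k →
           D.minor (c ∷ᶜ C) (suc j) i k R.≈ ((c ∘ suc) ∷ᶜ (λ i k → C (suc i) (punchIn j k))) i k
minor-∷ᶜ c C j i zero    = R.refl
minor-∷ᶜ c C j i (suc k) = R.refl

-- The determinant is linear in column 0, and the other columns are scalars as far as x₁ is
-- concerned. As the expansion runs along the first row, the minors that retain column 0 are treated
-- by recursion.
determinant-slice : ∀ {n} m (c : Fin (suc n) → Series) (C : Fin (suc n) → Fin n → Series) α →
  D.determinant (c ∷ᶜ λ i b → ι (C i b)) (m ∷ α) ≡ D.determinant ((λ i → c i ∘ (m ∷_)) ∷ᶜ C) α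
determinant-slice {n} m c C α = begin
  D.alt (λ j → M zero j R.* D.determinant (D.minor M j)) (m ∷ α)
    ≡⟨ alt-at (λ j → M zero j R.* D.determinant (D.minor M j)) (m ∷ α) ⟩
  altℚ (λ j → mul (M zero j) (D.determinant (D.minor M j)) (m ∷ α))
    ≡⟨ altℚ-cong term ⟩
  altℚ (λ j → mul (N zero j) (D.determinant (D.minor N j)) α)
    ≡⟨ alt-at (λ j → N zero j R.* D.determinant (D.minor N j)) α ⟨
  D.alt (λ j → N zero j R.* D.determinant (D.minor N j)) α ∎
  where
  M N : Fin (suc n) → Fin (suc n) → Series
  M = c ∷ᶜ λ i b → ι (C i b)
  N = (λ i → c i ∘ (m ∷_)) ∷ᶜ C
  minor-slice : ∀ {n} c (C : Fin (suc n) → Fin n → Series) j →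
    (D.determinant (D.minor (c ∷ᶜ λ i b → ι (C i b)) (suc j)) ∘ (m ∷_))
    R.≈ D.determinant (D.minor ((λ i → c i ∘ (m ∷_)) ∷ᶜ C) (suc j))
  minor-slice {suc n} c C j β = begin
    D.determinant (D.minor (c ∷ᶜ λ i b → ι (C i b)) (suc j)) (m ∷ β)
      ≡⟨ D.determinant-cong (minor-∷ᶜ c (λ i b → ι (C i b)) j) (m ∷ β) ⟩
    D.determinant ((c ∘ suc) ∷ᶜ λ i b → ι (C (suc i) (punchIn j b))) (m ∷ β)
      ≡⟨ determinant-slice m (c ∘ suc) (λ i b → C (suc i) (punchIn j b)) β ⟩
    D.determinant ((λ i → c (suc i) ∘ (m ∷_)) ∷ᶜ (λ i b → C (suc i) (punchIn j b))) β
      ≡⟨ D.determinant-cong (minor-∷ᶜ (λ i → c i ∘ (m ∷_)) C j) β ⟨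
    D.determinant (D.minor ((λ i → c i ∘ (m ∷_)) ∷ᶜ C) (suc j)) β ∎
  term : ∀ j → mul (M zero j) (D.determinant (D.minor M j)) (m ∷ α)
             ≡ mul (N zero j) (D.determinant (D.minor N j)) α
  term zero = trans
    (R.*-congˡ {c zero} (ι-determinant λ i b → C (suc i) b) (m ∷ α))
    (slice-ι m (c zero) (D.determinant λ i b → C (suc i) b) α)
  term (suc j) = begin
    mul (ι (C zero j)) (D.determinant (D.minor M (suc j))) (m ∷ α)
      ≡⟨ mul-comm (ι (C zero j)) (D.determinant (D.minor M (suc j))) (m ∷ α) ⟩
    mul (D.determinant (D.minor M (suc j))) (ι (C zero j)) (m ∷ α)
      ≡⟨ slice-ι m (D.determinant (D.minor M (suc j))) (C zero j) α ⟩
    mul (D.determinant (D.minor M (suc j)) ∘ (m ∷_)) (C zero j) α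
      ≡⟨ R.*-congʳ {C zero j} (minor-slice c C j) α ⟩
    mul (D.determinant (D.minor N (suc j))) (C zero j) α
      ≡⟨ mul-comm (D.determinant (D.minor N (suc j))) (C zero j) α ⟩
    mul (C zero j) (D.determinant (D.minor N (suc j))) α ∎

shear-sequence : ∀ {n} x (a : ℕ → Series) (b : Fin n) →
  D.shear x (const t) (a ∘ toℕ) (suc b) R.≈ (a (suc (toℕ b)) R.+ (D.-1# R.* (t R.* a (toℕ b))))
shear-sequence x a zero    = R.refl
shear-sequence x a (suc b) = shear-sequence (t R.* a 0) (a ∘ suc) b

shear-first : ∀ {n} (v : Fin (suc n) → Series) → D.shear R.0# (const t) v zero R.≈ v zero
shear-first v = D.-1#*0# (v zero) R.refl

at-[] : ∀ (F G : Series) → F [] ≡ F [] ℚ.+ mul t G []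
at-[] F G = sym (trans (cong (F [] ℚ.+_) (ℚₚ.*-zeroˡ (G []))) (ℚₚ.+-identityʳ (F [])))

-- h_{k+1}[x₁ + X] = h_{k+1}[X] + x₁ h_k[x₁ + X]

H-suc : ∀ k → H (ℤ.suc k) R.≈ (ι (H (ℤ.suc k)) R.+ (t R.* H k))
H-suc (+ r) []              = at-[] (H (+ suc r)) (H (+ r))
H-suc (+ r) (zero ∷ α)      = sym (trans (cong (H (+ suc r) α ℚ.+_) (t-mul-zero (H (+ r)) α)) (ℚₚ.+-identityʳ _))
H-suc (+ r) (suc a ∷ α)     = sym (trans (ℚₚ.+-identityˡ _) (t-mul-suc (H (+ r)) a α))
H-suc -[1+ 0 ] []           = at-[] (H (+ 0)) (H -[1+ 0 ])
H-suc -[1+ 0 ] (zero ∷ α)   = sym (trans (cong (H (+ 0) α ℚ.+_) (mul-zeroʳ t (0 ∷ α))) (ℚₚ.+-identityʳ _))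
H-suc -[1+ 0 ] (suc a ∷ α)  = sym (trans (ℚₚ.+-identityˡ _) (mul-zeroʳ t (suc a ∷ α)))
H-suc -[1+ suc n ] []           = at-[] (H -[1+ n ]) (H -[1+ suc n ])
H-suc -[1+ suc n ] (zero ∷ α)   = sym (trans (ℚₚ.+-identityˡ _) (mul-zeroʳ t (0 ∷ α)))
H-suc -[1+ suc n ] (suc a ∷ α)  = sym (trans (ℚₚ.+-identityˡ _) (mul-zeroʳ t (suc a ∷ α)))

row : ℤ → ℕ → Series
row k b = H (k ℤ.+ + b)

suc-+ : ∀ k b → ℤ.suc (k ℤ.+ + b) ≡ k ℤ.+ + suc b
suc-+ k b = begin
  + 1 ℤ.+ (k ℤ.+ + b)   ≡⟨ ℤₚ.+-comm (+ 1) (k ℤ.+ + b) ⟩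
  (k ℤ.+ + b) ℤ.+ + 1   ≡⟨ ℤₚ.+-assoc k (+ b) (+ 1) ⟩
  k ℤ.+ + (b ℕ.+ 1)     ≡⟨ cong (λ c → k ℤ.+ + c) (ℕₚ.+-comm b 1) ⟩
  k ℤ.+ + suc b         ∎

shear-row : ∀ {n} k (b : Fin n) →
  D.shear R.0# (const t) (row k ∘ toℕ) (suc b) R.≈ ι (row k (suc (toℕ b)))
shear-row k b = R.trans (shear-sequence R.0# (row k) b)
  (minus (≡.subst (λ z → H z R.≈ (ι (H z) R.+ (t R.* row k (toℕ b)))) (suc-+ k (toℕ b)) (H-suc (k ℤ.+ + toℕ b))))

JT : ∀ {n} → (Fin n → ℤ) → Series
JT k = D.determinant λ i j → row (k i) (toℕ j)

-- Subtracting from each column x₁ times its left neighbour removes x₁ from every column except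
-- column 0, by `H-suc`; so the slice is taken in column 0 alone.
slice-JT : ∀ {n} m (k : Fin (suc n) → ℤ) →
  (JT k ∘ (m ∷_)) R.≈ D.determinant ((λ i → H (k i) ∘ (m ∷_)) ∷ᶜ λ i b → row (k i) (suc (toℕ b)))
slice-JT {n} m k α = begin
  JT k (m ∷ α)
    ≡⟨ D.determinant-shear (const t) (λ i j → row (k i) (toℕ j)) (m ∷ α) ⟩
  D.determinant (λ i → D.shear R.0# (const t) (row (k i) ∘ toℕ)) (m ∷ α)
    ≡⟨ D.determinant-cong entries (m ∷ α) ⟩
  D.determinant ((λ i → H (k i)) ∷ᶜ λ i b → ι (row (k i) (suc (toℕ b)))) (m ∷ α)
    ≡⟨ determinant-slice m (H ∘ k) (λ i b → row (k i) (suc (toℕ b))) α ⟩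
  D.determinant ((λ i → H (k i) ∘ (m ∷_)) ∷ᶜ λ i b → row (k i) (suc (toℕ b))) α ∎
  where
  entries : ∀ i j → D.shear R.0# (const t) (row (k i) ∘ toℕ) j
          R.≈ ((H ∘ k) ∷ᶜ λ i b → ι (row (k i) (suc (toℕ b)))) i j
  entries i zero    = R.trans (shear-first {n} (row (k i) ∘ toℕ)) (λ β → cong (λ z → H z β) (ℤₚ.+-identityʳ (k i)))
  entries i (suc b) = shear-row (k i) b

H-slice-< : ∀ {k m} → k ℤ.< + m → ∀ α → H k (m ∷ α) ≡ 0ℚ
H-slice-< {+ r} {m} (ℤ.+<+ r<m) α = component r (byDegree λ _ → 1ℚ) .bounded (m ∷ α)
  (ℕₚ.<-≤-trans r<m (ℕₚ.m≤m+n m (degree α)))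
H-slice-< { -[1+ _ ]} _ α = refl

H-slice-≡ : ∀ m α → H (+ m) (m ∷ α) ≡ δ 0 (degree α)
H-slice-≡ m α = trans (ℚₚ.*-identityʳ _) (cancel m)
  where
  cancel : ∀ m → δ m (m ℕ.+ degree α) ≡ δ 0 (degree α)
  cancel zero    = refl
  cancel (suc m) = cancel m

slice-JT-< : ∀ {n} m (k : Fin (suc n) → ℤ) → (∀ i → k i ℤ.< + m) → ∀ α → JT k (m ∷ α) ≡ 0ℚ
slice-JT-< m k k< α = trans (slice-JT m k α)
  (D.determinant-zeroColumn ((λ i → H (k i) ∘ (m ∷_)) ∷ᶜ λ i b → row (k i) (suc (toℕ b)))
    (λ i → H-slice-< (k< i)) α)

-- h_m has coefficient 1 at x₁^m and smaller indices have none, so column 0 becomes 1, 0, ..., 0.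
-- Deleting it raises every starting index by one, which for s_μ makes up for the rows moving up.
slice-JT-≡ : ∀ {n} m (k : Fin (suc n) → ℤ) → k zero ≡ + m → (∀ i → k (suc i) ℤ.< + m) →
             ∀ α → JT k (m ∷ α) ≡ JT (λ i → ℤ.suc (k (suc i))) α
slice-JT-≡ m k k≡ k< α = begin
  JT k (m ∷ α)
    ≡⟨ slice-JT m k α ⟩
  D.determinant ((λ i → H (k i) ∘ (m ∷_)) ∷ᶜ C) α
    ≡⟨ D.determinant-unitColumn ((λ i → H (k i) ∘ (m ∷_)) ∷ᶜ C)
         (λ β → trans (cong (λ z → H z (m ∷ β)) k≡) (H-slice-≡ m β)) (λ i → H-slice-< (k< i)) α ⟩
  D.determinant (λ i b → row (k (suc i)) (suc (toℕ b))) α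
    ≡⟨ D.determinant-cong (λ i b β → cong (λ z → H z β) (shift (k (suc i)) (toℕ b))) α ⟩
  JT (λ i → ℤ.suc (k (suc i))) α ∎
  where
  C : Fin (suc _) → Fin _ → Series
  C i b = row (k i) (suc (toℕ b))
  shift : ∀ z b → z ℤ.+ + suc b ≡ ℤ.suc z ℤ.+ + b
  shift z b = trans (sym (suc-+ z b)) (sym (ℤₚ.+-assoc (+ 1) z (+ b)))

omit : ∀ {n} → (Fin n → ℤ) → Fin (suc n) → Fin n → Fin n → ℤ
omit k j i b = k i ℤ.+ + toℕ (punchIn j b)

-- Σ_j (-x₁)^j N_j[x₁ + X] = N_0[X] for the maximal minors N_j of the n × (n+1)
-- matrix with rows h_{k_i}, h_{k_i+1}, …: put (1, x₁, x₁², …) on top and shear.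

alternating-minors : ∀ {n} (k : Fin n → ℤ) m α →
  altℚ (λ j → slice (m ⊖ toℕ j) (D.determinant λ i b → H (omit k j i b)) α)
  ≡ δ 0 m ℚ.* D.determinant (λ i b → H (omit k zero i b)) α
alternating-minors {n} k m α = begin
  altℚ (λ j → slice (m ⊖ toℕ j) (N j) α)
    ≡⟨ altℚ-cong (λ j → pow-mul (toℕ j) (N j) m α) ⟨
  altℚ (λ j → mul (pow (toℕ j)) (N j) (m ∷ α))
    ≡⟨ alt-at (λ j → pow (toℕ j) R.* N j) (m ∷ α) ⟨
  D.determinant M (m ∷ α)
    ≡⟨ D.determinant-shear (const t) M (m ∷ α) ⟩
  D.determinant M′ (m ∷ α)
    ≡⟨ D.determinant-unitRow M′ (shear-first {n} (pow ∘ toℕ))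
         (λ j → R.trans (shear-sequence R.0# pow j) (minus (R.sym (R.+-identityˡ (t R.* pow (toℕ j)))))) (m ∷ α) ⟩
  D.determinant (D.minor M′ zero) (m ∷ α)
    ≡⟨ D.determinant-cong (λ i b → shear-row (k i) b) (m ∷ α) ⟩
  D.determinant (λ i b → ι (row (k i) (suc (toℕ b)))) (m ∷ α)
    ≡⟨ ι-determinant (λ i b → row (k i) (suc (toℕ b))) (m ∷ α) ⟩
  ι (N zero) (m ∷ α)
    ≡⟨ at m ⟩
  δ 0 m ℚ.* N zero α ∎
  where
  N : Fin (suc n) → Series
  N j = D.determinant λ i b → H (omit k j i b)
  M M′ : Fin (suc n) → Fin (suc n) → Series
  M zero    j = pow (toℕ j)
  M (suc i) j = row (k i) (toℕ j)
  M′ i = D.shear R.0# (const t) (M i)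
  at : ∀ m → ι (N zero) (m ∷ α) ≡ δ 0 m ℚ.* N zero α
  at zero    = sym (ℚₚ.*-identityˡ (N zero α))
  at (suc m) = sym (ℚₚ.*-zeroˡ (N zero α))

-- Coefficient extraction as a scalar product

hprod : List ℕ → Λ
hprod []      = 1Λ
hprod (m ∷ α) = h (+ m) * hprod α

-- W is a series in two separate sets of variables; multiplying by u in one set commutes with
-- multiplying by v in the other.
mul-interchange : ∀ u v (W : List ℕ → List ℕ → ℚ) α β →
  mul u (λ γ → mul v (λ η → W η γ) β) α ≡ mul v (λ η → mul u (W η) α) β
mul-interchange u v W α []      = mul-scaleʳ (v []) u (W []) α
mul-interchange u v W α (b ∷ β) = trans
  (mul-∑≤ʳ b u (λ i γ → mul (v ∘ (i ∷_)) (λ η → W (b ∸ i ∷ η) γ) β) α)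
  (∑≤-cong b λ i → mul-interchange u (v ∘ (i ∷_)) (λ η → W (b ∸ i ∷ η)) α β)

H-slice : ∀ b i α → H (+ b) (i ∷ α) ≡ H (b ⊖ i) α
H-slice b       zero    α = refl
H-slice zero    (suc i) α = refl
H-slice (suc b) (suc i) α = trans (H-slice b i α)
  (cong (λ z → H z α) (sym (ℤₚ.[1+m]⊖[1+n]≡m⊖n b i)))

-- Both sums effectively stop at the smaller of a and b, beyond which one argument of g is negative.
diagonal-sum : ∀ (g : ℤ → ℤ → ℚ) → (∀ x j → g x -[1+ j ] ≡ 0ℚ) → (∀ j y → g -[1+ j ] y ≡ 0ℚ) →
  ∀ a b → ∑≤ a (λ i → g (a ⊖ i) (b ⊖ i)) ≡ ∑≤ b (λ i → g (a ⊖ i) (b ⊖ i))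
diagonal-sum g g-ʳ g-ˡ zero    b       = trans (ℚₚ.+-identityʳ (g (+ 0) (+ b)))
  (sym (∑≤-head b (λ i → g (0 ⊖ i) (b ⊖ i)) λ i → g-ˡ i (b ⊖ suc i)))
diagonal-sum g g-ʳ g-ˡ (suc a) zero    = trans
  (∑≤-head (suc a) (λ i → g (suc a ⊖ i) (0 ⊖ i)) λ i → g-ʳ (suc a ⊖ suc i) i)
  (sym (ℚₚ.+-identityʳ (g (+ suc a) (+ 0))))
diagonal-sum g g-ʳ g-ˡ (suc a) (suc b) = cong (g (+ suc a) (+ suc b) ℚ.+_) (begin
  ∑≤ a (λ i → g (suc a ⊖ suc i) (suc b ⊖ suc i))  ≡⟨ ∑≤-cong a cancel ⟩
  ∑≤ a (λ i → g (a ⊖ i) (b ⊖ i))                  ≡⟨ diagonal-sum g g-ʳ g-ˡ a b ⟩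
  ∑≤ b (λ i → g (a ⊖ i) (b ⊖ i))                  ≡⟨ ∑≤-cong b cancel ⟨
  ∑≤ b (λ i → g (suc a ⊖ suc i) (suc b ⊖ suc i))  ∎)
  where
  cancel : ∀ i → g (suc a ⊖ suc i) (suc b ⊖ suc i) ≡ g (a ⊖ i) (b ⊖ i)
  cancel i = cong₂ g (ℤₚ.[1+m]⊖[1+n]≡m⊖n a i) (ℤₚ.[1+m]⊖[1+n]≡m⊖n b i)

complement-⊖ : ∀ i j n → i ℕ.+ j ≡ n → + j ≡ n ⊖ i
complement-⊖ zero    j n       eq   = cong +_ eq
complement-⊖ (suc i) j (suc n) eq   =
  trans (complement-⊖ i j n (ℕₚ.suc-injective eq)) (sym (ℤₚ.[1+m]⊖[1+n]≡m⊖n n i))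

-- `⟦ hprod β ⟧ α` counts the matrices over ℕ with row sums β and column sums α. On the right a
-- column of sum a is split off: the factor `H (+ a)` runs over all such columns ε, and β - ε are
-- the row sums that remain. In the induction, i is the corner entry.
hprod-slice : ∀ β a α → ⟦ hprod β ⟧ (a ∷ α) ≡ mul (H (+ a)) (λ γ → ⟦ hprod γ ⟧ α) β
hprod-slice []      zero    α = sym (trans (cong (ℚ._* δ 0 (degree α)) (ℚₚ.*-identityʳ 1ℚ)) (ℚₚ.*-identityˡ (δ 0 (degree α))))
hprod-slice []      (suc a) α = sym (ℚₚ.*-zeroˡ (δ 0 (degree α)))
hprod-slice (b ∷ β) a       α = begin
  conv a (λ i j → mul (H (+ b) ∘ (i ∷_)) (⟦ hprod β ⟧ ∘ (j ∷_)) α)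
    ≡⟨ conv-cong a (λ i j → mul-cong (H-slice b i) (hprod-slice β j) α) ⟩
  conv a (λ i j → mul (H (b ⊖ i)) (λ γ → mul (H (+ j)) (λ η → ⟦ hprod η ⟧ γ) β) α)
    ≡⟨ conv-cong a (λ i j → mul-interchange (H (b ⊖ i)) (H (+ j)) (λ η → ⟦ hprod η ⟧) α β) ⟩
  conv a (λ i j → g (+ j) (b ⊖ i))
    ≡⟨ conv-cong′ a {λ i j → g (+ j) (b ⊖ i)} {λ i _ → g (a ⊖ i) (b ⊖ i)}
         (λ i j eq → cong (λ z → g z (b ⊖ i)) (complement-⊖ i j a eq)) ⟩
  ∑≤ a (λ i → g (a ⊖ i) (b ⊖ i))
    ≡⟨ diagonal-sum g
         (λ x j → trans (mul-cong {H x} (λ _ → refl) (λ η → mul-zeroˡ ⟦ hprod η ⟧ α) β) (mul-zeroʳ (H x) β))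
         (λ j y → mul-zeroˡ (λ η → mul (H y) ⟦ hprod η ⟧ α) β) a b ⟩
  ∑≤ b (λ i → g (a ⊖ i) (b ⊖ i))
    ≡⟨ conv-cong′ b {λ i j → g (a ⊖ i) (+ j)} {λ i _ → g (a ⊖ i) (b ⊖ i)}
         (λ i j eq → cong (g (a ⊖ i)) (complement-⊖ i j b eq)) ⟨
  conv b (λ i j → mul (H (a ⊖ i)) (λ η → mul (H (+ j)) ⟦ hprod η ⟧ α) β)
    ≡⟨ conv-cong b (λ i j → mul-cong {G = λ η → mul (H (+ j)) ⟦ hprod η ⟧ α} (H-slice a i) (λ _ → refl) β) ⟨
  conv b (λ i j → mul (H (+ a) ∘ (i ∷_)) (λ η → mul (H (+ j)) ⟦ hprod η ⟧ α) β) ∎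
  where
  g : ℤ → ℤ → ℚ
  g x y = mul (H x) (λ η → mul (H y) ⟦ hprod η ⟧ α) β

-- Transposition of the matrices that both sides count.
hprod-sym : ∀ α β → ⟦ hprod α ⟧ β ≡ ⟦ hprod β ⟧ α
hprod-sym []      []      = refl
hprod-sym []      (b ∷ β) = begin
  δ 0 (b ℕ.+ degree β)               ≡⟨ split b ⟩
  H (+ b) [] ℚ.* δ 0 (degree β)      ≡⟨ cong (H (+ b) [] ℚ.*_) (hprod-sym [] β) ⟩
  H (+ b) [] ℚ.* ⟦ hprod β ⟧ []      ∎
  where
  split : ∀ b → δ 0 (b ℕ.+ degree β) ≡ H (+ b) [] ℚ.* δ 0 (degree β)
  split zero    = sym (ℚₚ.*-identityˡ (δ 0 (degree β)))
  split (suc b) = sym (ℚₚ.*-zeroˡ (δ 0 (degree β)))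
hprod-sym (a ∷ α) β       = begin
  mul (H (+ a)) ⟦ hprod α ⟧ β            ≡⟨ mul-cong {H (+ a)} (λ _ → refl) (hprod-sym α) β ⟩
  mul (H (+ a)) (λ γ → ⟦ hprod γ ⟧ α) β  ≡⟨ hprod-slice β a α ⟨
  ⟦ hprod β ⟧ (a ∷ α)                    ∎

-- Formal polynomials in h₁, h₂, …, and the pairing ⟨h_α , F⟩ = F α of the
-- products h_α = h_α₁ h_α₂ ⋯ with series, extended linearly.

infixl 6 _⊞_
infixl 7 _⊡_

data Formal : Set where
  mono : List ℕ → Formal
  _⊞_  : Formal → Formal → Formal
  _⊡_  : ℚ → Formal → Formal

eval : Formal → Λ
eval (mono α) = hprod α
eval (p ⊞ q)  = eval p + eval q
eval (c ⊡ p)  = c · eval p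

pair : Formal → Series → ℚ
pair (mono α) F = F α
pair (p ⊞ q)  F = pair p F ℚ.+ pair q F
pair (c ⊡ p)  F = c ℚ.* pair p F

pair-cong : ∀ p {F G} → F R.≈ G → pair p F ≡ pair p G
pair-cong (mono α) eq = eq α
pair-cong (p ⊞ q)  eq = cong₂ ℚ._+_ (pair-cong p eq) (pair-cong q eq)
pair-cong (c ⊡ p)  eq = cong (c ℚ.*_) (pair-cong p eq)

pair-+ : ∀ p F G → pair p (F R.+ G) ≡ pair p F ℚ.+ pair p G
pair-+ (mono α) F G = refl
pair-+ (p ⊞ q)  F G = trans (cong₂ ℚ._+_ (pair-+ p F G) (pair-+ q F G))
  (interchange (pair p F) (pair p G) (pair q F) (pair q G))
  where
  open import Algebra.Properties.CommutativeSemigroup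
    (CommutativeMonoid.commutativeSemigroup ℚₚ.+-0-commutativeMonoid) using (interchange)
pair-+ (c ⊡ p)  F G = trans (cong (c ℚ.*_) (pair-+ p F G)) (ℚₚ.*-distribˡ-+ c _ _)

pair-scale : ∀ p c F → pair p (λ α → c ℚ.* F α) ≡ c ℚ.* pair p F
pair-scale (mono α) c F = refl
pair-scale (p ⊞ q)  c F = trans (cong₂ ℚ._+_ (pair-scale p c F) (pair-scale q c F))
  (sym (ℚₚ.*-distribˡ-+ c _ _))
pair-scale (d ⊡ p)  c F = begin
  d ℚ.* pair p (λ α → c ℚ.* F α)  ≡⟨ cong (d ℚ.*_) (pair-scale p c F) ⟩
  d ℚ.* (c ℚ.* pair p F)          ≡⟨ ℚₚ.*-assoc d c (pair p F) ⟨
  d ℚ.* c ℚ.* pair p F            ≡⟨ cong (ℚ._* pair p F) (ℚₚ.*-comm d c) ⟩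
  c ℚ.* d ℚ.* pair p F            ≡⟨ ℚₚ.*-assoc c d (pair p F) ⟩
  c ℚ.* (d ℚ.* pair p F)          ∎

pair-zero : ∀ p → pair p (λ _ → 0ℚ) ≡ 0ℚ
pair-zero (mono α) = refl
pair-zero (p ⊞ q)  = cong₂ ℚ._+_ (pair-zero p) (pair-zero q)
pair-zero (c ⊡ p)  = trans (cong (c ℚ.*_) (pair-zero p)) (ℚₚ.*-zeroʳ c)

pair-hprod : ∀ p α → pair p ⟦ hprod α ⟧ ≡ ⟦ eval p ⟧ α
pair-hprod (mono β) α = hprod-sym α β
pair-hprod (p ⊞ q)  α = cong₂ ℚ._+_ (pair-hprod p α) (pair-hprod q α)
pair-hprod (c ⊡ p)  α = cong (c ℚ.*_) (pair-hprod p α)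

pair-sym : ∀ p q → pair p ⟦ eval q ⟧ ≡ pair q ⟦ eval p ⟧
pair-sym p (mono α)  = pair-hprod p α
pair-sym p (q ⊞ q′)  = trans (pair-+ p ⟦ eval q ⟧ ⟦ eval q′ ⟧) (cong₂ ℚ._+_ (pair-sym p q) (pair-sym p q′))
pair-sym p (c ⊡ q)   = trans (pair-scale p c ⟦ eval q ⟧) (cong (c ℚ.*_) (pair-sym p q))

hmul⁺ : ℕ → Formal → Formal
hmul⁺ m (mono α) = mono (m ∷ α)
hmul⁺ m (p ⊞ q)  = hmul⁺ m p ⊞ hmul⁺ m q
hmul⁺ m (c ⊡ p)  = c ⊡ hmul⁺ m p

hmul : ℤ → Formal → Formal
hmul (+ m)    p = hmul⁺ m p
hmul -[1+ _ ] p = 0ℚ ⊡ p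

eval-hmul : ∀ z p → ⟦ eval (hmul z p) ⟧ R.≈ (H z R.* ⟦ eval p ⟧)
eval-hmul (+ m) (mono α) β = refl
eval-hmul (+ m) (p ⊞ q)  β = trans (cong₂ ℚ._+_ (eval-hmul (+ m) p β) (eval-hmul (+ m) q β))
  (sym (mul-distribˡ (H (+ m)) ⟦ eval p ⟧ ⟦ eval q ⟧ β))
eval-hmul (+ m) (c ⊡ p)  β = trans (cong (c ℚ.*_) (eval-hmul (+ m) p β))
  (sym (mul-scaleʳ c (H (+ m)) ⟦ eval p ⟧ β))
eval-hmul -[1+ _ ] p     β = trans (ℚₚ.*-zeroˡ (⟦ eval p ⟧ β)) (sym (mul-zeroˡ ⟦ eval p ⟧ β))

-- Multiplication by h_z is adjoint to taking the coefficient of x₁^z, because h_z h_α pairs with F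
-- to its coefficient at `z ∷ α`.
pair-hmul : ∀ z p F → pair (hmul z p) F ≡ pair p (slice z F)
pair-hmul (+ m) (mono α) F = refl
pair-hmul (+ m) (p ⊞ q)  F = cong₂ ℚ._+_ (pair-hmul (+ m) p F) (pair-hmul (+ m) q F)
pair-hmul (+ m) (c ⊡ p)  F = cong (c ℚ.*_) (pair-hmul (+ m) p F)
pair-hmul -[1+ _ ] p     F = trans (ℚₚ.*-zeroˡ (pair p F)) (sym (pair-zero p))

falt : ∀ {n} → (Fin n → Formal) → Formal
falt {zero}  a = 0ℚ ⊡ mono []
falt {suc n} a = a zero ⊞ (ℚ.- 1ℚ ⊡ falt (a ∘ suc))

fdet : ∀ {n} → (Fin n → Fin n → ℤ) → Formal
fdet {zero}  N = mono []
fdet {suc n} N = falt λ j → hmul (N zero j) (fdet λ i k → N (suc i) (punchIn j k))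

-1*x : ∀ x → ℚ.- 1ℚ ℚ.* x ≡ ℚ.- x
-1*x x = trans (sym (ℚₚ.neg-distribˡ-* 1ℚ x)) (cong ℚ.-_ (ℚₚ.*-identityˡ x))

eval-falt : ∀ {n} (a : Fin n → Formal) α → ⟦ eval (falt a) ⟧ α ≡ altℚ (λ j → ⟦ eval (a j) ⟧ α)
eval-falt {zero}  a α = ℚₚ.*-zeroˡ (δ 0 (degree α))
eval-falt {suc n} a α = cong (⟦ eval (a zero) ⟧ α ℚ.+_)
  (trans (-1*x (⟦ eval (falt (a ∘ suc)) ⟧ α)) (cong ℚ.-_ (eval-falt (a ∘ suc) α)))

pair-falt : ∀ {n} (a : Fin n → Formal) F → pair (falt a) F ≡ altℚ (λ j → pair (a j) F)
pair-falt {zero}  a F = ℚₚ.*-zeroˡ (F [])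
pair-falt {suc n} a F = cong (pair (a zero) F ℚ.+_)
  (trans (-1*x (pair (falt (a ∘ suc)) F)) (cong ℚ.-_ (pair-falt (a ∘ suc) F)))

falt-cong : ∀ {n} {a b : Fin n → Formal} → (∀ j → a j ≡ b j) → falt a ≡ falt b
falt-cong {zero}  eq = refl
falt-cong {suc n} eq = cong₂ (λ x y → x ⊞ (ℚ.- 1ℚ ⊡ y)) (eq zero) (falt-cong (eq ∘ suc))

fdet-cong : ∀ {n} {M N : Fin n → Fin n → ℤ} → (∀ i j → M i j ≡ N i j) → fdet M ≡ fdet N
fdet-cong {zero}  eq = refl
fdet-cong {suc n} eq = falt-cong λ j →
  cong₂ hmul (eq zero j) (fdet-cong λ i k → eq (suc i) (punchIn j k))

eval-fdet : ∀ {n} (N : Fin n → Fin n → ℤ) → ⟦ eval (fdet N) ⟧ R.≈ D.determinant (λ i j → H (N i j))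
eval-fdet {zero}  N α = refl
eval-fdet {suc n} N α = begin
  ⟦ eval (fdet N) ⟧ α
    ≡⟨ eval-falt (λ j → hmul (N zero j) (sub j)) α ⟩
  altℚ (λ j → ⟦ eval (hmul (N zero j) (sub j)) ⟧ α)
    ≡⟨ altℚ-cong (λ j → R.trans (eval-hmul (N zero j) (sub j))
         (R.*-congˡ {H (N zero j)} (eval-fdet λ i k → N (suc i) (punchIn j k))) α) ⟩
  altℚ (λ j → mul (H (N zero j)) (D.determinant (λ i k → H (N (suc i) (punchIn j k)))) α)
    ≡⟨ alt-at (λ j → H (N zero j) R.* D.determinant (λ i k → H (N (suc i) (punchIn j k)))) α ⟨
  D.determinant (λ i j → H (N i j)) α ∎
  where
  sub : Fin (suc n) → Formal
  sub j = fdet λ i k → N (suc i) (punchIn j k)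

altℚ-head : ∀ {n} (q : Fin (suc n) → ℚ) → (∀ j → q (suc j) ≡ 0ℚ) → altℚ q ≡ q zero
altℚ-head q eq = trans (cong (λ x → q zero ℚ.+ ℚ.- x) (zeros (q ∘ suc) eq)) (ℚₚ.+-identityʳ (q zero))
  where
  zeros : ∀ {n} (q : Fin n → ℚ) → (∀ j → q j ≡ 0ℚ) → altℚ q ≡ 0ℚ
  zeros {zero}  q eq = refl
  zeros {suc n} q eq = cong₂ (λ x y → x ℚ.+ ℚ.- y) (eq zero) (zeros (q ∘ suc) (eq ∘ suc))

-- Exponents > m do not occur in x₁, hence, by symmetry, in any variable.

Narrow : ℕ → Series → Set
Narrow m F = ∀ k → m ℕ.< k → ∀ α → F (k ∷ α) ≡ 0ℚ

-- Orthonormality of the Schur functions under the coefficient pairing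

index : (μ : List ℕ) → Fin (length μ) → ℤ
index μ i = lookup (Vec.map +_ (fromList μ)) i ℤ.- + toℕ i

schurSeries : List ℕ → Series
schurSeries μ = JT (index μ)

form : List ℕ → Formal
form μ = fdet λ i j → index μ i ℤ.+ + toℕ j

eval-form : ∀ μ → ⟦ eval (form μ) ⟧ R.≈ schurSeries μ
eval-form μ = eval-fdet λ i j → index μ i ℤ.+ + toℕ j

index-head : ∀ m μ → index (m ∷ μ) zero ≡ + m
index-head m μ = cong +_ (ℕₚ.+-identityʳ m)

shift-index : ∀ z i → ℤ.suc (z ℤ.- + suc i) ≡ z ℤ.- + i
shift-index z i = lemma z (+ i)
  where
  lemma : ∀ z i → + 1 ℤ.+ (z ℤ.- (+ 1 ℤ.+ i)) ≡ z ℤ.- i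
  lemma = ℤSolver.solve-∀

shift-entry : ∀ z i j → z ℤ.- + suc i ℤ.+ + suc j ≡ z ℤ.- + i ℤ.+ + j
shift-entry z i j = lemma z (+ i) (+ j)
  where
  lemma : ∀ z i j → (z ℤ.- (+ 1 ℤ.+ i)) ℤ.+ (+ 1 ℤ.+ j) ≡ (z ℤ.- i) ℤ.+ j
  lemma = ℤSolver.solve-∀

index-bound : ∀ {m μ} → All (m ℕ.≥_) μ → ∀ i → lookup (Vec.map +_ (fromList μ)) i ℤ.≤ + m
index-bound (p ∷ _)  zero    = ℤ.+≤+ p
index-bound (_ ∷ ps) (suc i) = index-bound ps i

index-tail : ∀ {m μ} → All (m ℕ.≥_) μ → ∀ i → index (m ∷ μ) (suc i) ℤ.< + m
index-tail {m} {μ} p i = ℤₚ.<-≤-trans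
  (≡.subst (index (m ∷ μ) (suc i) ℤ.<_) (ℤₚ.+-identityʳ z) (ℤₚ.+-monoʳ-< z {ℤ.- + suc (toℕ i)} {+ 0} ℤ.-<+))
  (index-bound p i)
  where
  z : ℤ
  z = lookup (Vec.map +_ (fromList μ)) i

schurSeries-slice : ∀ {m μ} → All (m ℕ.≥_) μ → (schurSeries (m ∷ μ) ∘ (m ∷_)) R.≈ schurSeries μ
schurSeries-slice {m} {μ} p α = trans
  (slice-JT-≡ m (index (m ∷ μ)) (index-head m μ) (index-tail p) α)
  (D.determinant-cong (λ i j β → cong (λ z → row z (toℕ j) β)
    (shift-index (lookup (Vec.map +_ (fromList μ)) i) (toℕ i))) α)

schurSeries-narrow : ∀ {m μ} → All (m ℕ.≥_) μ → Narrow m (schurSeries μ)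
schurSeries-narrow []             (suc k) m<k α = refl
schurSeries-narrow {m} {l ∷ μ} (l≤m ∷ p) k m<k α = slice-JT-< k (index (l ∷ μ)) below α
  where
  below : ∀ i → index (l ∷ μ) i ℤ.< + k
  below i = ℤₚ.≤-<-trans (ℤₚ.i≤j⇒i-k≤j (+ toℕ i) (index-bound (l≤m ∷ p) i)) (ℤ.+<+ m<k)

-- Expand along the first row h_m, h_(m+1), ...: an index above m slices F to 0, so only column 0
-- survives, and its cofactor is the determinant of μ.
pair-form : ∀ m μ {F} → Narrow m F → pair (form (m ∷ μ)) F ≡ pair (form μ) (F ∘ (m ∷_))
pair-form m μ {F} narrow = begin
  pair (form (m ∷ μ)) F
    ≡⟨ pair-falt (λ j → hmul (k j) (sub j)) F ⟩
  altℚ (λ j → pair (hmul (k j) (sub j)) F)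
    ≡⟨ altℚ-head (λ j → pair (hmul (k j) (sub j)) F) (λ j → begin
         pair (hmul (k (suc j)) (sub (suc j))) F
           ≡⟨ pair-hmul (k (suc j)) (sub (suc j)) F ⟩
         pair (sub (suc j)) (slice (k (suc j)) F)
           ≡⟨ pair-cong (sub (suc j)) (narrow (m ℕ.+ 0 ℕ.+ suc (toℕ j)) (big (toℕ j))) ⟩
         pair (sub (suc j)) (λ _ → 0ℚ)
           ≡⟨ pair-zero (sub (suc j)) ⟩
         0ℚ ∎) ⟩
  pair (hmul (k zero) (sub zero)) F
    ≡⟨ pair-hmul (k zero) (sub zero) F ⟩
  pair (sub zero) (slice (k zero) F)
    ≡⟨ cong₂ (λ p z → pair p (slice z F)) (fdet-cong entries)
         (trans (ℤₚ.+-identityʳ _) (index-head m μ)) ⟩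
  pair (form μ) (F ∘ (m ∷_)) ∎
  where
  k : Fin (suc (length μ)) → ℤ
  k j = index (m ∷ μ) zero ℤ.+ + toℕ j
  sub : Fin (suc (length μ)) → Formal
  sub j = fdet λ i b → index (m ∷ μ) (suc i) ℤ.+ + toℕ (punchIn j b)
  big : ∀ j → m ℕ.< m ℕ.+ 0 ℕ.+ suc j
  big j = ≡.subst (m ℕ.<_) (cong (ℕ._+ suc j) (sym (ℕₚ.+-identityʳ m))) (ℕₚ.m<m+n m ℕ.z<s)
  entries : ∀ i j → index (m ∷ μ) (suc i) ℤ.+ + suc (toℕ j) ≡ index μ i ℤ.+ + toℕ j
  entries i j = shift-entry (lookup (Vec.map +_ (fromList μ)) i) (toℕ i) (toℕ j)

KroneckerDelta : List ℕ → List ℕ → ℚ → Set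
KroneckerDelta κ μ x = (κ ≡ μ → x ≡ 1ℚ) × (κ ≢ μ → x ≡ 0ℚ)

parts-bound : ∀ {m μ} → Linked ℕ._≥_ (m ∷ μ) → All (m ℕ.≥_) μ
parts-bound [-]      = []
parts-bound (p ∷ ps) = Linked⇒All (λ a b → ℕₚ.≤-trans b a) p ps

pair-Schur-> : ∀ {k κ m μ} → All (m ℕ.≥_) μ → m ℕ.< k → pair (form (k ∷ κ)) (schurSeries μ) ≡ 0ℚ
pair-Schur-> {k} {κ} {m} {μ} p m<k = begin
  pair (form (k ∷ κ)) (schurSeries μ)      ≡⟨ pair-form k κ (λ l k<l → schurSeries-narrow p l (ℕₚ.<-trans m<k k<l)) ⟩
  pair (form κ) (schurSeries μ ∘ (k ∷_))   ≡⟨ pair-cong (form κ) (schurSeries-narrow p k m<k) ⟩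
  pair (form κ) (λ _ → 0ℚ)       ≡⟨ pair-zero (form κ) ⟩
  0ℚ                             ∎

pair-Schur-sym : ∀ κ μ → pair (form κ) (schurSeries μ) ≡ pair (form μ) (schurSeries κ)
pair-Schur-sym κ μ = begin
  pair (form κ) (schurSeries μ)               ≡⟨ pair-cong (form κ) (eval-form μ) ⟨
  pair (form κ) ⟦ eval (form μ) ⟧   ≡⟨ pair-sym (form κ) (form μ) ⟩
  pair (form μ) ⟦ eval (form κ) ⟧   ≡⟨ pair-cong (form μ) (eval-form κ) ⟩
  pair (form μ) (schurSeries κ)               ∎

-- Equal first parts are peeled off on both sides at once. If they differ, symmetry puts the larger
-- one into the formal argument, and slicing the other Schur function there gives 0. The empty
-- partition counts as having first part 0, which positivity of the parts keeps apart from the rest.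
pair-Schur : ∀ {κ μ} → Linked ℕ._≥_ κ → All (0 ℕ.<_) κ → Linked ℕ._≥_ μ → All (0 ℕ.<_) μ →
             KroneckerDelta κ μ (pair (form κ) (schurSeries μ))
pair-Schur {[]}    {[]}    _ _        _ _        = (λ _ → refl) , (λ ≢ → contradiction refl ≢)
pair-Schur {[]}    {m ∷ μ} _ _        _ (0<m ∷ _) = (λ ()) , λ _ →
  trans (pair-Schur-sym [] (m ∷ μ)) (pair-Schur-> {κ = μ} [] 0<m)
pair-Schur {k ∷ κ} {[]}    _ (0<k ∷ _) _ _       = (λ ()) , λ _ → pair-Schur-> {κ = κ} [] 0<k
pair-Schur {k ∷ κ} {m ∷ μ} κ↓ (_ ∷ κ⁺) μ↓ (_ ∷ μ⁺) with ℕₚ.<-cmp k m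
... | tri> _ k≢m m<k = (λ eq → contradiction (lemma eq) k≢m) , λ _ →
        pair-Schur-> {κ = κ} (ℕₚ.≤-refl ∷ parts-bound μ↓) m<k
  where
  lemma : k ∷ κ ≡ m ∷ μ → k ≡ m
  lemma refl = refl
... | tri< k<m k≢m _ = (λ eq → contradiction (lemma eq) k≢m) , λ _ →
        trans (pair-Schur-sym (k ∷ κ) (m ∷ μ)) (pair-Schur-> {κ = μ} (ℕₚ.≤-refl ∷ parts-bound κ↓) k<m)
  where
  lemma : k ∷ κ ≡ m ∷ μ → k ≡ m
  lemma refl = refl
... | tri≈ _ refl _ = (λ { refl → trans step (proj₁ rec refl) }) ,
                      λ ≢ → trans step (proj₂ rec (≢ ∘ cong (m ∷_)))
  where
  rec : KroneckerDelta κ μ (pair (form κ) (schurSeries μ))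
  rec = pair-Schur (Linked.tail κ↓) κ⁺ (Linked.tail μ↓) μ⁺
  step : pair (form (m ∷ κ)) (schurSeries (m ∷ μ)) ≡ pair (form κ) (schurSeries μ)
  step = trans (pair-form m κ (schurSeries-narrow (ℕₚ.≤-refl ∷ parts-bound μ↓)))
    (pair-cong (form κ) (schurSeries-slice (parts-bound μ↓)))

-- The Schur functions span Λ

sliceΛ : ℕ → Λ → Λ
sliceΛ m F .series .coeff α                  = ⟦ F ⟧ (m ∷ α)
sliceΛ m F .series .symmetric .IsSymmetric.perm r = F .series .symmetric .IsSymmetric.perm (↭.prep m r)
sliceΛ m F .series .symmetric .IsSymmetric.pad α  = trans
  (F .series .symmetric .IsSymmetric.perm (↭.swap m 0 ↭.refl)) (F .series .symmetric .IsSymmetric.pad (m ∷ α))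
sliceΛ m F .bound                            = F .bound
sliceΛ m F .bounded α lt                     = F .bounded (m ∷ α) (ℕₚ.<-≤-trans lt (ℕₚ.m≤n+m (degree α) m))

schur-⟦⟧ : ∀ κ → ⟦ schur κ ⟧ R.≈ schurSeries (parts κ)
schur-⟦⟧ κ = det-⟦⟧ λ i j → h (index (parts κ) i ℤ.+ + toℕ j)

Parts≤ : ℕ → Partition → Set
Parts≤ m κ = All (m ℕ.≥_) (parts κ)

addPart : ∀ m → 0 ℕ.< m → ∀ κ → Parts≤ m κ → Partition
addPart m 0<m κ κ≤m = record
  { parts = m ∷ parts κ ; weakly-↓ = linked κ≤m (weakly-↓ κ) ; positive = 0<m ∷ positive κ }
  where
  linked : ∀ {μ} → All (m ℕ.≥_) μ → Linked ℕ._≥_ μ → Linked ℕ._≥_ (m ∷ μ)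
  linked []      []  = [-]
  linked (p ∷ _) ps  = p ∷ ps

-- The bound on the parts travels with the expansion so that a part m can be put in front of every
-- partition occurring in it.
data SchurSpan (m : ℕ) (F : Λ) : Set where
  nil  : F ≈ 0Λ → SchurSpan m F
  cons : ∀ {G} c κ → Parts≤ m κ → SchurSpan m G → F ≈ c · schur κ + G → SchurSpan m F

span-≈ : ∀ {m F G} → F ≈ G → SchurSpan m G → SchurSpan m F
span-≈ F≈G (nil eq)           = nil λ α → trans (F≈G α) (eq α)
span-≈ F≈G (cons c κ b sp eq) = cons c κ b sp λ α → trans (F≈G α) (eq α)

span-+ : ∀ {m F G} → SchurSpan m F → SchurSpan m G → SchurSpan m (F + G)
span-+ {G = G} (nil eq) spG =
  span-≈ (λ α → trans (cong (ℚ._+ ⟦ G ⟧ α) (eq α)) (ℚₚ.+-identityˡ (⟦ G ⟧ α))) spG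
span-+ {G = G} (cons {F′} c κ b sp eq) spG =
  cons c κ b (span-+ sp spG) λ α → trans (cong (ℚ._+ ⟦ G ⟧ α) (eq α)) (ℚₚ.+-assoc (⟦ c · schur κ ⟧ α) (⟦ F′ ⟧ α) (⟦ G ⟧ α))

span-weaken : ∀ {m F} → SchurSpan m F → SchurSpan (suc m) F
span-weaken (nil eq)           = nil eq
span-weaken (cons c κ b sp eq) = cons c κ (All.map ℕₚ.m≤n⇒m≤1+n b) (span-weaken sp) eq

-- s_κ ↦ s_(m, κ) is a section of the slicing map F ↦ F (m ∷_).

span-lift : ∀ {m F} → 0 ℕ.< m → SchurSpan m F →
            ∃ λ G → SchurSpan m G × (∀ α → ⟦ G ⟧ (m ∷ α) ≡ ⟦ F ⟧ α) × Narrow m ⟦ G ⟧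
span-lift 0<m (nil eq) = 0Λ , nil (λ _ → refl) , (λ α → sym (eq α)) , λ _ _ _ → refl
span-lift {m} {F} 0<m (cons {F′} c κ b sp eq) with span-lift 0<m sp
... | G′ , spG , at-m , above = c · schur κ⁺ + G′ ,
        cons c κ⁺ (ℕₚ.≤-refl ∷ b) spG (λ _ → refl) ,
        (λ α → begin
          c ℚ.* ⟦ schur κ⁺ ⟧ (m ∷ α) ℚ.+ ⟦ G′ ⟧ (m ∷ α)
            ≡⟨ cong₂ (λ x y → c ℚ.* x ℚ.+ y) (schur-⟦⟧ κ⁺ (m ∷ α)) (at-m α) ⟩
          c ℚ.* schurSeries (m ∷ parts κ) (m ∷ α) ℚ.+ ⟦ F′ ⟧ α
            ≡⟨ cong (λ x → c ℚ.* x ℚ.+ ⟦ F′ ⟧ α) (trans (schurSeries-slice b α) (sym (schur-⟦⟧ κ α))) ⟩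
          c ℚ.* ⟦ schur κ ⟧ α ℚ.+ ⟦ F′ ⟧ α
            ≡⟨ eq α ⟨
          ⟦ F ⟧ α ∎) ,
        (λ k m<k α → begin
          c ℚ.* ⟦ schur κ⁺ ⟧ (k ∷ α) ℚ.+ ⟦ G′ ⟧ (k ∷ α)
            ≡⟨ cong₂ (λ x y → c ℚ.* x ℚ.+ y)
                 (trans (schur-⟦⟧ κ⁺ (k ∷ α)) (schurSeries-narrow (ℕₚ.≤-refl ∷ b) k m<k α)) (above k m<k α) ⟩
          c ℚ.* 0ℚ ℚ.+ 0ℚ
            ≡⟨ trans (ℚₚ.+-identityʳ (c ℚ.* 0ℚ)) (ℚₚ.*-zeroʳ c) ⟩
          0ℚ ∎)
  where
  κ⁺ : Partition
  κ⁺ = addPart m 0<m κ b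

emptyPartition : Partition
emptyPartition = record { parts = [] ; weakly-↓ = [] ; positive = [] }

-- Induction on the largest exponent and, inside it, on the degree. The slice at the top exponent
-- has smaller degree; lifting its expansion gives an L with the same slice, and G - L has only
-- smaller exponents. With exponent bound 0 the function is constant.
span-narrow : ∀ m F → Narrow m ⟦ F ⟧ → SchurSpan m F
span-narrow zero F narrow = cons {G = 0Λ} (⟦ F ⟧ []) emptyPartition [] (nil λ _ → refl) λ α →
  trans (constant α) (sym (ℚₚ.+-identityʳ (⟦ F ⟧ [] ℚ.* δ 0 (degree α))))
  where
  constant : ∀ α → ⟦ F ⟧ α ≡ ⟦ F ⟧ [] ℚ.* δ 0 (degree α)
  constant []          = sym (ℚₚ.*-identityʳ (⟦ F ⟧ []))
  constant (zero ∷ α)  = trans (F .series .symmetric .IsSymmetric.pad α) (constant α)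
  constant (suc a ∷ α) = trans (narrow (suc a) ℕ.z<s α) (sym (ℚₚ.*-zeroʳ (⟦ F ⟧ [])))
span-narrow (suc m) F narrow = by-degree (F .bound) F narrow (F .bounded)
  where
  tighten : ∀ G → Narrow (suc m) ⟦ G ⟧ → (∀ α → ⟦ G ⟧ (suc m ∷ α) ≡ 0ℚ) → Narrow m ⟦ G ⟧
  tighten G narrow slice≡0 k m<k α with suc m ℕₚ.≟ k
  ... | yes refl = slice≡0 α
  ... | no  m≢k  = narrow k (ℕₚ.≤∧≢⇒< m<k m≢k) α
  by-degree : ∀ d G → Narrow (suc m) ⟦ G ⟧ → HasDegree≤ d ⟦ G ⟧ → SchurSpan (suc m) G
  by-degree zero G narrow deg = span-weaken
    (span-narrow m G (tighten G narrow λ α → deg (suc m ∷ α) ℕ.z<s))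
  by-degree (suc d) G narrow deg = span-≈ split (span-+ spL (span-weaken (span-narrow m G′ narrow′)))
    where
    lifted : ∃ λ L → SchurSpan (suc m) L × (∀ α → ⟦ L ⟧ (suc m ∷ α) ≡ ⟦ G ⟧ (suc m ∷ α)) × Narrow (suc m) ⟦ L ⟧
    lifted = span-lift ℕ.z<s (by-degree d (sliceΛ (suc m) G)
      -- `Narrow` speaks of the first exponent; exchanging it with the second carries the bound over
      -- to the slice.
      (λ k m<k α → trans (G .series .symmetric .IsSymmetric.perm (↭.swap (suc m) k ↭.refl)) (narrow k m<k (suc m ∷ α)))
      (λ α d<α → deg (suc m ∷ α) (ℕ.s≤s (ℕₚ.<-≤-trans d<α (ℕₚ.m≤n+m (degree α) m)))))
    L : Λ
    L = proj₁ lifted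
    spL : SchurSpan (suc m) L
    spL = proj₁ (proj₂ lifted)
    G′ : Λ
    G′ = G + (- L)
    narrow′ : Narrow m ⟦ G′ ⟧
    narrow′ = tighten G′
      (λ k m<k α → cong₂ (λ x y → x ℚ.+ ℚ.- y) (narrow k m<k α) (proj₂ (proj₂ (proj₂ lifted)) k m<k α))
      (λ α → trans (cong (λ y → ⟦ G ⟧ (suc m ∷ α) ℚ.+ ℚ.- y) (proj₁ (proj₂ (proj₂ lifted)) α))
        (ℚₚ.+-inverseʳ (⟦ G ⟧ (suc m ∷ α))))
    split : G ≈ L + G′
    split α = begin
      x                        ≡⟨ ℚₚ.+-identityʳ x ⟨
      x ℚ.+ 0ℚ                 ≡⟨ cong (x ℚ.+_) (ℚₚ.+-inverseˡ y) ⟨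
      x ℚ.+ (ℚ.- y ℚ.+ y)      ≡⟨ ℚₚ.+-assoc x (ℚ.- y) y ⟨
      (x ℚ.+ ℚ.- y) ℚ.+ y      ≡⟨ ℚₚ.+-comm (x ℚ.+ ℚ.- y) y ⟩
      y ℚ.+ (x ℚ.+ ℚ.- y)      ∎
      where
      x y : ℚ
      x = ⟦ G ⟧ α
      y = ⟦ L ⟧ α

schur-span : ∀ F → SchurSpan (F .bound) F
schur-span F = span-narrow (F .bound) F λ k b<k α → F .bounded (k ∷ α) (ℕₚ.<-≤-trans b<k (ℕₚ.m≤m+n k (degree α)))

formal : ∀ {m F} → SchurSpan m F → ∃ λ p → ⟦ eval p ⟧ R.≈ ⟦ F ⟧
formal (nil eq) = 0ℚ ⊡ mono [] , λ α → trans (ℚₚ.*-zeroˡ (δ 0 (degree α))) (sym (eq α))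
formal (cons c κ _ sp eq) with formal sp
... | p , ev = c ⊡ form (parts κ) ⊞ p , λ α → trans
  (cong₂ (λ x y → c ℚ.* x ℚ.+ y) (trans (eval-form (parts κ) α) (sym (schur-⟦⟧ κ α))) (ev α))
  (sym (eq α))

-- Cutting formal polynomials off by degree

hprod-bound : ∀ α → hprod α .bound ≡ degree α
hprod-bound []      = refl
hprod-bound (m ∷ α) = cong (m ℕ.+_) (hprod-bound α)

hprod-> : ∀ α β → degree α ℕ.< degree β → ⟦ hprod α ⟧ β ≡ 0ℚ
hprod-> α β lt = hprod α .bounded β (≡.subst (ℕ._< degree β) (sym (hprod-bound α)) lt)

-- Nothing recorded in an expansion ties its terms to the degree of the function expanded: terms
-- above N might cancel in `eval`. Removing them makes it visible that pairing with a function of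
-- degree ≤ N looks only at coefficients of degree ≤ N.
truncate : ℕ → Formal → Formal
truncate N (mono α) with degree α ℕₚ.≤? N
... | yes _ = mono α
... | no  _ = 0ℚ ⊡ mono α
truncate N (p ⊞ q)  = truncate N p ⊞ truncate N q
truncate N (c ⊡ p)  = c ⊡ truncate N p

pair-truncate : ∀ N p {D D′ : Series} → (∀ α → degree α ℕ.≤ N → D α ≡ D′ α) →
                pair (truncate N p) D ≡ pair (truncate N p) D′
pair-truncate N (mono α) {D} {D′} eq with degree α ℕₚ.≤? N
... | yes α≤N = eq α α≤N
... | no  _   = trans (ℚₚ.*-zeroˡ (D α)) (sym (ℚₚ.*-zeroˡ (D′ α)))
pair-truncate N (p ⊞ q) eq = cong₂ ℚ._+_ (pair-truncate N p eq) (pair-truncate N q eq)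
pair-truncate N (c ⊡ p) eq = cong (c ℚ.*_) (pair-truncate N p eq)

eval-truncate-≤ : ∀ N p β → degree β ℕ.≤ N → ⟦ eval (truncate N p) ⟧ β ≡ ⟦ eval p ⟧ β
eval-truncate-≤ N (mono α) β β≤N with degree α ℕₚ.≤? N
... | yes _   = refl
-- `bound` only says that h_α vanishes above its degree. That it also vanishes below follows by
-- exchanging the roles of α and β.
... | no  α≰N = trans (ℚₚ.*-zeroˡ (⟦ hprod α ⟧ β))
  (sym (trans (hprod-sym α β) (hprod-> β α (ℕₚ.≤-<-trans β≤N (ℕₚ.≰⇒> α≰N)))))
eval-truncate-≤ N (p ⊞ q) β β≤N = cong₂ ℚ._+_ (eval-truncate-≤ N p β β≤N) (eval-truncate-≤ N q β β≤N)
eval-truncate-≤ N (c ⊡ p) β β≤N = cong (c ℚ.*_) (eval-truncate-≤ N p β β≤N)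

eval-truncate-> : ∀ N p β → N ℕ.< degree β → ⟦ eval (truncate N p) ⟧ β ≡ 0ℚ
eval-truncate-> N (mono α) β N<β with degree α ℕₚ.≤? N
... | yes α≤N = hprod-> α β (ℕₚ.≤-<-trans α≤N N<β)
... | no  _   = ℚₚ.*-zeroˡ (⟦ hprod α ⟧ β)
eval-truncate-> N (p ⊞ q) β N<β = cong₂ ℚ._+_ (eval-truncate-> N p β N<β) (eval-truncate-> N q β N<β)
eval-truncate-> N (c ⊡ p) β N<β = trans (cong (c ℚ.*_) (eval-truncate-> N p β N<β)) (ℚₚ.*-zeroʳ c)

-- The given scalar product in terms of coefficients

module ScalarProductProperties (SP : ScalarProduct) where
  open ScalarProduct SP

  ⟨⟩-zero : ∀ {F} G → F ≈ 0Λ → ⟨ F , G ⟩ ≡ 0ℚ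
  ⟨⟩-zero {F} G F≈0 = begin
    ⟨ F , G ⟩            ≡⟨ ⟨⟩-cong (λ α → trans (F≈0 α) (sym (ℚₚ.*-zeroˡ 0ℚ))) (λ _ → refl) ⟩
    ⟨ 0ℚ · 0Λ , G ⟩      ≡⟨ ⟨⟩-· 0ℚ 0Λ G ⟩
    0ℚ ℚ.* ⟨ 0Λ , G ⟩    ≡⟨ ℚₚ.*-zeroˡ ⟨ 0Λ , G ⟩ ⟩
    0ℚ                   ∎

  ⟨⟩-congˡ : ∀ {F F′} G → F ≈ F′ → ⟨ F , G ⟩ ≡ ⟨ F′ , G ⟩
  ⟨⟩-congˡ G eq = ⟨⟩-cong eq λ _ → refl

  ⟨⟩-congʳ : ∀ F {G G′} → G ≈ G′ → ⟨ F , G ⟩ ≡ ⟨ F , G′ ⟩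
  ⟨⟩-congʳ F eq = ⟨⟩-cong (λ _ → refl) eq

  ⟨⟩-schur : ∀ κ μ → ⟨ schur κ , schur μ ⟩ ≡ pair (form (parts μ)) (schurSeries (parts κ))
  ⟨⟩-schur κ μ with Listₚ.≡-dec ℕₚ._≟_ (parts κ) (parts μ)
  ... | yes eq = trans
    (trans (⟨⟩-congʳ (schur κ) λ α → trans (schur-⟦⟧ μ α)
        (trans (cong (λ ν → schurSeries ν α) (sym eq)) (sym (schur-⟦⟧ κ α))))
      (normal κ))
    (sym (proj₁ (pair-Schur (weakly-↓ μ) (positive μ) (weakly-↓ κ) (positive κ)) (sym eq)))
  ... | no ≢ = trans (orthogonal κ μ ≢)
    (sym (proj₂ (pair-Schur (weakly-↓ μ) (positive μ) (weakly-↓ κ) (positive κ)) (≢ ∘ sym)))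

  span-pair : ∀ {m F} μ → SchurSpan m F → ⟨ F , schur μ ⟩ ≡ pair (form (parts μ)) ⟦ F ⟧
  span-pair {F = F} μ (nil eq) = trans (⟨⟩-zero (schur μ) eq)
    (sym (trans (pair-cong p eq) (pair-zero p)))
    where
    p : Formal
    p = form (parts μ)
  span-pair {F = F} μ (cons {G} c κ _ sp eq) = begin
    ⟨ F , schur μ ⟩
      ≡⟨ ⟨⟩-congˡ (schur μ) eq ⟩
    ⟨ c · schur κ + G , schur μ ⟩
      ≡⟨ ⟨⟩-+ (c · schur κ) G (schur μ) ⟩
    ⟨ c · schur κ , schur μ ⟩ ℚ.+ ⟨ G , schur μ ⟩
      ≡⟨ cong₂ ℚ._+_ (trans (⟨⟩-· c (schur κ) (schur μ)) (cong (c ℚ.*_)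
           (trans (⟨⟩-schur κ μ) (pair-cong p (R.sym (schur-⟦⟧ κ)))))) (span-pair μ sp) ⟩
    c ℚ.* pair p ⟦ schur κ ⟧ ℚ.+ pair p ⟦ G ⟧
      ≡⟨ cong (ℚ._+ pair p ⟦ G ⟧) (pair-scale p c ⟦ schur κ ⟧) ⟨
    pair p ⟦ c · schur κ ⟧ ℚ.+ pair p ⟦ G ⟧
      ≡⟨ pair-+ p ⟦ c · schur κ ⟧ ⟦ G ⟧ ⟨
    pair p ⟦ c · schur κ + G ⟧
      ≡⟨ pair-cong p eq ⟨
    pair p ⟦ F ⟧ ∎
    where
    p : Formal
    p = form (parts μ)

  ⟨hprod,schur⟩ : ∀ α κ → ⟨ hprod α , schur κ ⟩ ≡ ⟦ schur κ ⟧ α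
  ⟨hprod,schur⟩ α κ = begin
    ⟨ hprod α , schur κ ⟩              ≡⟨ span-pair κ (schur-span (hprod α)) ⟩
    pair (form (parts κ)) ⟦ hprod α ⟧  ≡⟨ pair-hprod (form (parts κ)) α ⟩
    ⟦ eval (form (parts κ)) ⟧ α        ≡⟨ eval-form (parts κ) α ⟩
    schurSeries (parts κ) α                      ≡⟨ schur-⟦⟧ κ α ⟨
    ⟦ schur κ ⟧ α                      ∎

  -- The Schur expansion of F reduces this to `⟨hprod,schur⟩`. The axioms give linearity in the
  -- first argument, hence the passages through `⟨⟩-sym`.
  ⟨hprod,_⟩ : ∀ F α → ⟨ hprod α , F ⟩ ≡ ⟦ F ⟧ α
  ⟨hprod, F ⟩ α = go (schur-span F)
    where
    go : ∀ {m F} → SchurSpan m F → ⟨ hprod α , F ⟩ ≡ ⟦ F ⟧ α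
    go {F = F} (nil eq) = trans (⟨⟩-sym (hprod α) F) (trans (⟨⟩-zero (hprod α) eq) (sym (eq α)))
    go {F = F} (cons {G} c κ _ sp eq) = begin
      ⟨ hprod α , F ⟩
        ≡⟨ ⟨⟩-congʳ (hprod α) eq ⟩
      ⟨ hprod α , c · schur κ + G ⟩
        ≡⟨ ⟨⟩-sym (hprod α) (c · schur κ + G) ⟩
      ⟨ c · schur κ + G , hprod α ⟩
        ≡⟨ ⟨⟩-+ (c · schur κ) G (hprod α) ⟩
      ⟨ c · schur κ , hprod α ⟩ ℚ.+ ⟨ G , hprod α ⟩
        ≡⟨ cong₂ ℚ._+_
             (trans (⟨⟩-· c (schur κ) (hprod α)) (cong (c ℚ.*_) (trans (⟨⟩-sym (schur κ) (hprod α)) (⟨hprod,schur⟩ α κ))))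
             (trans (⟨⟩-sym G (hprod α)) (go sp)) ⟩
      c ℚ.* ⟦ schur κ ⟧ α ℚ.+ ⟦ G ⟧ α
        ≡⟨ eq α ⟨
      ⟦ F ⟧ α ∎

  ⟨⟩-pair : ∀ p F → ⟨ eval p , F ⟩ ≡ pair p ⟦ F ⟧
  ⟨⟩-pair (mono α) F = ⟨hprod, F ⟩ α
  ⟨⟩-pair (p ⊞ q)  F = trans (⟨⟩-+ (eval p) (eval q) F) (cong₂ ℚ._+_ (⟨⟩-pair p F) (⟨⟩-pair q F))
  ⟨⟩-pair (c ⊡ p)  F = trans (⟨⟩-· c (eval p) F) (cong (c ℚ.*_) (⟨⟩-pair p F))

  formalOf : Λ → Formal
  formalOf P = proj₁ (formal (schur-span P))

  eval-formalOf : ∀ P → eval (formalOf P) ≈ P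
  eval-formalOf P = proj₂ (formal (schur-span P))

  ⟨⟩-formalOf : ∀ P F → ⟨ P , F ⟩ ≡ pair (formalOf P) ⟦ F ⟧
  ⟨⟩-formalOf P F = trans (sym (⟨⟩-congˡ F (eval-formalOf P))) (⟨⟩-pair (formalOf P) F)

  -- This is what lets an infinite sum be replaced by a finite truncation when skewing P.
  ⟨⟩-agree : ∀ {N} D D′ P → HasDegree≤ N ⟦ P ⟧ → (∀ α → degree α ℕ.≤ N → ⟦ D ⟧ α ≡ ⟦ D′ ⟧ α) →
             ⟨ P , D ⟩ ≡ ⟨ P , D′ ⟩
  ⟨⟩-agree {N} D D′ P P≤N eq = begin
    ⟨ P , D ⟩                        ≡⟨ ⟨⟩-congˡ D P≈ ⟩
    ⟨ eval p , D ⟩                   ≡⟨ ⟨⟩-pair p D ⟩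
    pair p ⟦ D ⟧                     ≡⟨ pair-truncate N (formalOf P) eq ⟩
    pair p ⟦ D′ ⟧                    ≡⟨ ⟨⟩-pair p D′ ⟨
    ⟨ eval p , D′ ⟩                  ≡⟨ ⟨⟩-congˡ D′ P≈ ⟨
    ⟨ P , D′ ⟩                       ∎
    where
    p : Formal
    p = truncate N (formalOf P)
    P≈ : P ≈ eval p
    P≈ α with degree α ℕₚ.≤? N
    ... | yes α≤N = sym (trans (eval-truncate-≤ N (formalOf P) α α≤N) (eval-formalOf P α))
    ... | no  α≰N = trans (P≤N α (ℕₚ.≰⇒> α≰N)) (sym (eval-truncate-> N (formalOf P) α (ℕₚ.≰⇒> α≰N)))

-- Exponentials of series

-- As an iterated sum it unfolds by one 1ℚ for each successor, which the inductions in `E-^` and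
-- `newton` rely on.
nat : ℕ → ℚ
nat n = n ×ℚ 1ℚ

nat-+ : ∀ m n → nat (m ℕ.+ n) ≡ nat m ℚ.+ nat n
nat-+ = ×-homo-+ 1ℚ

toℚᵘ-nat : ∀ n → toℚᵘ (nat n) ℚᵘ.≃ mkℚᵘ (+ n) 0
toℚᵘ-nat zero    = *≡* refl
toℚᵘ-nat (suc n) = ℚᵘₚ.≃-trans (ℚₚ.toℚᵘ-homo-+ 1ℚ (nat n))
  (ℚᵘₚ.≃-trans (ℚᵘₚ.+-congʳ (mkℚᵘ (+ 1) 0) (toℚᵘ-nat n)) (*≡* (lemma (+ n))))
  where
  lemma : ∀ n → (+ 1 ℤ.* + 1 ℤ.+ n ℤ.* + 1) ℤ.* + 1 ≡ (+ 1 ℤ.+ n) ℤ.* + 1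
  lemma = ℤSolver.solve-∀

nat-inverse : ∀ n .{{_ : NonZero n}} → nat n ℚ.* (+ 1 ℚ./ n) ≡ 1ℚ
nat-inverse (suc n) = ℚₚ.toℚᵘ-injective (ℚᵘₚ.≃-trans (ℚₚ.toℚᵘ-homo-* (nat (suc n)) (+ 1 ℚ./ suc n))
  (ℚᵘₚ.≃-trans (ℚᵘₚ.*-cong (toℚᵘ-nat (suc n)) (ℚₚ.toℚᵘ-fromℚᵘ (mkℚᵘ (+ 1) n)))
    (*≡* (trans (lemma (+ suc n)) (cong (λ m → + 1 ℤ.* + m) (sym (ℕₚ.+-identityʳ (suc n))))))))
  where
  lemma : ∀ n → (n ℤ.* + 1) ℤ.* + 1 ≡ + 1 ℤ.* n
  lemma = ℤSolver.solve-∀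

nat-cancel : ∀ n {x} → nat (suc n) ℚ.* x ≡ 0ℚ → x ≡ 0ℚ
nat-cancel n {x} eq = begin
  x                                  ≡⟨ ℚₚ.*-identityˡ x ⟨
  1ℚ ℚ.* x                           ≡⟨ cong (ℚ._* x) (nat-inverse (suc n)) ⟨
  nat (suc n) ℚ.* r ℚ.* x            ≡⟨ cong (ℚ._* x) (ℚₚ.*-comm (nat (suc n)) r) ⟩
  r ℚ.* nat (suc n) ℚ.* x            ≡⟨ ℚₚ.*-assoc r (nat (suc n)) x ⟩
  r ℚ.* (nat (suc n) ℚ.* x)          ≡⟨ cong (r ℚ.*_) eq ⟩
  r ℚ.* 0ℚ                           ≡⟨ ℚₚ.*-zeroʳ r ⟩
  0ℚ                                 ∎
  where
  r : ℚ
  r = + 1 ℚ./ suc n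

1/! : ℕ → ℚ
1/! m = ℚ._/_ (+ 1) (m !) {{ℕₚ._!≢0 m}}

1/!-suc : ∀ m → 1/! (suc m) ℚ.* nat (suc m) ≡ 1/! m
1/!-suc m = begin
  a ℚ.* nat (suc m)                               ≡⟨ ℚₚ.*-identityʳ (a ℚ.* nat (suc m)) ⟨
  a ℚ.* nat (suc m) ℚ.* 1ℚ                        ≡⟨ cong (a ℚ.* nat (suc m) ℚ.*_) (nat-inverse (m !) {{ℕₚ._!≢0 m}}) ⟨
  a ℚ.* nat (suc m) ℚ.* (nat (m !) ℚ.* 1/! m)     ≡⟨ ℚₚ.*-assoc (a ℚ.* nat (suc m)) (nat (m !)) (1/! m) ⟨
  a ℚ.* nat (suc m) ℚ.* nat (m !) ℚ.* 1/! m       ≡⟨ cong (ℚ._* 1/! m) (ℚₚ.*-assoc a (nat (suc m)) (nat (m !))) ⟩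
  a ℚ.* (nat (suc m) ℚ.* nat (m !)) ℚ.* 1/! m     ≡⟨ cong (λ x → a ℚ.* x ℚ.* 1/! m) (×1-homo-* (suc m) (m !)) ⟨
  a ℚ.* nat (suc m !) ℚ.* 1/! m                   ≡⟨ cong (ℚ._* 1/! m) (trans (ℚₚ.*-comm a (nat (suc m !))) (nat-inverse (suc m !) {{ℕₚ._!≢0 (suc m)}})) ⟩
  1ℚ ℚ.* 1/! m                                    ≡⟨ ℚₚ.*-identityˡ (1/! m) ⟩
  1/! m                                           ∎
  where
  a : ℚ
  a = 1/! (suc m)

∑≤-extend : ∀ {n N} (a : ℕ → ℚ) → n ℕ.≤ N → (∀ i → n ℕ.< i → a i ≡ 0ℚ) → ∑≤ N a ≡ ∑≤ n a
∑≤-extend {zero}  {N}     a _           a≡0 =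
  trans (∑≤-head N a λ i → a≡0 (suc i) ℕ.z<s) (sym (ℚₚ.+-identityʳ (a 0)))
∑≤-extend {suc n} {suc N} a (ℕ.s≤s n≤N) a≡0 =
  cong (a 0 ℚ.+_) (∑≤-extend (a ∘ suc) n≤N λ i n<i → a≡0 (suc i) (ℕ.s≤s n<i))

∑≤-single : ∀ {j n} (a : ℕ → ℚ) → j ℕ.≤ n → (∀ i → i ≢ j → a i ≡ 0ℚ) → ∑≤ n a ≡ a j
∑≤-single {zero}  {n}     a _           a≡0 = ∑≤-head n a λ i → a≡0 (suc i) λ ()
∑≤-single {suc j} {suc n} a (ℕ.s≤s j≤n) a≡0 = trans
  (cong₂ ℚ._+_ (a≡0 0 λ ()) (∑≤-single (a ∘ suc) j≤n λ i i≢j → a≡0 (suc i) (i≢j ∘ ℕₚ.suc-injective)))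
  (ℚₚ.+-identityˡ (a (suc j)))

mul-agree : ∀ {F F′} G α → (∀ β → degree β ℕ.≤ degree α → F β ≡ F′ β) → mul F G α ≡ mul F′ G α
mul-agree {F} {F′} G []      eq = cong (ℚ._* G []) (eq [] ℕ.z≤n)
mul-agree {F} {F′} G (a ∷ α) eq = conv-cong′ a
  {λ i j → mul (F ∘ (i ∷_)) (G ∘ (j ∷_)) α} {λ i j → mul (F′ ∘ (i ∷_)) (G ∘ (j ∷_)) α} λ i j i+j≡a →
  mul-agree (G ∘ (j ∷_)) α λ β β≤α →
    eq (i ∷ β) (ℕₚ.+-mono-≤ (≡.subst (i ℕ.≤_) i+j≡a (ℕₚ.m≤m+n i j)) β≤α)

Order≥ : ℕ → Series → Set
Order≥ m F = ∀ α → degree α ℕ.< m → F α ≡ 0ℚ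

mul-order : ∀ m k {F G} → Order≥ m F → Order≥ k G → Order≥ (m ℕ.+ k) (mul F G)
mul-order zero    zero    F≥ G≥ []      ()
mul-order zero    (suc k) {F} F≥ G≥ [] _ = trans (cong (F [] ℚ.*_) (G≥ [] ℕ.z<s)) (ℚₚ.*-zeroʳ (F []))
mul-order (suc m) k {G = G} F≥ G≥ []   _ = trans (cong (ℚ._* G []) (F≥ [] ℕ.z<s)) (ℚₚ.*-zeroˡ (G []))
mul-order m k {F} {G} F≥ G≥ (a ∷ α) lt = trans
  (conv-cong′ a {λ i j → mul (F ∘ (i ∷_)) (G ∘ (j ∷_)) α} {λ _ _ → 0ℚ} λ i j i+j≡a →
    mul-order (m ∸ i) (k ∸ j) (shift F≥ i) (shift G≥ j) α (arith i j i+j≡a))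
  (∑≤-null a (const 0ℚ) λ _ → refl)
  where
  shift : ∀ {n K} → Order≥ n K → ∀ i → Order≥ (n ∸ i) (K ∘ (i ∷_))
  shift {n} K≥ i β β< = K≥ (i ∷ β)
    (ℕₚ.≰⇒> λ n≤ → ℕₚ.<⇒≱ β< (ℕₚ.m≤n+o⇒m∸n≤o n i n≤))
  arith : ∀ i j → i ℕ.+ j ≡ a → degree α ℕ.< (m ∸ i) ℕ.+ (k ∸ j)
  arith i j refl = ℕₚ.+-cancelˡ-< (i ℕ.+ j) (degree α) ((m ∸ i) ℕ.+ (k ∸ j)) (ℕₚ.<-≤-trans lt
    (≡.subst (m ℕ.+ k ℕ.≤_) (rearrange i (m ∸ i) j (k ∸ j))
      (ℕₚ.+-mono-≤ (ℕₚ.m≤n+m∸n m i) (ℕₚ.m≤n+m∸n k j))))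
    where
    open import Algebra.Properties.CommutativeSemigroup ℕₚ.+-commutativeSemigroup using (interchange)
    rearrange : ∀ a b c d → (a ℕ.+ b) ℕ.+ (c ℕ.+ d) ≡ (a ℕ.+ c) ℕ.+ (b ℕ.+ d)
    rearrange = interchange

-- This is Σ xᵢ ∂/∂xᵢ. Over ℚ it kills only the part of degree 0, so a series is determined by its
-- image under E and that part.
E : Series → Series
E F α = nat (degree α) ℚ.* F α

E-cong : ∀ {F G} → F R.≈ G → E F R.≈ E G
E-cong eq α = cong (nat (degree α) ℚ.*_) (eq α)

E-1 : E R.1# R.≈ R.0#
E-1 α = lemma (degree α)
  where
  lemma : ∀ d → nat d ℚ.* δ 0 d ≡ 0ℚ
  lemma zero    = ℚₚ.*-zeroˡ 1ℚ
  lemma (suc d) = ℚₚ.*-zeroʳ (nat (suc d))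

E-slice : ∀ F i → (E F ∘ (i ∷_)) R.≈ (λ β → nat i ℚ.* F (i ∷ β) ℚ.+ E (F ∘ (i ∷_)) β)
E-slice F i β = trans (cong (ℚ._* F (i ∷ β)) (nat-+ i (degree β)))
  (ℚₚ.*-distribʳ-+ (F (i ∷ β)) (nat i) (nat (degree β)))

E-mul : ∀ F G → E (mul F G) R.≈ (mul (E F) G R.+ mul F (E G))
E-mul F G []      = begin
  0ℚ ℚ.* (F [] ℚ.* G [])                           ≡⟨ ℚₚ.*-zeroˡ (F [] ℚ.* G []) ⟩
  0ℚ                                               ≡⟨⟩
  0ℚ ℚ.+ 0ℚ                                        ≡⟨ cong₂ ℚ._+_ (ℚₚ.*-zeroˡ (G [])) (ℚₚ.*-zeroʳ (F [])) ⟨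
  0ℚ ℚ.* G [] ℚ.+ F [] ℚ.* 0ℚ                      ≡⟨ cong₂ (λ x y → x ℚ.* G [] ℚ.+ F [] ℚ.* y) (ℚₚ.*-zeroˡ (F [])) (ℚₚ.*-zeroˡ (G [])) ⟨
  0ℚ ℚ.* F [] ℚ.* G [] ℚ.+ F [] ℚ.* (0ℚ ℚ.* G [])  ∎
E-mul F G (a ∷ α) = begin
  nat (a ℕ.+ degree α) ℚ.* conv a φ
    ≡⟨ ∑≤-*ˡ a (nat (a ℕ.+ degree α)) (λ i → φ i (a ∸ i)) ⟩
  conv a (λ i j → nat (a ℕ.+ degree α) ℚ.* φ i j)
    ≡⟨ conv-cong′ a {λ i j → nat (a ℕ.+ degree α) ℚ.* φ i j} {λ i j → ψ i j ℚ.+ χ i j} termwise ⟩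
  conv a (λ i j → ψ i j ℚ.+ χ i j)
    ≡⟨ conv-+ a ψ χ ⟩
  mul (E F) G (a ∷ α) ℚ.+ mul F (E G) (a ∷ α) ∎
  where
  φ ψ χ : ℕ → ℕ → ℚ
  φ i j = mul (F ∘ (i ∷_)) (G ∘ (j ∷_)) α
  ψ i j = mul (E F ∘ (i ∷_)) (G ∘ (j ∷_)) α
  χ i j = mul (F ∘ (i ∷_)) (E G ∘ (j ∷_)) α
  ψ-split : ∀ i j → ψ i j ≡ nat i ℚ.* φ i j ℚ.+ mul (E (F ∘ (i ∷_))) (G ∘ (j ∷_)) α
  ψ-split i j = begin
    ψ i j
      ≡⟨ R.*-congʳ {G ∘ (j ∷_)} (E-slice F i) α ⟩
    mul (λ β → nat i ℚ.* F (i ∷ β) ℚ.+ E (F ∘ (i ∷_)) β) (G ∘ (j ∷_)) α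
      ≡⟨ mul-distribʳ (G ∘ (j ∷_)) (λ β → nat i ℚ.* F (i ∷ β)) (E (F ∘ (i ∷_))) α ⟩
    mul (λ β → nat i ℚ.* F (i ∷ β)) (G ∘ (j ∷_)) α ℚ.+ mul (E (F ∘ (i ∷_))) (G ∘ (j ∷_)) α
      ≡⟨ cong (ℚ._+ mul (E (F ∘ (i ∷_))) (G ∘ (j ∷_)) α) (mul-scaleˡ (nat i) (F ∘ (i ∷_)) (G ∘ (j ∷_)) α) ⟩
    nat i ℚ.* φ i j ℚ.+ mul (E (F ∘ (i ∷_))) (G ∘ (j ∷_)) α ∎
  χ-split : ∀ i j → χ i j ≡ nat j ℚ.* φ i j ℚ.+ mul (F ∘ (i ∷_)) (E (G ∘ (j ∷_))) α
  χ-split i j = begin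
    χ i j
      ≡⟨ R.*-congˡ {F ∘ (i ∷_)} (E-slice G j) α ⟩
    mul (F ∘ (i ∷_)) (λ β → nat j ℚ.* G (j ∷ β) ℚ.+ E (G ∘ (j ∷_)) β) α
      ≡⟨ mul-distribˡ (F ∘ (i ∷_)) (λ β → nat j ℚ.* G (j ∷ β)) (E (G ∘ (j ∷_))) α ⟩
    mul (F ∘ (i ∷_)) (λ β → nat j ℚ.* G (j ∷ β)) α ℚ.+ mul (F ∘ (i ∷_)) (E (G ∘ (j ∷_))) α
      ≡⟨ cong (ℚ._+ mul (F ∘ (i ∷_)) (E (G ∘ (j ∷_))) α) (mul-scaleʳ (nat j) (F ∘ (i ∷_)) (G ∘ (j ∷_)) α) ⟩
    nat j ℚ.* φ i j ℚ.+ mul (F ∘ (i ∷_)) (E (G ∘ (j ∷_))) α ∎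
  termwise : ∀ i j → i ℕ.+ j ≡ a → nat (a ℕ.+ degree α) ℚ.* φ i j ≡ ψ i j ℚ.+ χ i j
  termwise i j refl = begin
    nat (i ℕ.+ j ℕ.+ degree α) ℚ.* φ i j
      ≡⟨ cong (ℚ._* φ i j) (trans (nat-+ (i ℕ.+ j) (degree α)) (cong (ℚ._+ nat (degree α)) (nat-+ i j))) ⟩
    (nat i ℚ.+ nat j ℚ.+ nat (degree α)) ℚ.* φ i j
      ≡⟨ trans (ℚₚ.*-distribʳ-+ (φ i j) (nat i ℚ.+ nat j) (nat (degree α)))
           (cong₂ ℚ._+_ (ℚₚ.*-distribʳ-+ (φ i j) (nat i) (nat j)) (E-mul (F ∘ (i ∷_)) (G ∘ (j ∷_)) α)) ⟩
    (nat i ℚ.* φ i j ℚ.+ nat j ℚ.* φ i j) ℚ.+ (u ℚ.+ v)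
      ≡⟨ interchange (nat i ℚ.* φ i j) (nat j ℚ.* φ i j) u v ⟩
    (nat i ℚ.* φ i j ℚ.+ u) ℚ.+ (nat j ℚ.* φ i j ℚ.+ v)
      ≡⟨ cong₂ ℚ._+_ (ψ-split i j) (χ-split i j) ⟨
    ψ i j ℚ.+ χ i j ∎
    where
    open import Algebra.Properties.CommutativeSemigroup
      (CommutativeRing.+-commutativeSemigroup ℚₚ.+-*-commutativeRing) using (interchange)
    u v : ℚ
    u = mul (E (F ∘ (i ∷_))) (G ∘ (j ∷_)) α
    v = mul (F ∘ (i ∷_)) (E (G ∘ (j ∷_))) α

-- All exponent lists consisting of zeros are included, as a `Series` need not identify them.
Unital : Series → Set
Unital F = ∀ α → degree α ≡ 0 → F α ≡ 1ℚ

E≈0⇒1 : ∀ {F} → E F R.≈ R.0# → Unital F → F R.≈ R.1#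
E≈0⇒1 {F} EF≈0 F-unital α = go (degree α) refl
  where
  go : ∀ d → degree α ≡ d → F α ≡ δ 0 (degree α)
  go zero    eq = trans (F-unital α eq) (cong (δ 0) (sym eq))
  go (suc d) eq = trans
    (nat-cancel d (trans (cong (λ k → nat k ℚ.* F α) (sym eq)) (EF≈0 α)))
    (cong (δ 0) (sym eq))

mul-unital : ∀ {F G} → Unital F → Unital G → Unital (mul F G)
mul-unital {F} {G} F-unital G-unital α α≡0 = begin
  mul F G α     ≡⟨ mul-agree G α (λ β β≤α → agree β (ℕₚ.n≤0⇒n≡0 (≡.subst (degree β ℕ.≤_) α≡0 β≤α))) ⟩
  mul R.1# G α  ≡⟨ mul-identityˡ G α ⟩
  G α           ≡⟨ G-unital α α≡0 ⟩
  1ℚ            ∎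
  where
  agree : ∀ β → degree β ≡ 0 → F β ≡ R.1# β
  agree β β≡0 = trans (F-unital β β≡0) (cong (δ 0) (sym β≡0))

-- P and Q are the logarithmic derivatives: E (F G) = F G (P + Q) = 0, so F G is constant.
log-derivative-inverse : ∀ {F G P Q} → E F R.≈ (F R.* P) → E G R.≈ (G R.* Q) → (P R.+ Q) R.≈ R.0# →
                         Unital F → Unital G → (F R.* G) R.≈ R.1#
log-derivative-inverse {F} {G} {P} {Q} EF EG P+Q≈0 F-unital G-unital = E≈0⇒1
  (R.trans (E-mul F G) (R.trans (R.+-cong (R.*-congʳ {G} EF) (R.*-congˡ {F} EG))
    (R.trans (lemma F G P Q) (R.trans (R.*-congˡ {F R.* G} P+Q≈0) (R.zeroʳ (F R.* G))))))
  (mul-unital F-unital G-unital)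
  where
  open import Algebra.Solver.Ring.NaturalCoefficients.Default R.commutativeSemiring
  lemma : ∀ F G P Q → (((F R.* P) R.* G) R.+ (F R.* (G R.* Q))) R.≈ ((F R.* G) R.* (P R.+ Q))
  lemma = solve 4 (λ F G P Q → (F :* P) :* G :+ F :* (G :* Q) := (F :* G) :* (P :+ Q)) R.refl

module _ (G : Λ̂) (G≥1 : Order≥ 1 (G .coeff)) where

  private
    g : Series
    g = G .coeff

    G^ : ℕ → Series
    G^ m = (G Λ̂ʳ.^ m) .coeff

  ^-order : ∀ m → Order≥ m (G^ m)
  ^-order zero    α ()
  ^-order (suc m) = mul-order 1 m G≥1 (^-order m)

  E-^ : ∀ m → E (G^ (suc m)) R.≈ (λ α → nat (suc m) ℚ.* mul (G^ m) (E g) α)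
  E-^ zero α = begin
    E (mul g R.1#) α                ≡⟨ E-cong (mul-identityʳ g) α ⟩
    E g α                           ≡⟨ mul-identityˡ (E g) α ⟨
    mul R.1# (E g) α                ≡⟨ ℚₚ.*-identityˡ _ ⟨
    1ℚ ℚ.* mul R.1# (E g) α         ∎
  E-^ (suc m) α = begin
    E (mul g G′) α
      ≡⟨ E-mul g G′ α ⟩
    mul (E g) G′ α ℚ.+ mul g (E G′) α
      ≡⟨ cong₂ ℚ._+_ (mul-comm (E g) G′ α) (begin
           mul g (E G′) α                                        ≡⟨ R.*-congˡ {g} (E-^ m) α ⟩
           mul g (λ β → nat (suc m) ℚ.* mul (G^ m) (E g) β) α    ≡⟨ mul-scaleʳ (nat (suc m)) g (mul (G^ m) (E g)) α ⟩
           nat (suc m) ℚ.* mul g (mul (G^ m) (E g)) α            ≡⟨ cong (nat (suc m) ℚ.*_) (mul-assoc g (G^ m) (E g) α) ⟨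
           nat (suc m) ℚ.* x                                     ∎) ⟩
    x ℚ.+ nat (suc m) ℚ.* x
      ≡⟨ cong (ℚ._+ nat (suc m) ℚ.* x) (ℚₚ.*-identityˡ x) ⟨
    1ℚ ℚ.* x ℚ.+ nat (suc m) ℚ.* x
      ≡⟨ ℚₚ.*-distribʳ-+ x 1ℚ (nat (suc m)) ⟨
    nat (suc (suc m)) ℚ.* x ∎
    where
    G′ : Series
    G′ = G^ (suc m)
    x : ℚ
    x = mul G′ (E g) α

  -- The cut-off inside `exp` varies with the exponent list. A common one for all lists of degree ≤
  -- N turns `exp G` into a finite sum that `mul-∑≤` can distribute over.
  exp-truncate : ∀ N α → degree α ℕ.≤ N → exp G .coeff α ≡ ∑≤ N (λ m → 1/! m ℚ.* G^ m α)
  exp-truncate N α α≤N = sym (∑≤-extend (λ m → 1/! m ℚ.* G^ m α) α≤N λ m α<m →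
    trans (cong (1/! m ℚ.*_) (^-order m α α<m)) (ℚₚ.*-zeroʳ (1/! m)))

  exp-unital : Unital (exp G .coeff)
  exp-unital α α≡0 = trans (exp-truncate 0 α (ℕₚ.≤-reflexive α≡0)) (cong (λ d → 1ℚ ℚ.* δ 0 d ℚ.+ 0ℚ) α≡0)

  E-order : Order≥ 1 (E g)
  E-order α α<1 = trans (cong (nat (degree α) ℚ.*_) (G≥1 α α<1)) (ℚₚ.*-zeroʳ (nat (degree α)))

  mul-expN : ∀ N α → mul (λ β → ∑≤ N λ m → 1/! m ℚ.* G^ m β) (E g) α
                   ≡ ∑≤ N (λ m → 1/! m ℚ.* mul (G^ m) (E g) α)
  mul-expN N α = trans (mul-∑≤ N (λ m β → 1/! m ℚ.* G^ m β) (E g) α)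
    (∑≤-cong N λ m → mul-scaleˡ (1/! m) (G^ m) (E g) α)

  -- Termwise, E (G^(m+1) / (m+1)!) = (G^m / m!) E G. The shift of index loses the last term of the
  -- cut-off sum, which is 0 because G^m E G has order at least m + 1.
  E-exp : E (exp G .coeff) R.≈ (exp G .coeff R.* E g)
  E-exp α = begin
    E (exp G .coeff) α
      ≡⟨ by-degree (degree α) refl ⟩
    ∑≤ (degree α) (λ m → 1/! m ℚ.* mul (G^ m) (E g) α)
      ≡⟨ mul-expN (degree α) α ⟨
    mul (λ β → ∑≤ (degree α) λ m → 1/! m ℚ.* G^ m β) (E g) α
      ≡⟨ mul-agree (E g) α (λ β β≤α → exp-truncate (degree α) β β≤α) ⟨
    mul (exp G .coeff) (E g) α ∎
    where
    summand : ∀ m → 1/! (suc m) ℚ.* E (G^ (suc m)) α ≡ 1/! m ℚ.* mul (G^ m) (E g) α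
    summand m = trans (cong (1/! (suc m) ℚ.*_) (E-^ m α))
      (trans (sym (ℚₚ.*-assoc (1/! (suc m)) (nat (suc m)) (mul (G^ m) (E g) α)))
        (cong (ℚ._* mul (G^ m) (E g) α) (1/!-suc m)))
    top : ∀ m → degree α ℕ.≤ m → 1/! m ℚ.* mul (G^ m) (E g) α ≡ 0ℚ
    top m α≤m = trans (cong (1/! m ℚ.*_)
      (mul-order m 1 (^-order m) E-order α (≡.subst (degree α ℕ.<_) (ℕₚ.+-comm 1 m) (ℕ.s≤s α≤m))))
      (ℚₚ.*-zeroʳ (1/! m))
    by-degree : ∀ d → degree α ≡ d →
                nat (degree α) ℚ.* exp G .coeff α ≡ ∑≤ (degree α) (λ m → 1/! m ℚ.* mul (G^ m) (E g) α)
    by-degree zero eq = begin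
      nat (degree α) ℚ.* exp G .coeff α
        ≡⟨ cong (λ k → nat k ℚ.* exp G .coeff α) eq ⟩
      0ℚ ℚ.* exp G .coeff α
        ≡⟨ ℚₚ.*-zeroˡ (exp G .coeff α) ⟩
      0ℚ
        ≡⟨ ∑≤-null (degree α) (λ m → 1/! m ℚ.* mul (G^ m) (E g) α)
             (λ m → top m (≡.subst (ℕ._≤ m) (sym eq) ℕ.z≤n)) ⟨
      ∑≤ (degree α) (λ m → 1/! m ℚ.* mul (G^ m) (E g) α) ∎
    by-degree (suc d) eq = begin
      nat (degree α) ℚ.* exp G .coeff α
        ≡⟨ ∑≤-*ˡ (degree α) (nat (degree α)) (λ m → 1/! m ℚ.* G^ m α) ⟩
      ∑≤ (degree α) (λ m → nat (degree α) ℚ.* (1/! m ℚ.* G^ m α))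
        ≡⟨ ∑≤-cong (degree α) (λ m → swap (nat (degree α)) (1/! m) (G^ m α)) ⟩
      ∑≤ (degree α) (λ m → 1/! m ℚ.* E (G^ m) α)
        ≡⟨ cong (λ k → ∑≤ k λ m → 1/! m ℚ.* E (G^ m) α) eq ⟩
      1/! 0 ℚ.* E R.1# α ℚ.+ ∑≤ d (λ m → 1/! (suc m) ℚ.* E (G^ (suc m)) α)
        ≡⟨ cong₂ ℚ._+_ (cong (1/! 0 ℚ.*_) (E-1 α)) (∑≤-cong d summand) ⟩
      0ℚ ℚ.+ ∑≤ d (λ m → 1/! m ℚ.* mul (G^ m) (E g) α)
        ≡⟨ ℚₚ.+-identityˡ (∑≤ d λ m → 1/! m ℚ.* mul (G^ m) (E g) α) ⟩
      ∑≤ d (λ m → 1/! m ℚ.* mul (G^ m) (E g) α)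
        ≡⟨ ∑≤-extend (λ m → 1/! m ℚ.* mul (G^ m) (E g) α) (ℕₚ.n≤1+n d)
             (λ m d<m → top m (≡.subst (ℕ._≤ m) (sym eq) d<m)) ⟨
      ∑≤ (suc d) (λ m → 1/! m ℚ.* mul (G^ m) (E g) α)
        ≡⟨ cong (λ k → ∑≤ k λ m → 1/! m ℚ.* mul (G^ m) (E g) α) eq ⟨
      ∑≤ (degree α) (λ m → 1/! m ℚ.* mul (G^ m) (E g) α) ∎
      where
      swap : ∀ x y z → x ℚ.* (y ℚ.* z) ≡ y ℚ.* (x ℚ.* z)
      swap x y z = trans (sym (ℚₚ.*-assoc x y z)) (trans (cong (ℚ._* z) (ℚₚ.*-comm x y)) (ℚₚ.*-assoc y x z))

-- The exponent of Ω[ A ] is an unnamed function of the definitions, hence inferred.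

Ω-exp : ∀ A → ∃ λ G → Ω[ A ] ≡ exp G
Ω-exp A = _ , refl

logΩ : Λ̂ → Λ̂
logΩ A = proj₁ (Ω-exp A)

logΩ-term : Λ̂ → ℕ → Series
logΩ-term A zero    α = 0ℚ
logΩ-term A (suc j) α = (+ 1 ℚ./ suc j) ℚ.* (p[1+ j ] A) .coeff α

logΩ-coeff : ∀ A α → logΩ A .coeff α ≡ ∑≤ (degree α) (λ m → logΩ-term A m α)
logΩ-coeff A α = refl

-- In degree 0 the cut-off of `∑∞` leaves only the term at index 0, which is 0 because the sum over
-- k starts at 1.
logΩ-order : ∀ A → Order≥ 1 (logΩ A .coeff)
logΩ-order A α α<1 = trans (logΩ-coeff A α)
  (cong (λ d → ∑≤ d λ m → logΩ-term A m α) (ℕₚ.n<1⇒n≡0 α<1))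

p-neg : ∀ j A α → (p[1+ j ] (Λ̂ʳ.- A)) .coeff α ≡ ℚ.- (p[1+ j ] A) .coeff α
p-neg j A α with does (all? (suc j ∣?_) α)
... | true  = refl
... | false = refl

∑≤-neg : ∀ n (a : ℕ → ℚ) → ∑≤ n (λ i → ℚ.- a i) ≡ ℚ.- ∑≤ n a
∑≤-neg zero    a = sym (ℚₚ.neg-distrib-+ (a 0) 0ℚ)
∑≤-neg (suc n) a = trans (cong (ℚ.- a 0 ℚ.+_) (∑≤-neg n (a ∘ suc))) (sym (ℚₚ.neg-distrib-+ (a 0) (∑≤ n (a ∘ suc))))

logΩ-neg : ∀ A α → logΩ (Λ̂ʳ.- A) .coeff α ≡ ℚ.- logΩ A .coeff α
logΩ-neg A α = begin
  logΩ (Λ̂ʳ.- A) .coeff α                               ≡⟨ logΩ-coeff (Λ̂ʳ.- A) α ⟩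
  ∑≤ (degree α) (λ m → logΩ-term (Λ̂ʳ.- A) m α)         ≡⟨ ∑≤-cong (degree α) term-neg ⟩
  ∑≤ (degree α) (λ m → ℚ.- logΩ-term A m α)            ≡⟨ ∑≤-neg (degree α) (λ m → logΩ-term A m α) ⟩
  ℚ.- ∑≤ (degree α) (λ m → logΩ-term A m α)            ≡⟨ cong ℚ.-_ (logΩ-coeff A α) ⟨
  ℚ.- logΩ A .coeff α                                  ∎
  where
  term-neg : ∀ m → logΩ-term (Λ̂ʳ.- A) m α ≡ ℚ.- logΩ-term A m α
  term-neg zero    = refl
  term-neg (suc j) = trans (cong ((+ 1 ℚ./ suc j) ℚ.*_) (p-neg j A α))
    (sym (ℚₚ.neg-distribʳ-* (+ 1 ℚ./ suc j) ((p[1+ j ] A) .coeff α)))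

E-logΩ-neg : ∀ A → E (logΩ (Λ̂ʳ.- A) .coeff) R.≈ R.- E (logΩ A .coeff)
E-logΩ-neg A α = trans (cong (nat (degree α) ℚ.*_) (logΩ-neg A α))
  (sym (ℚₚ.neg-distribʳ-* (nat (degree α)) (logΩ A .coeff α)))

Ω-unital : ∀ A → Unital (Ω[ A ] .coeff)
Ω-unital A = exp-unital (logΩ A) (logΩ-order A)

E-Ω : ∀ A → E (Ω[ A ] .coeff) R.≈ (Ω[ A ] .coeff R.* E (logΩ A .coeff))
E-Ω A = E-exp (logΩ A) (logΩ-order A)

Ω-inverse : ∀ A → (Ω[ Λ̂ʳ.- A ] .coeff R.* Ω[ A ] .coeff) R.≈ R.1#
Ω-inverse A = log-derivative-inverse (E-Ω (Λ̂ʳ.- A)) (E-Ω A)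
  (R.trans (R.+-congʳ (E-logΩ-neg A)) (R.-‿inverseˡ (E (logΩ A .coeff))))
  (Ω-unital (Λ̂ʳ.- A)) (Ω-unital A)

-- Σ_k p_k: coefficient 1 at the powers of a single variable.

π : Series
π []          = 0ℚ
π (0 ∷ α)     = π α
π (suc a ∷ α) = δ 0 (degree α)

complete : Series
complete _ = 1ℚ

-- Newton: deg · Σ_r h_r = Σ_r h_r · Σ_k p_k

newton : E complete R.≈ (complete R.* π)
newton []      = refl
newton (a ∷ α) = sym (begin
  conv a (λ i j → mul complete (π ∘ (j ∷_)) α)  ≡⟨ conv-comm a (λ i j → ψ j) ⟩
  ∑≤ a ψ                                        ≡⟨ sum-ψ a ⟩
  nat (a ℕ.+ degree α)                          ≡⟨ ℚₚ.*-identityʳ (nat (a ℕ.+ degree α)) ⟨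
  nat (a ℕ.+ degree α) ℚ.* 1ℚ                   ∎)
  where
  ψ : ℕ → ℚ
  ψ j = mul complete (π ∘ (j ∷_)) α
  ψ-0 : ψ 0 ≡ nat (degree α)
  ψ-0 = trans (sym (newton α)) (ℚₚ.*-identityʳ (nat (degree α)))
  ones : ∀ a → ∑≤ a (const 1ℚ) ≡ nat (suc a)
  ones zero    = refl
  ones (suc a) = cong (1ℚ ℚ.+_) (ones a)
  -- The slice of π at 0 is π again and contributes `degree α` by induction; each of the a slices at
  -- positive exponents is the series 1 and contributes 1.
  sum-ψ : ∀ a → ∑≤ a ψ ≡ nat (a ℕ.+ degree α)
  sum-ψ zero    = trans (ℚₚ.+-identityʳ (ψ 0)) ψ-0
  sum-ψ (suc a) = begin
    ψ 0 ℚ.+ ∑≤ a (ψ ∘ suc)            ≡⟨ cong₂ ℚ._+_ ψ-0 (∑≤-cong a λ j → mul-identityʳ complete α) ⟩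
    nat (degree α) ℚ.+ ∑≤ a (const 1ℚ) ≡⟨ cong (nat (degree α) ℚ.+_) (ones a) ⟩
    nat (degree α) ℚ.+ nat (suc a)     ≡⟨ ℚₚ.+-comm (nat (degree α)) (nat (suc a)) ⟩
    nat (suc a) ℚ.+ nat (degree α)     ≡⟨ nat-+ (suc a) (degree α) ⟨
    nat (suc a ℕ.+ degree α)           ∎

degree≡0⇒∣ : ∀ k α → degree α ≡ 0 → All (k ∣_) α
degree≡0⇒∣ k []      eq = []
degree≡0⇒∣ k (0 ∷ α) eq = (k ∣0) ∷ degree≡0⇒∣ k α eq

π-degree-0 : ∀ α → degree α ≡ 0 → π α ≡ 0ℚ
π-degree-0 []      eq = refl
π-degree-0 (0 ∷ α) eq = π-degree-0 α eq

-- A nonzero multiple of `suc j` among exponents that add up to `suc j` leaves nothing for the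
-- others.
π-yes : ∀ j α → All (suc j ∣_) α → degree α ≡ suc j → π α ≡ 1ℚ
π-yes j (0 ∷ α)     (_ ∷ d)   eq = π-yes j α d eq
π-yes j (suc a ∷ α) (k∣a ∷ _) eq = cong (δ 0) (ℕₚ.n≤0⇒n≡0 (ℕₚ.+-cancelˡ-≤ (suc a) (degree α) 0
  (≡.subst₂ ℕ._≤_ (sym eq) (sym (ℕₚ.+-identityʳ (suc a))) (∣⇒≤ k∣a))))

π-no : ∀ j α → ¬ All (suc j ∣_) α → degree α ≡ suc j → π α ≡ 0ℚ
π-no j []          ∤ eq = refl
π-no j (0 ∷ α)     ∤ eq = π-no j α (λ d → ∤ ((suc j ∣0) ∷ d)) eq
π-no j (suc a ∷ α) ∤ eq with degree α in deg
... | suc _ = refl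
... | zero  = contradiction
  (≡.subst (suc j ∣_) (trans (sym eq) (ℕₚ.+-identityʳ (suc a))) ∣-refl ∷ degree≡0⇒∣ (suc j) α deg) ∤

degree-/ : ∀ j α → All (suc j ∣_) α → suc j ℕ.* degree (map (ℕ._/ suc j) α) ≡ degree α
degree-/ j []      []        = ℕₚ.*-zeroʳ (suc j)
degree-/ j (a ∷ α) (k∣a ∷ d) = trans (ℕₚ.*-distribˡ-+ (suc j) (a ℕ./ suc j) (degree (map (ℕ._/ suc j) α)))
  (cong₂ ℕ._+_ (m*[n/m]≡n k∣a) (degree-/ j α d))

p-X-off : ∀ j α → degree α ≢ suc j → (p[1+ j ] X) .coeff α ≡ 0ℚ
p-X-off j α ≢ with all? (suc j ∣?_) α
... | no  _ = refl
... | yes d with degree (map (ℕ._/ suc j) α) in eq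
...   | 0           = refl
...   | suc (suc _) = refl
...   | 1           = contradiction
  (trans (sym (degree-/ j α d)) (trans (cong (suc j ℕ.*_) eq) (ℕₚ.*-identityʳ (suc j)))) ≢

p-X-on : ∀ j α → degree α ≡ suc j → (p[1+ j ] X) .coeff α ≡ π α
p-X-on j α eq with all? (suc j ∣?_) α
... | no  ∤ = sym (π-no j α ∤ eq)
... | yes d = trans (cong (λ k → δ 1 k ℚ.* 1ℚ) quotient≡1) (sym (π-yes j α d eq))
  where
  quotient≡1 : degree (map (ℕ._/ suc j) α) ≡ 1
  quotient≡1 = ℕₚ.*-cancelˡ-≡ (degree (map (ℕ._/ suc j) α)) 1 (suc j)
    (trans (degree-/ j α d) (trans eq (sym (ℕₚ.*-identityʳ (suc j)))))

-- p_k[X] is homogeneous of degree k, so E cancels the denominator of p_k[X] / k.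
E-logΩ-X : E (logΩ X .coeff) R.≈ π
E-logΩ-X α = go (degree α) refl
  where
  go : ∀ d → degree α ≡ d → nat (degree α) ℚ.* logΩ X .coeff α ≡ π α
  go zero    eq = trans (cong (λ k → nat k ℚ.* logΩ X .coeff α) eq)
    (trans (ℚₚ.*-zeroˡ (logΩ X .coeff α)) (sym (π-degree-0 α eq)))
  go (suc j) eq = begin
    nat (degree α) ℚ.* logΩ X .coeff α
      ≡⟨ cong (nat (degree α) ℚ.*_) (logΩ-coeff X α) ⟩
    nat (degree α) ℚ.* ∑≤ (degree α) (λ m → logΩ-term X m α)
      ≡⟨ cong (nat (degree α) ℚ.*_) (∑≤-single {suc j} {degree α} (λ m → logΩ-term X m α)
           (ℕₚ.≤-reflexive (sym eq)) off) ⟩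
    nat (degree α) ℚ.* ((+ 1 ℚ./ suc j) ℚ.* (p[1+ j ] X) .coeff α)
      ≡⟨ cong₂ (λ k x → nat k ℚ.* ((+ 1 ℚ./ suc j) ℚ.* x)) eq (p-X-on j α eq) ⟩
    nat (suc j) ℚ.* ((+ 1 ℚ./ suc j) ℚ.* π α)
      ≡⟨ ℚₚ.*-assoc (nat (suc j)) (+ 1 ℚ./ suc j) (π α) ⟨
    nat (suc j) ℚ.* (+ 1 ℚ./ suc j) ℚ.* π α
      ≡⟨ cong (ℚ._* π α) (nat-inverse (suc j)) ⟩
    1ℚ ℚ.* π α
      ≡⟨ ℚₚ.*-identityˡ (π α) ⟩
    π α ∎
    where
    off : ∀ i → i ≢ suc j → logΩ-term X i α ≡ 0ℚ
    off zero    _ = refl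
    off (suc i) ≢ = trans (cong ((+ 1 ℚ./ suc i) ℚ.*_)
      (p-X-off i α λ eq′ → ≢ (trans (sym eq′) eq))) (ℚₚ.*-zeroʳ (+ 1 ℚ./ suc i))

-- Newton's identity says that Σ_r h_r has the same logarithmic derivative as Ω[X], which is
-- opposite to that of Ω[-X].
complete-inverse : (Ω[ Λ̂ʳ.- X ] .coeff R.* complete) R.≈ R.1#
complete-inverse = log-derivative-inverse (E-Ω (Λ̂ʳ.- X)) newton
  (R.trans (R.+-cong (E-logΩ-neg X) (R.sym E-logΩ-X)) (R.-‿inverseˡ (E (logΩ X .coeff))))
  (Ω-unital (Λ̂ʳ.- X)) (λ _ _ → refl)

-- Both sides are inverse to Ω[-X].
Ω-X : Ω[ X ] .coeff R.≈ complete
Ω-X = R.trans (R.sym (R.*-identityˡ ω)) (R.trans (R.*-congʳ {ω} (R.sym complete-inverse))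
  (R.trans (lemma ω⁻ complete ω) (R.trans (R.*-congʳ {complete} (Ω-inverse X)) (R.*-identityˡ complete))))
  where
  ω ω⁻ : Series
  ω  = Ω[ X ] .coeff
  ω⁻ = Ω[ Λ̂ʳ.- X ] .coeff
  open import Algebra.Solver.Ring.NaturalCoefficients.Default R.commutativeSemiring
  lemma : ∀ a b c → ((a R.* b) R.* c) R.≈ ((a R.* c) R.* b)
  lemma = solve 3 (λ a b c → (a :* b) :* c := (a :* c) :* b) R.refl

-- Homogeneous components of a product

homogeneous : ℕ → Series → Series
homogeneous d F α = δ d (degree α) ℚ.* F α

-- The components of F and G are taken with respect to the degrees i + deg
-- and j + deg, so that the induction can pass to slices.

conv-δ : ∀ m i j → conv m (λ l k → δ l i ℚ.* δ k j) ≡ δ m (i ℕ.+ j)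
conv-δ zero    zero    zero    = refl
conv-δ zero    zero    (suc j) = refl
conv-δ zero    (suc i) zero    = refl
conv-δ zero    (suc i) (suc j) = refl
conv-δ (suc m) zero    j       = trans
  (∑≤-head (suc m) (λ l → δ l 0 ℚ.* δ (suc m ∸ l) j) λ l → ℚₚ.*-zeroˡ (δ (m ∸ l) j))
  (ℚₚ.*-identityˡ (δ (suc m) j))
conv-δ (suc m) (suc i) j       = trans
  (cong₂ ℚ._+_ (ℚₚ.*-zeroˡ (δ (suc m) j)) (conv-δ m i j)) (ℚₚ.+-identityˡ (δ m (i ℕ.+ j)))

homogeneous-mul′ : ∀ m i j F G α →
  conv m (λ l k → mul (λ β → δ l (i ℕ.+ degree β) ℚ.* F β) (λ β → δ k (j ℕ.+ degree β) ℚ.* G β) α)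
  ≡ δ m ((i ℕ.+ j) ℕ.+ degree α) ℚ.* mul F G α
homogeneous-mul′ m i j F G [] = begin
  conv m (λ l k → (δ l (i ℕ.+ 0) ℚ.* F []) ℚ.* (δ k (j ℕ.+ 0) ℚ.* G []))
    ≡⟨ conv-cong m (λ l k → trans
         (cong₂ (λ x y → (δ l x ℚ.* F []) ℚ.* (δ k y ℚ.* G [])) (ℕₚ.+-identityʳ i) (ℕₚ.+-identityʳ j))
         (interchange (δ l i) (F []) (δ k j) (G []))) ⟩
  conv m (λ l k → (δ l i ℚ.* δ k j) ℚ.* (F [] ℚ.* G []))
    ≡⟨ ∑≤-*ʳ m (F [] ℚ.* G []) (λ l → δ l i ℚ.* δ (m ∸ l) j) ⟨
  conv m (λ l k → δ l i ℚ.* δ k j) ℚ.* (F [] ℚ.* G [])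
    ≡⟨ cong (ℚ._* (F [] ℚ.* G [])) (conv-δ m i j) ⟩
  δ m (i ℕ.+ j) ℚ.* (F [] ℚ.* G [])
    ≡⟨ cong (λ d → δ m d ℚ.* (F [] ℚ.* G [])) (ℕₚ.+-identityʳ (i ℕ.+ j)) ⟨
  δ m ((i ℕ.+ j) ℕ.+ 0) ℚ.* (F [] ℚ.* G []) ∎
  where
  open import Algebra.Properties.CommutativeSemigroup
    (CommutativeRing.*-commutativeSemigroup ℚₚ.+-*-commutativeRing) using (interchange)
homogeneous-mul′ m i j F G (a ∷ α) = begin
  conv m (λ l k → conv a λ u v → Φ l k u v)
    ≡⟨ ∑≤-comm m a (λ l u → Φ l (m ∸ l) u (a ∸ u)) ⟩
  conv a (λ u v → conv m λ l k → Φ l k u v)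
    ≡⟨ conv-cong a (λ u v → conv-cong m λ l k → mul-cong
         (λ β → cong (λ d → δ l d ℚ.* F (u ∷ β)) (sym (ℕₚ.+-assoc i u (degree β))))
         (λ β → cong (λ d → δ k d ℚ.* G (v ∷ β)) (sym (ℕₚ.+-assoc j v (degree β)))) α) ⟩
  conv a (λ u v → conv m λ l k → mul (λ β → δ l ((i ℕ.+ u) ℕ.+ degree β) ℚ.* F (u ∷ β))
                                     (λ β → δ k ((j ℕ.+ v) ℕ.+ degree β) ℚ.* G (v ∷ β)) α)
    ≡⟨ conv-cong a (λ u v → homogeneous-mul′ m (i ℕ.+ u) (j ℕ.+ v) (F ∘ (u ∷_)) (G ∘ (v ∷_)) α) ⟩
  conv a (λ u v → δ m (((i ℕ.+ u) ℕ.+ (j ℕ.+ v)) ℕ.+ degree α) ℚ.* φ u v)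
    ≡⟨ conv-cong′ a {λ u v → δ m (((i ℕ.+ u) ℕ.+ (j ℕ.+ v)) ℕ.+ degree α) ℚ.* φ u v}
         {λ u v → δ m ((i ℕ.+ j) ℕ.+ (a ℕ.+ degree α)) ℚ.* φ u v}
         (λ u v u+v≡a → cong (λ d → δ m d ℚ.* φ u v) (degrees u v u+v≡a)) ⟩
  conv a (λ u v → δ m ((i ℕ.+ j) ℕ.+ (a ℕ.+ degree α)) ℚ.* φ u v)
    ≡⟨ ∑≤-*ˡ a (δ m ((i ℕ.+ j) ℕ.+ (a ℕ.+ degree α))) (λ u → φ u (a ∸ u)) ⟨
  δ m ((i ℕ.+ j) ℕ.+ (a ℕ.+ degree α)) ℚ.* conv a φ ∎
  where
  open import Algebra.Properties.CommutativeSemigroup ℕₚ.+-commutativeSemigroup using (interchange)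
  φ : ℕ → ℕ → ℚ
  φ u v = mul (F ∘ (u ∷_)) (G ∘ (v ∷_)) α
  Φ : ℕ → ℕ → ℕ → ℕ → ℚ
  Φ l k u v = mul (λ β → δ l (i ℕ.+ (u ℕ.+ degree β)) ℚ.* F (u ∷ β))
                  (λ β → δ k (j ℕ.+ (v ℕ.+ degree β)) ℚ.* G (v ∷ β)) α
  degrees : ∀ u v → u ℕ.+ v ≡ a → ((i ℕ.+ u) ℕ.+ (j ℕ.+ v)) ℕ.+ degree α ≡ (i ℕ.+ j) ℕ.+ (a ℕ.+ degree α)
  degrees u v refl = trans (cong (ℕ._+ degree α) (interchange i u j v)) (ℕₚ.+-assoc (i ℕ.+ j) (u ℕ.+ v) (degree α))

homogeneous-mul : ∀ m F G α →
  conv m (λ l k → mul (homogeneous l F) (homogeneous k G) α) ≡ homogeneous m (mul F G) α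
homogeneous-mul m = homogeneous-mul′ m 0 0

-- Skewing and Bernstein's operators

δ-refl : ∀ n → δ n n ≡ 1ℚ
δ-refl zero    = refl
δ-refl (suc n) = δ-refl n

δ-off : ∀ m n → m ≢ n → δ m n ≡ 0ℚ
δ-off zero    zero    ≢ = contradiction refl ≢
δ-off zero    (suc n) ≢ = refl
δ-off (suc m) zero    ≢ = refl
δ-off (suc m) (suc n) ≢ = δ-off m n (≢ ∘ cong suc)

∑≤-δ : ∀ {j n} (a : ℕ → ℚ) → j ℕ.≤ n → ∑≤ n (λ i → δ i j ℚ.* a i) ≡ a j
∑≤-δ {j} {n} a j≤n = trans
  (∑≤-single (λ i → δ i j ℚ.* a i) j≤n λ i i≢j → trans (cong (ℚ._* a i) (δ-off i j i≢j)) (ℚₚ.*-zeroˡ (a i)))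
  (trans (cong (ℚ._* a j) (δ-refl j)) (ℚₚ.*-identityˡ (a j)))

linear-altℚ : ∀ {n} (L : Series → ℚ) →
  (∀ {F G} → F R.≈ G → L F ≡ L G) → (∀ F G → L (F R.+ G) ≡ L F ℚ.+ L G) →
  (∀ c F → L (λ α → c ℚ.* F α) ≡ c ℚ.* L F) →
  ∀ (x : Fin n → Series) → L (λ α → altℚ λ j → x j α) ≡ altℚ (λ j → L (x j))
linear-altℚ {zero} L L-cong L-+ L-scale x = trans (L-cong λ α → refl) (trans (L-scale 0ℚ (λ _ → 0ℚ)) (ℚₚ.*-zeroˡ (L λ _ → 0ℚ)))
linear-altℚ {suc n} L L-cong L-+ L-scale x = begin
  L (λ α → x zero α ℚ.+ ℚ.- rest α)       ≡⟨ L-+ (x zero) (λ α → ℚ.- rest α) ⟩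
  L (x zero) ℚ.+ L (λ α → ℚ.- rest α)     ≡⟨ cong (L (x zero) ℚ.+_) (L-cong λ α → -1*x (rest α)) ⟨
  L (x zero) ℚ.+ L (λ α → ℚ.- 1ℚ ℚ.* rest α) ≡⟨ cong (L (x zero) ℚ.+_) (trans (L-scale (ℚ.- 1ℚ) rest) (-1*x (L rest))) ⟩
  L (x zero) ℚ.+ ℚ.- L rest               ≡⟨ cong (λ y → L (x zero) ℚ.+ ℚ.- y) (linear-altℚ L L-cong L-+ L-scale (x ∘ suc)) ⟩
  altℚ (λ j → L (x j))                    ∎
  where
  rest : Series
  rest α = altℚ λ j → x (suc j) α

pair-altℚ : ∀ {n} p (x : Fin n → Series) → pair p (λ α → altℚ λ j → x j α) ≡ altℚ (λ j → pair p (x j))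
pair-altℚ p = linear-altℚ (pair p) (pair-cong p) (pair-+ p) (pair-scale p)

mul-altℚ : ∀ {n} F (x : Fin n → Series) β → mul F (λ α → altℚ λ j → x j α) β ≡ altℚ (λ j → mul F (x j) β)
mul-altℚ F x β = linear-altℚ (λ G → mul F G β) (λ eq → R.*-congˡ {F} eq β)
  (λ G K → mul-distribˡ F G K β) (λ c G → mul-scaleʳ c F G β) x

∑≤-altℚ : ∀ {n} N (a : ℕ → Fin n → ℚ) → ∑≤ N (λ i → altℚ (a i)) ≡ altℚ (λ j → ∑≤ N λ i → a i j)
∑≤-altℚ {zero}  N a = ∑≤-null N (const 0ℚ) λ _ → refl
∑≤-altℚ {suc n} N a = begin
  ∑≤ N (λ i → a i zero ℚ.+ ℚ.- altℚ (a i ∘ suc))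
    ≡⟨ ∑≤-+ N (λ i → a i zero) (λ i → ℚ.- altℚ (a i ∘ suc)) ⟩
  ∑≤ N (λ i → a i zero) ℚ.+ ∑≤ N (λ i → ℚ.- altℚ (a i ∘ suc))
    ≡⟨ cong (∑≤ N (λ i → a i zero) ℚ.+_) (trans (∑≤-neg N (λ i → altℚ (a i ∘ suc)))
         (cong ℚ.-_ (∑≤-altℚ N (λ i → a i ∘ suc)))) ⟩
  altℚ (λ j → ∑≤ N λ i → a i j) ∎

pair-∑≤ : ∀ N p (F : ℕ → Series) → pair p (λ α → ∑≤ N λ i → F i α) ≡ ∑≤ N (λ i → pair p (F i))
pair-∑≤ N (mono α) F = refl
pair-∑≤ N (p ⊞ q)  F = trans (cong₂ ℚ._+_ (pair-∑≤ N p F) (pair-∑≤ N q F))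
  (sym (∑≤-+ N (λ i → pair p (F i)) (λ i → pair q (F i))))
pair-∑≤ N (c ⊡ p)  F = trans (cong (c ℚ.*_) (pair-∑≤ N p F)) (∑≤-*ˡ N c (λ i → pair p (F i)))

sum-⟦⟧ : ∀ {n} (F : Fin n → Λ) α → ⟦ Λʳ.sum F ⟧ α ≡ ℚΣ.sum (λ i → ⟦ F i ⟧ α)
sum-⟦⟧ {zero}  F α = refl
sum-⟦⟧ {suc n} F α = cong (⟦ F zero ⟧ α ℚ.+_) (sum-⟦⟧ (F ∘ suc) α)

-- A stand-in for Φ inside Λ, whose cut-off N can be chosen independently of the function to be
-- skewed.
truncation : ℕ → Λ̂ → Λ
truncation N Φ = Λʳ.sum {suc N} λ d → component (toℕ d) Φ

truncation-agree : ∀ N Φ α → degree α ℕ.≤ N → ⟦ truncation N Φ ⟧ α ≡ Φ .coeff α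
truncation-agree N Φ α α≤N = trans (sum-⟦⟧ {suc N} (λ d → component (toℕ d) Φ) α)
  (∑≤-δ (λ _ → Φ .coeff α) α≤N)

-- Σ_{l + m = k} (-1)^l e_l h_{m-j} = δ_{k j}

e-h-orthogonality : ∀ k j α →
  conv k (λ l m → mul (homogeneous l (Ω[ Λ̂ʳ.- X ] .coeff)) (H (m ⊖ j)) α) ≡ δ k j ℚ.* δ 0 (degree α)
e-h-orthogonality k zero α = begin
  conv k (λ l m → mul (homogeneous l ω) (homogeneous m complete) α)  ≡⟨ homogeneous-mul k ω complete α ⟩
  δ k (degree α) ℚ.* mul ω complete α                                ≡⟨ cong (δ k (degree α) ℚ.*_) (complete-inverse α) ⟩
  δ k (degree α) ℚ.* δ 0 (degree α)                                  ≡⟨ merge (degree α) ⟩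
  δ k 0 ℚ.* δ 0 (degree α)                                           ∎
  where
  ω : Series
  ω = Ω[ Λ̂ʳ.- X ] .coeff
  merge : ∀ d → δ k d ℚ.* δ 0 d ≡ δ k 0 ℚ.* δ 0 d
  merge zero    = refl
  merge (suc d) = trans (ℚₚ.*-zeroʳ (δ k (suc d))) (sym (ℚₚ.*-zeroʳ (δ k 0)))
e-h-orthogonality zero    (suc j) α = trans
  (cong (ℚ._+ 0ℚ) (mul-zeroʳ (homogeneous 0 (Ω[ Λ̂ʳ.- X ] .coeff)) α)) (sym (ℚₚ.*-zeroˡ (δ 0 (degree α))))
e-h-orthogonality (suc k) (suc j) α = begin
  conv (suc k) (λ l m → mul (q l) (H (m ⊖ suc j)) α)
    ≡⟨ conv-last k (λ l m → mul (q l) (H (m ⊖ suc j)) α) ⟩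
  conv k (λ l m → mul (q l) (H (suc m ⊖ suc j)) α) ℚ.+ mul (q (suc k)) (H (0 ⊖ suc j)) α
    ≡⟨ cong₂ ℚ._+_
         (conv-cong k λ l m → cong (λ z → mul (q l) (H z) α) (ℤₚ.[1+m]⊖[1+n]≡m⊖n m j))
         (mul-zeroʳ (q (suc k)) α) ⟩
  conv k (λ l m → mul (q l) (H (m ⊖ j)) α) ℚ.+ 0ℚ
    ≡⟨ trans (ℚₚ.+-identityʳ _) (e-h-orthogonality k j α) ⟩
  δ k j ℚ.* δ 0 (degree α) ∎
  where
  q : ℕ → Series
  q l = homogeneous l (Ω[ Λ̂ʳ.- X ] .coeff)

minorΛ : ∀ {n} → (Fin n → ℤ) → Fin (suc n) → Λ
minorΛ k j = det λ i b → h (omit k j i b)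

alternating-minorsΛ : ∀ {n} (k : Fin n → ℤ) m α →
  altℚ (λ j → slice (m ⊖ toℕ j) ⟦ minorΛ k j ⟧ α) ≡ δ 0 m ℚ.* ⟦ minorΛ k zero ⟧ α
alternating-minorsΛ k m α = begin
  altℚ (λ j → slice (m ⊖ toℕ j) ⟦ minorΛ k j ⟧ α)
    ≡⟨ altℚ-cong (λ j → slice-cong (m ⊖ toℕ j) (det-⟦⟧ λ i b → h (omit k j i b))) ⟩
  altℚ (λ j → slice (m ⊖ toℕ j) (D.determinant λ i b → H (omit k j i b)) α)
    ≡⟨ alternating-minors k m α ⟩
  δ 0 m ℚ.* D.determinant (λ i b → H (omit k zero i b)) α
    ≡⟨ cong (δ 0 m ℚ.*_) (det-⟦⟧ (λ i b → h (omit k zero i b)) α) ⟨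
  δ 0 m ℚ.* ⟦ minorΛ k zero ⟧ α ∎
  where
  slice-cong : ∀ z {F G} → F R.≈ G → slice z F α ≡ slice z G α
  slice-cong (+ m)    eq = eq (m ∷ α)
  slice-cong -[1+ _ ] eq = refl

-- Skewing in terms of coefficients, and its action on Jacobi-Trudi determinants

module SkewingProperties {SP : ScalarProduct} (K : Skewing SP) where
  open ScalarProduct SP
  open ScalarProductProperties SP
  open Skewing K
  open Operators K

  -- The coefficient at β is the pairing with h_β, which `adjoint` moves across. The properties of
  -- `_⊥_` below derive from this formula.
  ⊥-at : ∀ P F β → ⟦ P ⊥ F ⟧ β ≡ ⟨ F , P * hprod β ⟩
  ⊥-at P F β = trans (sym (⟨hprod, P ⊥ F ⟩ β))
    (trans (⟨⟩-sym (hprod β) (P ⊥ F)) (adjoint P F (hprod β)))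

  ⊥-congʳ : ∀ P F G → F ≈ G → P ⊥ F ≈ P ⊥ G
  ⊥-congʳ P F G F≈G β = begin
    ⟦ P ⊥ F ⟧ β              ≡⟨ ⊥-at P F β ⟩
    ⟨ F , P * hprod β ⟩      ≡⟨ ⟨⟩-congˡ (P * hprod β) F≈G ⟩
    ⟨ G , P * hprod β ⟩      ≡⟨ ⊥-at P G β ⟨
    ⟦ P ⊥ G ⟧ β              ∎

  ⊥-assoc : ∀ P Q F → P ⊥ (Q ⊥ F) ≈ (P * Q) ⊥ F
  ⊥-assoc P Q F β = begin
    ⟦ P ⊥ (Q ⊥ F) ⟧ β              ≡⟨ ⊥-at P (Q ⊥ F) β ⟩
    ⟨ Q ⊥ F , P * hprod β ⟩        ≡⟨ adjoint Q F (P * hprod β) ⟩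
    ⟨ F , Q * (P * hprod β) ⟩      ≡⟨ ⟨⟩-congʳ F rearrange ⟩
    ⟨ F , (P * Q) * hprod β ⟩      ≡⟨ ⊥-at (P * Q) F β ⟨
    ⟦ (P * Q) ⊥ F ⟧ β              ∎
    where
    rearrange : Q * (P * hprod β) ≈ (P * Q) * hprod β
    rearrange = R.trans (R.sym (R.*-assoc ⟦ Q ⟧ ⟦ P ⟧ ⟦ hprod β ⟧)) (R.*-congʳ {⟦ hprod β ⟧} (R.*-comm ⟦ Q ⟧ ⟦ P ⟧))

  1⊥ : ∀ F → 1Λ ⊥ F ≈ F
  1⊥ F β = begin
    ⟦ 1Λ ⊥ F ⟧ β              ≡⟨ ⊥-at 1Λ F β ⟩
    ⟨ F , 1Λ * hprod β ⟩      ≡⟨ ⟨⟩-congʳ F (R.*-identityˡ ⟦ hprod β ⟧) ⟩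
    ⟨ F , hprod β ⟩           ≡⟨ ⟨⟩-sym F (hprod β) ⟩
    ⟨ hprod β , F ⟩           ≡⟨ ⟨hprod, F ⟩ β ⟩
    ⟦ F ⟧ β                   ∎

  -- Here the coefficient appears as a linear functional of F, and in `⊥-pairˡ` as one of P; linear
  -- relations between series then pass through `pair`.
  ⊥-pairʳ : ∀ P F β → ⟦ P ⊥ F ⟧ β ≡ pair (formalOf (P * hprod β)) ⟦ F ⟧
  ⊥-pairʳ P F β = trans (⊥-at P F β)
    (trans (⟨⟩-sym F (P * hprod β)) (⟨⟩-formalOf (P * hprod β) F))

  ⊥-pairˡ : ∀ P F β → ⟦ P ⊥ F ⟧ β ≡ pair (formalOf F) (mul ⟦ P ⟧ ⟦ hprod β ⟧)
  ⊥-pairˡ P F β = trans (⊥-at P F β) (⟨⟩-formalOf F (P * hprod β))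

  h⊥ : ∀ z F β → ⟦ h z ⊥ F ⟧ β ≡ slice z ⟦ F ⟧ β
  h⊥ (+ m)    F β = trans (⊥-at (h (+ m)) F β) (trans (⟨⟩-sym F (hprod (m ∷ β))) (⟨hprod, F ⟩ (m ∷ β)))
  h⊥ -[1+ n ] F β = trans (⊥-at 0Λ F β) (trans (⟨⟩-sym F (0Λ * hprod β)) (⟨⟩-zero F (mul-zeroˡ ⟦ hprod β ⟧)))

  ⊥-agree : ∀ {N} P P′ F → HasDegree≤ N ⟦ F ⟧ → (∀ α → degree α ℕ.≤ N → ⟦ P ⟧ α ≡ ⟦ P′ ⟧ α) → P ⊥ F ≈ P′ ⊥ F
  ⊥-agree P P′ F F≤N eq β = begin
    ⟦ P ⊥ F ⟧ β              ≡⟨ ⊥-at P F β ⟩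
    ⟨ F , P * hprod β ⟩      ≡⟨ ⟨⟩-agree (P * hprod β) (P′ * hprod β) F F≤N
                                  (λ α α≤N → mul-agree ⟦ hprod β ⟧ α λ γ γ≤α → eq γ (ℕₚ.≤-trans γ≤α α≤N)) ⟩
    ⟨ F , P′ * hprod β ⟩     ≡⟨ ⊥-at P′ F β ⟨
    ⟦ P′ ⊥ F ⟧ β             ∎

  ⊥-sum : ∀ {n} (P : Fin n → Λ) F → Λʳ.sum (λ i → P i ⊥ F) ≈ Λʳ.sum P ⊥ F
  ⊥-sum {zero}  P F β = sym (trans (⊥-pairˡ 0Λ F β)
    (trans (pair-cong (formalOf F) (mul-zeroˡ ⟦ hprod β ⟧)) (pair-zero (formalOf F))))
  ⊥-sum {suc n} P F β = begin
    ⟦ P zero ⊥ F ⟧ β ℚ.+ ⟦ Λʳ.sum (λ i → P (suc i) ⊥ F) ⟧ β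
      ≡⟨ cong₂ ℚ._+_ (⊥-pairˡ (P zero) F β) (trans (⊥-sum (P ∘ suc) F β) (⊥-pairˡ (Λʳ.sum (P ∘ suc)) F β)) ⟩
    pair p (mul ⟦ P zero ⟧ ⟦ hprod β ⟧) ℚ.+ pair p (mul ⟦ Λʳ.sum (P ∘ suc) ⟧ ⟦ hprod β ⟧)
      ≡⟨ pair-+ p (mul ⟦ P zero ⟧ ⟦ hprod β ⟧) (mul ⟦ Λʳ.sum (P ∘ suc) ⟧ ⟦ hprod β ⟧) ⟨
    pair p (mul ⟦ P zero ⟧ ⟦ hprod β ⟧ R.+ mul ⟦ Λʳ.sum (P ∘ suc) ⟧ ⟦ hprod β ⟧)
      ≡⟨ pair-cong p (R.distribʳ ⟦ hprod β ⟧ ⟦ P zero ⟧ ⟦ Λʳ.sum (P ∘ suc) ⟧) ⟨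
    pair p (mul ⟦ Λʳ.sum P ⟧ ⟦ hprod β ⟧)
      ≡⟨ ⊥-pairˡ (Λʳ.sum P) F β ⟨
    ⟦ Λʳ.sum P ⊥ F ⟧ β ∎
    where
    p : Formal
    p = formalOf F

  ⊥̂-≈ : ∀ Φ P F → (∀ α → degree α ℕ.≤ F .bound → Φ .coeff α ≡ ⟦ P ⟧ α) → Φ ⊥̂ F ≈ P ⊥ F
  ⊥̂-≈ Φ P F eq α = trans (⊥-sum {suc (F .bound)} (λ d → component (toℕ d) Φ) F α)
    (⊥-agree (truncation (F .bound) Φ) P F (F .bounded)
      (λ γ γ≤ → trans (truncation-agree (F .bound) Φ γ γ≤) (eq γ γ≤)) α)

  ⊥̂-truncation : ∀ {N} Φ F → F .bound ℕ.≤ N → Φ ⊥̂ F ≈ truncation N Φ ⊥ F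
  ⊥̂-truncation {N} Φ F F≤N = ⊥̂-≈ Φ (truncation N Φ) F
    λ α α≤F → sym (truncation-agree N Φ α (ℕₚ.≤-trans α≤F F≤N))

  -- The cut-off in `Φ ⊥̂ F` is the bound of F, which `≈` does not preserve; a truncation at the
  -- larger of the two bounds serves both sides.
  ⊥̂-cong : ∀ Φ F G → F ≈ G → Φ ⊥̂ F ≈ Φ ⊥̂ G
  ⊥̂-cong Φ F G F≈G β = begin
    ⟦ Φ ⊥̂ F ⟧ β                ≡⟨ ⊥̂-truncation Φ F (ℕₚ.m≤m⊔n (F .bound) (G .bound)) β ⟩
    ⟦ truncation N Φ ⊥ F ⟧ β   ≡⟨ ⊥-congʳ (truncation N Φ) F G F≈G β ⟩
    ⟦ truncation N Φ ⊥ G ⟧ β   ≡⟨ ⊥̂-truncation Φ G (ℕₚ.m≤n⊔m (F .bound) (G .bound)) β ⟨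
    ⟦ Φ ⊥̂ G ⟧ β                ∎
    where
    N : ℕ
    N = F .bound ℕ.⊔ G .bound

  -- N dominates the bound of `Ψ ⊥̂ F` as well as that of F. The truncations then compose to skewing
  -- by `Φ′ * Ψ′`, which agrees with 1 in all degrees that F can detect.
  ⊥̂-inverse : ∀ Φ Ψ → (Φ .coeff R.* Ψ .coeff) R.≈ R.1# → ∀ F → Φ ⊥̂ (Ψ ⊥̂ F) ≈ F
  ⊥̂-inverse Φ Ψ ΦΨ≈1 F β = begin
    ⟦ Φ ⊥̂ (Ψ ⊥̂ F) ⟧ β      ≡⟨ ⊥̂-truncation Φ (Ψ ⊥̂ F) (ℕₚ.m≤n⊔m (F .bound) ((Ψ ⊥̂ F) .bound)) β ⟩
    ⟦ Φ′ ⊥ (Ψ ⊥̂ F) ⟧ β     ≡⟨ ⊥-congʳ Φ′ (Ψ ⊥̂ F) (Ψ′ ⊥ F) (⊥̂-truncation Ψ F F≤N) β ⟩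
    ⟦ Φ′ ⊥ (Ψ′ ⊥ F) ⟧ β    ≡⟨ ⊥-assoc Φ′ Ψ′ F β ⟩
    ⟦ (Φ′ * Ψ′) ⊥ F ⟧ β    ≡⟨ ⊥-agree (Φ′ * Ψ′) 1Λ F (F .bounded) agree β ⟩
    ⟦ 1Λ ⊥ F ⟧ β           ≡⟨ 1⊥ F β ⟩
    ⟦ F ⟧ β                ∎
    where
    N : ℕ
    N = F .bound ℕ.⊔ (Ψ ⊥̂ F) .bound
    F≤N : F .bound ℕ.≤ N
    F≤N = ℕₚ.m≤m⊔n (F .bound) ((Ψ ⊥̂ F) .bound)
    Φ′ Ψ′ : Λ
    Φ′ = truncation N Φ
    Ψ′ = truncation N Ψ
    agree : ∀ α → degree α ℕ.≤ F .bound → mul ⟦ Φ′ ⟧ ⟦ Ψ′ ⟧ α ≡ R.1# α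
    agree α α≤ = begin
      mul ⟦ Φ′ ⟧ ⟦ Ψ′ ⟧ α              ≡⟨ mul-agree ⟦ Ψ′ ⟧ α (λ γ γ≤ → truncation-agree N Φ γ (below γ γ≤)) ⟩
      mul (Φ .coeff) ⟦ Ψ′ ⟧ α          ≡⟨ mul-comm (Φ .coeff) ⟦ Ψ′ ⟧ α ⟩
      mul ⟦ Ψ′ ⟧ (Φ .coeff) α          ≡⟨ mul-agree (Φ .coeff) α (λ γ γ≤ → truncation-agree N Ψ γ (below γ γ≤)) ⟩
      mul (Ψ .coeff) (Φ .coeff) α      ≡⟨ mul-comm (Ψ .coeff) (Φ .coeff) α ⟩
      mul (Φ .coeff) (Ψ .coeff) α      ≡⟨ ΦΨ≈1 α ⟩
      R.1# α                           ∎
      where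
      below : ∀ γ → degree γ ℕ.≤ degree α → degree γ ℕ.≤ N
      below γ γ≤ = ℕₚ.≤-trans γ≤ (ℕₚ.≤-trans α≤ F≤N)

  q : ℕ → Λ
  q i = [z^- i ]Ω[-z⁻¹X]

  q⊥-vanish : ∀ {i} F → F .bound ℕ.< i → ∀ β → ⟦ q i ⊥ F ⟧ β ≡ 0ℚ
  q⊥-vanish {i} F F<i β = trans
    (⊥-agree (q i) 0Λ F (F .bounded)
      (λ α α≤F → trans (cong (ℚ._* Ω[ Λ̂ʳ.- X ] .coeff α)
          (δ-off i (degree α) (ℕₚ.<⇒≢ (ℕₚ.≤-<-trans α≤F F<i) ∘ sym)))
        (ℚₚ.*-zeroˡ (Ω[ Λ̂ʳ.- X ] .coeff α))) β)
    (sym (⊥-sum {0} (λ ()) F β))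

  coefficient-H : ∀ z → ⟦ [z^ z ]Ω[zX] ⟧ R.≈ H z
  coefficient-H (+ r)    α = cong (δ r (degree α) ℚ.*_) (Ω-X α)
  coefficient-H -[1+ _ ] α = refl

  B-at : ∀ {N} r F → F .bound ℕ.≤ N → ∀ β →
         ⟦ B r F ⟧ β ≡ ∑≤ N (λ i → mul (H (r ℤ.+ + i)) ⟦ q i ⊥ F ⟧ β)
  B-at {N} r F F≤N β = begin
    ⟦ B r F ⟧ β
      ≡⟨ sum-⟦⟧ {suc (F .bound)} (λ i → [z^ r ℤ.+ + toℕ i ]Ω[zX] * (q (toℕ i) ⊥ F)) β ⟩
    ∑≤ (F .bound) (λ i → mul ⟦ [z^ r ℤ.+ + i ]Ω[zX] ⟧ ⟦ q i ⊥ F ⟧ β)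
      ≡⟨ ∑≤-cong (F .bound) (λ i → R.*-congʳ {⟦ q i ⊥ F ⟧} (coefficient-H (r ℤ.+ + i)) β) ⟩
    ∑≤ (F .bound) (λ i → mul (H (r ℤ.+ + i)) ⟦ q i ⊥ F ⟧ β)
      ≡⟨ ∑≤-extend (λ i → mul (H (r ℤ.+ + i)) ⟦ q i ⊥ F ⟧ β) F≤N (λ i F<i →
           trans (R.*-congˡ {H (r ℤ.+ + i)} (q⊥-vanish F F<i) β) (mul-zeroʳ (H (r ℤ.+ + i)) β)) ⟨
    ∑≤ N (λ i → mul (H (r ℤ.+ + i)) ⟦ q i ⊥ F ⟧ β) ∎

  B-cong : ∀ r F G → F ≈ G → B r F ≈ B r G
  B-cong r F G F≈G β = begin
    ⟦ B r F ⟧ β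
      ≡⟨ B-at {N} r F (ℕₚ.m≤m⊔n (F .bound) (G .bound)) β ⟩
    ∑≤ N (λ i → mul (H (r ℤ.+ + i)) ⟦ q i ⊥ F ⟧ β)
      ≡⟨ ∑≤-cong N (λ i → R.*-congˡ {H (r ℤ.+ + i)} (⊥-congʳ (q i) F G F≈G) β) ⟩
    ∑≤ N (λ i → mul (H (r ℤ.+ + i)) ⟦ q i ⊥ G ⟧ β)
      ≡⟨ B-at {N} r G (ℕₚ.m≤n⊔m (F .bound) (G .bound)) β ⟨
    ⟦ B r G ⟧ β ∎
    where
    N : ℕ
    N = F .bound ℕ.⊔ G .bound

  -- e_i^⊥ acts on a Jacobi–Trudi determinant by omitting column i instead of column 0.

  q⊥-minor : ∀ {n} (k : Fin n → ℤ) i β →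
    ⟦ q i ⊥ minorΛ k zero ⟧ β ≡ altℚ (λ j → δ i (toℕ j) ℚ.* ⟦ minorΛ k j ⟧ β)
  q⊥-minor {n} k i β = begin
    ⟦ q i ⊥ N zero ⟧ β
      ≡⟨ trans (conv-comm i (λ l m → δ 0 m ℚ.* ⟦ q l ⊥ N zero ⟧ β)) (trans
           (∑≤-head i (λ m → δ 0 m ℚ.* ⟦ q (i ∸ m) ⊥ N zero ⟧ β) (λ m → ℚₚ.*-zeroˡ (⟦ q (i ∸ suc m) ⊥ N zero ⟧ β)))
           (ℚₚ.*-identityˡ (⟦ q i ⊥ N zero ⟧ β))) ⟨
    -- Only m = 0 contributes. The terms with m ≥ 1, zero though they are, bring in the relation
    -- between the minors in every degree m; summed over l + m = i, the products q_l h_(m-j)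
    -- collapse by orthogonality.
    conv i (λ l m → δ 0 m ℚ.* ⟦ q l ⊥ N zero ⟧ β)
      ≡⟨ conv-cong i expand ⟩
    conv i (λ l m → altℚ λ j → ⟦ (q l * h (m ⊖ toℕ j)) ⊥ N j ⟧ β)
      ≡⟨ ∑≤-altℚ i (λ l j → ⟦ (q l * h ((i ∸ l) ⊖ toℕ j)) ⊥ N j ⟧ β) ⟩
    altℚ (λ j → conv i λ l m → ⟦ (q l * h (m ⊖ toℕ j)) ⊥ N j ⟧ β)
      ≡⟨ altℚ-cong collapse ⟩
    altℚ (λ j → δ i (toℕ j) ℚ.* ⟦ N j ⟧ β) ∎
    where
    N : Fin (suc n) → Λ
    N = minorΛ k
    expand : ∀ l m → δ 0 m ℚ.* ⟦ q l ⊥ N zero ⟧ β ≡ altℚ (λ j → ⟦ (q l * h (m ⊖ toℕ j)) ⊥ N j ⟧ β)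
    expand l m = begin
      δ 0 m ℚ.* ⟦ q l ⊥ N zero ⟧ β
        ≡⟨ cong (δ 0 m ℚ.*_) (⊥-pairʳ (q l) (N zero) β) ⟩
      δ 0 m ℚ.* pair p ⟦ N zero ⟧
        ≡⟨ pair-scale p (δ 0 m) ⟦ N zero ⟧ ⟨
      pair p (λ α → δ 0 m ℚ.* ⟦ N zero ⟧ α)
        ≡⟨ pair-cong p (alternating-minorsΛ k m) ⟨
      pair p (λ α → altℚ λ j → slice (m ⊖ toℕ j) ⟦ N j ⟧ α)
        ≡⟨ pair-altℚ p (λ j → slice (m ⊖ toℕ j) ⟦ N j ⟧) ⟩
      altℚ (λ j → pair p (slice (m ⊖ toℕ j) ⟦ N j ⟧))
        ≡⟨ altℚ-cong (λ j → begin
             pair p (slice (m ⊖ toℕ j) ⟦ N j ⟧)          ≡⟨ pair-cong p (h⊥ (m ⊖ toℕ j) (N j)) ⟨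
             pair p ⟦ h (m ⊖ toℕ j) ⊥ N j ⟧              ≡⟨ ⊥-pairʳ (q l) (h (m ⊖ toℕ j) ⊥ N j) β ⟨
             ⟦ q l ⊥ (h (m ⊖ toℕ j) ⊥ N j) ⟧ β           ≡⟨ ⊥-assoc (q l) (h (m ⊖ toℕ j)) (N j) β ⟩
             ⟦ (q l * h (m ⊖ toℕ j)) ⊥ N j ⟧ β           ∎) ⟩
      altℚ (λ j → ⟦ (q l * h (m ⊖ toℕ j)) ⊥ N j ⟧ β) ∎
      where
      p : Formal
      p = formalOf (q l * hprod β)
    collapse : ∀ j → conv i (λ l m → ⟦ (q l * h (m ⊖ toℕ j)) ⊥ N j ⟧ β) ≡ δ i (toℕ j) ℚ.* ⟦ N j ⟧ β
    collapse j = begin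
      conv i (λ l m → ⟦ (q l * h (m ⊖ toℕ j)) ⊥ N j ⟧ β)
        ≡⟨ conv-cong i (λ l m → ⊥-pairˡ (q l * h (m ⊖ toℕ j)) (N j) β) ⟩
      conv i (λ l m → pair p (mul (term l m) ⟦ hprod β ⟧))
        ≡⟨ pair-∑≤ i p (λ l → mul (term l (i ∸ l)) ⟦ hprod β ⟧) ⟨
      pair p (λ α → conv i λ l m → mul (term l m) ⟦ hprod β ⟧ α)
        ≡⟨ pair-cong p (λ α → trans (sym (mul-∑≤ i (λ l → term l (i ∸ l)) ⟦ hprod β ⟧ α))
             (trans (R.*-congʳ {⟦ hprod β ⟧} (e-h-orthogonality i (toℕ j)) α)
               (mul-scaleˡ (δ i (toℕ j)) R.1# ⟦ hprod β ⟧ α))) ⟩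
      pair p (λ α → δ i (toℕ j) ℚ.* mul R.1# ⟦ hprod β ⟧ α)
        ≡⟨ pair-scale p (δ i (toℕ j)) (mul R.1# ⟦ hprod β ⟧) ⟩
      δ i (toℕ j) ℚ.* pair p (mul R.1# ⟦ hprod β ⟧)
        ≡⟨ cong (δ i (toℕ j) ℚ.*_) (trans (sym (⊥-pairˡ 1Λ (N j) β)) (1⊥ (N j) β)) ⟩
      δ i (toℕ j) ℚ.* ⟦ N j ⟧ β ∎
      where
      p : Formal
      p = formalOf (N j)
      term : ℕ → ℕ → Series
      term l m = mul ⟦ q l ⟧ (H (m ⊖ toℕ j))

  B-s : ∀ {n} r (ν : Vec ℤ n) → B r (s ν) ≈ s (r ∷ ν)
  B-s {n} r ν β = begin
    ⟦ B r (s ν) ⟧ β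
      ≡⟨ B-at {N} r (s ν) (ℕₚ.m≤m⊔n (s ν .bound) n) β ⟩
    ∑≤ N (λ i → mul (H (r ℤ.+ + i)) ⟦ q i ⊥ s ν ⟧ β)
      ≡⟨ ∑≤-cong N (λ i → trans
           (R.*-congˡ {H (r ℤ.+ + i)} (λ γ → trans (⊥-congʳ (q i) (s ν) (minorΛ k zero) s≈ γ) (q⊥-minor k i γ)) β)
           (trans (mul-altℚ (H (r ℤ.+ + i)) (λ j γ → δ i (toℕ j) ℚ.* ⟦ minorΛ k j ⟧ γ) β)
             (altℚ-cong λ j → mul-scaleʳ (δ i (toℕ j)) (H (r ℤ.+ + i)) ⟦ minorΛ k j ⟧ β))) ⟩
    ∑≤ N (λ i → altℚ λ j → δ i (toℕ j) ℚ.* mul (H (r ℤ.+ + i)) ⟦ minorΛ k j ⟧ β)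
      ≡⟨ ∑≤-altℚ N (λ i j → δ i (toℕ j) ℚ.* mul (H (r ℤ.+ + i)) ⟦ minorΛ k j ⟧ β) ⟩
    altℚ (λ j → ∑≤ N λ i → δ i (toℕ j) ℚ.* mul (H (r ℤ.+ + i)) ⟦ minorΛ k j ⟧ β)
      ≡⟨ altℚ-cong (λ j → ∑≤-δ (λ i → mul (H (r ℤ.+ + i)) ⟦ minorΛ k j ⟧ β)
           (ℕₚ.≤-trans (ℕ.s≤s⁻¹ (Finₚ.toℕ<n j)) (ℕₚ.m≤n⊔m (s ν .bound) n))) ⟩
    altℚ (λ j → mul (H (r ℤ.+ + toℕ j)) ⟦ minorΛ k j ⟧ β)
      ≡⟨ altℚ-cong (λ j → mul-cong
           (λ γ → cong (λ z → H (z ℤ.+ + toℕ j) γ) (sym (ℤₚ.+-identityʳ r)))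
           (det-⟦⟧ λ i b → h (omit k j i b)) β) ⟩
    altℚ (λ j → mul (M zero j) (D.determinant (D.minor M j)) β)
      ≡⟨ alt-at (λ j → M zero j R.* D.determinant (D.minor M j)) β ⟨
    D.determinant M β
      ≡⟨ det-⟦⟧ (λ i j → h (lookup (r ∷ ν) i ℤ.- + toℕ i ℤ.+ + toℕ j)) β ⟨
    ⟦ s (r ∷ ν) ⟧ β ∎
    where
    N : ℕ
    -- Including n keeps every column index j ≤ n of the expansion within the cut-off.
    N = s ν .bound ℕ.⊔ n
    k : Fin n → ℤ
    -- Row i of s_ν is row i + 1 of s_(r, ν); with this shift s_ν is the minor of that larger
    -- determinant without column 0.
    k i = lookup ν i ℤ.- + suc (toℕ i)
    M : Fin (suc n) → Fin (suc n) → Series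
    M i j = H (lookup (r ∷ ν) i ℤ.- + toℕ i ℤ.+ + toℕ j)
    s≈ : s ν ≈ minorΛ k zero
    s≈ γ = trans (det-⟦⟧ (λ i j → h (lookup ν i ℤ.- + toℕ i ℤ.+ + toℕ j)) γ)
      (trans (D.determinant-cong (λ i j γ → cong (λ z → H z γ) (sym (shift-entry (lookup ν i) (toℕ i) (toℕ j)))) γ)
        (sym (det-⟦⟧ (λ i b → h (omit k zero i b)) γ)))

  Bᵥ-cong : ∀ {n} (ν : Vec ℤ n) F G → F ≈ G → Bᵥ ν F ≈ Bᵥ ν G
  Bᵥ-cong []      F G F≈G = F≈G
  Bᵥ-cong (r ∷ ν) F G F≈G = B-cong r (Bᵥ ν F) (Bᵥ ν G) (Bᵥ-cong ν F G F≈G)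

  Bᵥ-1 : ∀ {n} (ν : Vec ℤ n) → Bᵥ ν 1Λ ≈ s ν
  Bᵥ-1 []      α = refl
  Bᵥ-1 (r ∷ ν) α = trans (B-cong r (Bᵥ ν 1Λ) (s ν) (Bᵥ-1 ν) α) (B-s r ν α)

  -- Between consecutive factors b undoes a; the empty composite is where a must undo b.
  composite-conjugate : ∀ (a b : Λ → Λ) (op op′ : ℤ → Λ → Λ) →
    (∀ F G → F ≈ G → a F ≈ a G) → (∀ F G → F ≈ G → b F ≈ b G) → (∀ r F G → F ≈ G → op r F ≈ op r G) →
    (∀ F → a (b F) ≈ F) → (∀ F → b (a F) ≈ F) → (∀ r F → op′ r F ≈ a (op r (b F))) →
    ∀ {n} (ν : Vec ℤ n) F → composite (Vec.map op′ ν) F ≈ a (composite (Vec.map op ν) (b F))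
  composite-conjugate a b op op′ a-cong b-cong op-cong ab ba conj = go
    where
    go : ∀ {n} (ν : Vec ℤ n) F → composite (Vec.map op′ ν) F ≈ a (composite (Vec.map op ν) (b F))
    go []      F α = sym (ab F α)
    go (r ∷ ν) F α = begin
      ⟦ op′ r C ⟧ α            ≡⟨ conj r C α ⟩
      ⟦ a (op r (b C)) ⟧ α     ≡⟨ a-cong (op r (b C)) (op r G) (op-cong r (b C) G λ β →
                                    trans (b-cong C (a G) (go ν F) β) (ba G β)) α ⟩
      ⟦ a (op r G) ⟧ α         ∎
      where
      C G : Λ
      C = composite (Vec.map op′ ν) F
      G = composite (Vec.map op ν) (b F)

  ⊥̂Bᵥ-singleton : ∀ Φ Ψ r F → Φ ⊥̂ Bᵥ (r ∷ []) (Ψ ⊥̂ F) ≈ Φ ⊥̂ B r (Ψ ⊥̂ F)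
  ⊥̂Bᵥ-singleton Φ Ψ r F = ⊥̂-cong Φ (Bᵥ (r ∷ []) (Ψ ⊥̂ F)) (B r (Ψ ⊥̂ F)) λ _ → refl

  -- Skewing 1 detects only the constant term of Ψ, which is 1, so the inner operator disappears.
  ⊥̂Bᵥ-1 : ∀ {n} Φ Ψ → Unital (Ψ .coeff) → (ν : Vec ℤ n) → Φ ⊥̂ Bᵥ ν (Ψ ⊥̂ 1Λ) ≈ Φ ⊥̂ s ν
  ⊥̂Bᵥ-1 Φ Ψ Ψ-unital ν = ⊥̂-cong Φ (Bᵥ ν (Ψ ⊥̂ 1Λ)) (s ν) λ α →
    trans (Bᵥ-cong ν (Ψ ⊥̂ 1Λ) 1Λ Ψ⊥̂1 α) (Bᵥ-1 ν α)
    where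
    Ψ⊥̂1 : Ψ ⊥̂ 1Λ ≈ 1Λ
    Ψ⊥̂1 α = trans
      (⊥̂-≈ Ψ 1Λ 1Λ (λ γ γ≤0 → trans
        (Ψ-unital γ (ℕₚ.n≤0⇒n≡0 γ≤0)) (cong (δ 0) (sym (ℕₚ.n≤0⇒n≡0 γ≤0)))) α)
      (1⊥ 1Λ α)

  B^-singleton : ∀ ◇ r F → B^ ◇ (r ∷ []) F ≈ Ω[ Λ̂ʳ.- f ◇ .series ] ⊥̂ B r (Ω[ f ◇ .series ] ⊥̂ F)
  B^-singleton ◇ = ⊥̂Bᵥ-singleton Ω[ Λ̂ʳ.- f ◇ .series ] Ω[ f ◇ .series ]

  composite-B^ : ∀ ◇ {n} (ν : Vec ℤ n) F → composite (Vec.map (λ r → B^ ◇ (r ∷ [])) ν) F ≈ B^ ◇ ν F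
  composite-B^ ◇ = composite-conjugate (Ω[ Λ̂ʳ.- f ◇ .series ] ⊥̂_) (Ω[ f ◇ .series ] ⊥̂_) B (λ r → B^ ◇ (r ∷ []))
    (⊥̂-cong Ω[ Λ̂ʳ.- f ◇ .series ]) (⊥̂-cong Ω[ f ◇ .series ]) B-cong
    (⊥̂-inverse Ω[ Λ̂ʳ.- f ◇ .series ] Ω[ f ◇ .series ] (Ω-inverse (f ◇ .series)))
    (⊥̂-inverse Ω[ f ◇ .series ] Ω[ Λ̂ʳ.- f ◇ .series ]
      (R.trans (R.*-comm (Ω[ f ◇ .series ] .coeff) (Ω[ Λ̂ʳ.- f ◇ .series ] .coeff)) (Ω-inverse (f ◇ .series))))
    (B^-singleton ◇)

  B^-1 : ∀ ◇ {n} (ν : Vec ℤ n) → B^ ◇ ν 1Λ ≈ s^ ◇ ν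
  B^-1 ◇ = ⊥̂Bᵥ-1 Ω[ Λ̂ʳ.- f ◇ .series ] Ω[ f ◇ .series ] (Ω-unital (f ◇ .series))

mainTheorem1 : {S : ScalarProduct} (K : Skewing S) → let open Operators K in
    (◇ : Symbol) (n : ℕ) → 1 ≤ n → (ν : Vec ℤ n) →
    (composite (Vec.map (λ r → B^ ◇ (r ∷ [])) ν) 1Λ ≈ B^ ◇ ν 1Λ) × (B^ ◇ ν 1Λ ≈ s^ ◇ ν)
mainTheorem1 K ◇ n _ ν = composite-B^ ◇ ν 1Λ , B^-1 ◇ ν
  where open SkewingProperties K
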